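{- If the linear space hypothesis (LSH) for $\mathrm{2SAT}_3$ is true, then $\mathrm{L}\neq\mathrm{NL}$.
   Context: Turing machines are multi-tape with a read-only input tape; space counts work tapes only. A polylogarithmic function is $\ell(n)=p(\log n)$ for a polynomial $p$. $\mathrm{2SAT}_3$: instances are 2CNF Boolean formulas in which each variable $v$ has at most 3 occurrences in total of the literals $v,\overline{v}$; the question is whether the formula is satisfiable. $m_{vbl}(x)$ is the number of variables of $x$. LSH for $\mathrm{2SAT}_3$: for every $\varepsilon\in(0,1)$ and every polylogarithmic function $\ell$, no deterministic Turing machine solves $\mathrm{2SAT}_3$ simultaneously in polynomial time using at most $m_{vbl}(x)^{\varepsilon}\ell(|x|)$ space on every instance $x$. -}

module Defs where

open import Data.Nat using (ℕ; zero; suc; _+_; _*_; _^_; _≤_; _<_; _⊓_)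
open import Data.Nat.Properties using (_≟_)
open import Data.Nat.Logarithm using (⌊log₂_⌋)
open import Data.Nat.Binary.Base using (ℕᵇ; 2[1+_]; 1+[2_]; fromℕ)
open import Data.Fin using (Fin; zero; suc)
open import Data.Bool using (Bool; true; false; not)
open import Data.List using (List; []; _∷_; length; filter; map; concatMap; deduplicate; foldr)
open import Data.List.Membership.Propositional using (_∈_)
open import Data.List.Relation.Unary.All using (All)
open import Data.List.Relation.Unary.Any using (Any)
open import Data.Vec using (Vec; replicate; zipWith) renaming (map to vmap)
open import Data.Product using (Σ; ∃; _×_; _,_; proj₁; proj₂)
open import Data.Maybe using (Maybe; just; nothing)
open import Function.Bundles using (_⇔_)
open import Relation.Binary.PropositionalEquality using (_≡_)
open import Relation.Nullary using (¬_)

-- Turing machines: read-only input tape (with endmarkers) and k work tapes.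
-- One machine format; nondeterminism = a list of possible moves.

data Move : Set where
  left stay right : Move

data InSym (σ : ℕ) : Set where
  ⊢ ⊣ : InSym σ
  sym : Fin σ → InSym σ

record NTM (σ : ℕ) : Set where
  field
    Q  : ℕ
    k  : ℕ
    γ  : ℕ                       -- work alphabet is Fin (suc γ); zero = blank
    q₀ : Fin Q
    qacc : Fin Q
    δ  : Fin Q → InSym σ → Vec (Fin (suc γ)) k →
         List (Fin Q × Move × Vec (Fin (suc γ) × Move) k)

open NTM public

Deterministic : ∀ {σ} → NTM σ → Set
Deterministic M = ∀ q a w → length (δ M q a w) ≤ 1

record Tape (γ : ℕ) : Set where
  field
    cells : ℕ → Fin (suc γ)
    head  : ℕ
open Tape public

record Config {σ : ℕ} (M : NTM σ) : Set where
  field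
    state : Fin (Q M)
    ipos  : ℕ                    -- input head: 0 = ⊢, 1..n = input, n+1 = ⊣
    tapes : Vec (Tape (γ M)) (k M)
open Config public

lookupMaybe : ∀ {A : Set} → List A → ℕ → Maybe A
lookupMaybe []       _       = nothing
lookupMaybe (a ∷ _)  zero    = just a
lookupMaybe (_ ∷ as) (suc i) = lookupMaybe as i

readIn : ∀ {σ} → List (Fin σ) → ℕ → InSym σ
readIn x zero = ⊢
readIn x (suc i) with lookupMaybe x i
... | just a  = sym a
... | nothing = ⊣

moveHead : Move → ℕ → ℕ
moveHead left  zero    = zero
moveHead left  (suc h) = h
moveHead stay  h       = h
moveHead right h       = suc h

writeCell : ∀ {γ} → (ℕ → Fin (suc γ)) → ℕ → Fin (suc γ) → ℕ → Fin (suc γ)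
writeCell f h s i with i ≟ h
... | Relation.Nullary.yes _ = s
... | Relation.Nullary.no  _ = f i

updTape : ∀ {γ} → Tape γ → Fin (suc γ) × Move → Tape γ
updTape t (s , m) = record { cells = writeCell (cells t) (head t) s
                           ; head  = moveHead m (head t) }

readTape : ∀ {γ} → Tape γ → Fin (suc γ)
readTape t = cells t (head t)

blankTape : ∀ {γ} → Tape γ
blankTape = record { cells = λ _ → zero ; head = 0 }

initial : ∀ {σ} (M : NTM σ) → Config M
initial M = record { state = q₀ M ; ipos = 0 ; tapes = replicate _ blankTape }

apply : ∀ {σ} (M : NTM σ) → List (Fin σ) →
        Fin (Q M) × Move × Vec (Fin (suc (γ M)) × Move) (k M) →
        Config M → Config M
apply M x (q , m , ws) c = record
  { state = q
  ; ipos  = moveHead m (ipos c) ⊓ suc (length x)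
  ; tapes = zipWith updTape (tapes c) ws }

Step : ∀ {σ} (M : NTM σ) → List (Fin σ) → Config M → Config M → Set
Step M x c c' =
  Σ _ λ o → (o ∈ δ M (state c) (readIn x (ipos c)) (vmap readTape (tapes c)))
          × (c' ≡ apply M x o c)

data Reach {σ} (M : NTM σ) (x : List (Fin σ)) : ℕ → Config M → Set where
  start : Reach M x 0 (initial M)
  step  : ∀ {t c c'} → Reach M x t c → Step M x c c' → Reach M x (suc t) c'

Accepts : ∀ {σ} → NTM σ → List (Fin σ) → Set
Accepts M x = ∃ λ t → ∃ λ c → Reach M x t c × state c ≡ qacc M

TimeWithin : ∀ {σ} → NTM σ → List (Fin σ) → ℕ → Set
TimeWithin M x T = ∀ t c → Reach M x t c → t ≤ T

-- space of a configuration: work head positions (cells visited beyond the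
-- first one on each tape); P is the admissible-space predicate
SpaceWithin : ∀ {σ} → NTM σ → List (Fin σ) → (ℕ → Set) → Set
SpaceWithin M x P = ∀ t c → Reach M x t c → Data.Vec.Relation.Unary.All.All (λ tp → P (head tp)) (tapes c)
  where import Data.Vec.Relation.Unary.All

Language : ℕ → Set₁
Language σ = List (Fin σ) → Set

Decides : ∀ {σ} → NTM σ → Language σ → Set
Decides M A = ∀ x → A x ⇔ Accepts M x

LogSpace : ∀ {σ} → NTM σ → Set
LogSpace M = ∃ λ c → ∀ x → SpaceWithin M x (λ h → h ≤ c * ⌊log₂ length x ⌋ + c)

InL : ∀ {σ} → Language σ → Set
InL {σ} A = Σ (NTM σ) λ M → Deterministic M × LogSpace M × Decides M A

InNL : ∀ {σ} → Language σ → Set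
InNL {σ} A = Σ (NTM σ) λ M → LogSpace M × Decides M A

L≡NL : Set₁
L≡NL = ∀ σ (A : Language σ) → InL A ⇔ InNL A

L≢NL : Set₁
L≢NL = ¬ L≡NL

record Literal : Set where
  constructor lit
  field
    positive : Bool
    var      : ℕ
open Literal public

Clause : Set
Clause = List Literal

Formula : Set
Formula = List Clause

literals : Formula → List Literal
literals φ = concatMap (λ c → c) φ

mvbl : Formula → ℕ
mvbl φ = length (deduplicate _≟_ (map var (literals φ)))

occurrences : Formula → ℕ → ℕ
occurrences φ v = length (filter (λ l → var l ≟ v) (literals φ))

Is2SAT₃ : Formula → Set
Is2SAT₃ φ = All (λ c → length c ≤ 2) φ × (∀ v → occurrences φ v ≤ 3)

evalLit : (ℕ → Bool) → Literal → Bool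
evalLit a (lit true  v) = a v
evalLit a (lit false v) = not (a v)

Satisfiable : Formula → Set
Satisfiable φ = ∃ λ (a : ℕ → Bool) → All (Any (λ l → evalLit a l ≡ true)) φ

-- encoding over the 5-letter alphabet: 0 = digit 1, 1 = digit 2,
-- 2 = '+' (positive literal), 3 = '-' (negative literal), 4 = clause end.
-- Variable indices are written in bijective base 2 (via ℕᵇ), least digit first.
encBin : ℕᵇ → List (Fin 5)
encBin Data.Nat.Binary.Base.zero = []
encBin 2[1+ b ] = suc zero ∷ encBin b
encBin 1+[2 b ] = zero ∷ encBin b

encLit : Literal → List (Fin 5)
encLit (lit true  v) = suc (suc zero) ∷ encBin (fromℕ v)
encLit (lit false v) = suc (suc (suc zero)) ∷ encBin (fromℕ v)

encClause : Clause → List (Fin 5)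
encClause c = foldr (λ l r → Data.List._++_ (encLit l) r) (suc (suc (suc (suc zero))) ∷ []) c

encode : Formula → List (Fin 5)
encode φ = concatMap encClause φ

evalPoly : List ℕ → ℕ → ℕ
evalPoly []       _ = 0
evalPoly (a ∷ as) y = a + y * evalPoly as y

polylog : List ℕ → ℕ → ℕ
polylog p n = evalPoly p ⌊log₂ n ⌋

-- M solves 2SAT₃ in time c·n^d + c and space m_vbl(x)^(e₁/e₂)·ℓ(|x|)
-- (space s ≤ m^(e₁/e₂)·ℓ  written as  s^e₂ ≤ m^e₁ · ℓ^e₂)
Solves2SAT₃ : NTM 5 → (c d : ℕ) → (e₁ e₂ : ℕ) → (ℓ : List ℕ) → Set
Solves2SAT₃ M c d e₁ e₂ ℓ =
  ∀ φ → Is2SAT₃ φ →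
    let x = encode φ in
    TimeWithin M x (c * length x ^ d + c)
    × SpaceWithin M x (λ h → h ^ e₂ ≤ mvbl φ ^ e₁ * polylog ℓ (length x) ^ e₂)
    × (Satisfiable φ ⇔ Accepts M x)

LSH : Set
LSH = ∀ (e₁ e₂ : ℕ) → 0 < e₁ → e₁ < e₂ → ∀ (ℓ : List ℕ) →
      ¬ (Σ (NTM 5) λ M → Deterministic M × ∃ λ c → ∃ λ d → Solves2SAT₃ M c d e₁ e₂ ℓ)

{-# OPTIONS --safe #-}
-- Suppose L = NL. A 2CNF formula without empty clauses is unsatisfiable iff some literal z
-- satisfies z ⇝ ¬z ⇝ z in the implication graph. Names of variables may be long, so they
-- cannot be copied to a work tape, but a nondeterministic automaton with three heads on the
-- input can guess such a chain and compare names letter by letter. Such an automaton runs in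
-- logarithmic space, so by assumption a deterministic logspace machine M accepts the same inputs.
--
-- M may run forever, and the answer has to be negated. A machine with space s = O(log n) has at most
-- b^(log n + 1) configurations, so if M accepts, it does so within that many steps. Run M in
-- parallel with a clock, a counter of about log n digits in a large enough base, and accept when
-- the clock overflows or M gets stuck. The new machine halts, hence repeats no configuration, and so
-- is polynomial in time. Its space is at most m^(1/2) times a linear function of log n as soon as
-- there is a variable; formulas without variables are decided by a finite automaton.
module Submission where

open import Defs
open import Data.Nat using (ℕ; zero; suc; _+_; _*_; _^_; _∸_; _≤_; _<_; _⊓_; ⌊_/2⌋; ⌈_/2⌉; z≤n; s≤s)
import Data.Nat.Properties as ℕ
open import Data.Nat.Induction using (<-wellFounded)
open import Data.Nat.Logarithm using (⌊log₂_⌋; ⌊log₂⌋-mono-≤; ⌊log₂⌊n/2⌋⌋≡⌊log₂n⌋∸1)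
open import Data.Nat.Solver using (module +-*-Solver)
open import Data.Bool using (Bool; true; false; not)
open import Data.Fin using (Fin; zero; suc; toℕ; fromℕ<; combine; remQuot; splitAt; join; funToFin; finToFun)
open import Data.Fin.Patterns using (0F; 1F; 2F; 3F; 4F; 5F; 6F; 7F; 8F; 9F)
import Data.Fin.Properties as Fin
open import Data.Vec as Vec using (Vec; []; _∷_; lookup)
import Data.Vec.Properties as Vec
import Data.Vec.Relation.Unary.All as VecAll
import Data.Vec.Relation.Unary.All.Properties as VecAll
open import Data.List as List using (List; []; _∷_; length; _++_; _ʳ++_)
import Data.List.Properties as List
open import Data.List.Membership.Propositional using (_∈_; _∉_)
import Data.List.Membership.Propositional.Properties as Membership
open import Data.Maybe using (Maybe; just; nothing; maybe′)
open import Data.Product using (Σ; ∃; ∃₂; _×_; _,_; proj₁; proj₂)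
open import Data.Sum using (_⊎_; inj₁; inj₂)
open import Data.Empty using (⊥; ⊥-elim)
open import Function using (_∘_; id)
open import Function.Bundles using (_⇔_; mk⇔; Equivalence)
open import Induction.WellFounded using (Acc; acc)
open import Relation.Binary.PropositionalEquality as ≡ using (_≡_; _≢_; refl; trans; cong; cong₂; subst)
open import Relation.Nullary using (¬_; yes; no; contradiction; Dec)
open import Data.List.Relation.Unary.All as All using (All; []; _∷_)
import Data.List.Relation.Unary.All.Properties as All
open import Data.List.Relation.Unary.Any as Any using (Any; here; there)
open import Data.List.Membership.DecPropositional ℕ._≟_ using (_∈?_)
import Data.Bool.Properties as Bool
open import Data.Nat.Binary.Base as ℕᵇ using (ℕᵇ; 2[1+_]; 1+[2_]; fromℕ)
open import Data.Nat.Binary.Properties using (fromℕ-injective)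
open import Relation.Binary.Construct.Closure.ReflexiveTransitive using (Star; ε; _◅_; _◅◅_)
open import Relation.Nullary.Decidable using (¬¬-excluded-middle; decidable-stable)

-- Runs of transition systems and of machines

-- Claims about time, space and rejection concern every run of a machine, not one chosen run.
-- Stretches without choice are therefore described by `Forced`, which produces a run and at the
-- same time controls all runs; the simulation lemmas extend this to nondeterministic steps. The
-- logic is constructive. Whether one literal implies another is not decided, so the assignment for
-- a consistent formula is at first found only up to double negation, and a finite search for
-- assignments removes it. The clock must have more than log n digits although n is not known to the
-- machine. The input head goes from the right end to the left and its moves are counted in binary.
-- The same digits are then read in a base `b + 2` as the initial state of the clock; being 0 or 1,
-- they leave it far from overflow. A formula without variables has space bound 0, so no work head
-- may leave cell 0. This is why the input is scanned before the clock is built.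

data Run {S : Set} (R : S → S → Set) : ℕ → S → S → Set where
  []  : ∀ {s} → Run R 0 s s
  _∷_ : ∀ {n s t u} → R s t → Run R n t u → Run R (suc n) s u

infixr 5 _++ʳ_ _++ᶠ_

_++ʳ_ : ∀ {S : Set} {R : S → S → Set} {m n s t u} → Run R m s t → Run R n t u → Run R (m + n) s u
[]      ++ʳ q = q
(x ∷ p) ++ʳ q = x ∷ (p ++ʳ q)

split-run : ∀ {S : Set} {R : S → S → Set} m {n s u} → Run R (m + n) s u → ∃ λ t → Run R m s t × Run R n t u
split-run zero    p       = _ , [] , p
split-run (suc m) (x ∷ p) with split-run m p
... | t , q , r = t , x ∷ q , r

Only : ∀ {S : Set} → (S → S → Set) → S → S → Set
Only R s t = R s t × (∀ {u} → R s u → u ≡ t)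

-- A stretch of computation without any choice, all of whose states but the
-- last satisfy P.
data Forced {S : Set} (R : S → S → Set) (P : S → Set) : S → S → Set where
  []  : ∀ {s} → Forced R P s s
  _∷_ : ∀ {s t u} → P s × Only R s t → Forced R P t u → Forced R P s u

_++ᶠ_ : ∀ {S : Set} {R : S → S → Set} {P : S → Set} {s t u} → Forced R P s t → Forced R P t u → Forced R P s u
[]      ++ᶠ q = q
(x ∷ p) ++ᶠ q = x ∷ (p ++ᶠ q)

∣_∣ᶠ : ∀ {S : Set} {R : S → S → Set} {P : S → Set} {s t} → Forced R P s t → ℕ
∣ [] ∣ᶠ    = 0
∣ _ ∷ p ∣ᶠ = suc ∣ p ∣ᶠ

forced⇒run : ∀ {S : Set} {R : S → S → Set} {P : S → Set} {s t} (p : Forced R P s t) → Run R ∣ p ∣ᶠ s t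
forced⇒run []                    = []
forced⇒run ((_ , r , _) ∷ p) = r ∷ forced⇒run p

-- `Only` leaves the run no alternative, so both are consumed in step. The first outcome serves to
-- exclude acceptance: in every use, `P` says that the state is not accepting.
run-along : ∀ {S : Set} {R : S → S → Set} {P : S → Set} {s t n u} (p : Forced R P s t) → Run R n s u →
            P u ⊎ (∃ λ m → n ≡ ∣ p ∣ᶠ + m × Run R m t u)
run-along []                    q       = inj₂ (_ , refl , q)
run-along ((Ps , _) ∷ p)       []      = inj₁ Ps
run-along ((_ , _ , only) ∷ p) (r ∷ q) with only r
... | refl with run-along p q
...   | inj₁ Pu             = inj₁ Pu
...   | inj₂ (m , eq , q′) = inj₂ (m , cong suc eq , q′)

Stuck : ∀ {S : Set} → (S → S → Set) → S → Set
Stuck R s = ∀ {t} → ¬ R s t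

run-from-stuck : ∀ {S : Set} {R : S → S → Set} {n s t} → Stuck R s → Run R n s t → n ≡ 0 × t ≡ s
run-from-stuck st []      = refl , refl
run-from-stuck st (r ∷ _) = ⊥-elim (st r)

run-bounded : ∀ {S : Set} {R : S → S → Set} {P : S → Set} {s t n u} (p : Forced R P s t) → Stuck R t → Run R n s u → n ≤ ∣ p ∣ᶠ
run-bounded p                     st []      = z≤n
run-bounded []                    st (r ∷ _) = ⊥-elim (st r)
run-bounded ((_ , _ , only) ∷ p) st (r ∷ q) with only r
... | refl = s≤s (run-bounded p st q)

module _ {C S : Set} {R : C → C → Set} {T : S → S → Set} {P : C → Set} {Rep : C → S → Set}
  (forth : ∀ {c s s′} → Rep c s → T s s′ → ∃₂ λ c₁ c′ → R c c₁ × Forced R P c₁ c′ × Rep c′ s′)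
  (back  : ∀ {c s c₁} → Rep c s → R c c₁ → ∃₂ λ s′ c′ → T s s′ × Forced R P c₁ c′ × Rep c′ s′) where

  simulate : ∀ {c s n s′} → Rep c s → Run T n s s′ → ∃₂ λ m c′ → Run R m c c′ × Rep c′ s′
  simulate rep []      = _ , _ , [] , rep
  simulate rep (s ∷ p) with forth rep s
  ... | _ , _ , r , q , rep′ with simulate rep′ p
  ...   | _ , c′ , q′ , rep″ = _ , c′ , r ∷ (forced⇒run q ++ʳ q′) , rep″

  -- An arbitrary run may stop inside the stretch that follows a simulated step, where only `P` is
  -- known. The recursion is on the length because the rest of the run returned by `run-along` is
  -- not a subterm.
  unsimulate : ∀ {c s n d} → Rep c s → Run R n c d → P d ⊎ (∃₂ λ m s′ → Run T m s s′ × Rep d s′)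
  unsimulate {n = n} = go (<-wellFounded n)
    where
    go : ∀ {c s n d} → Acc _<_ n → Rep c s → Run R n c d → P d ⊎ (∃₂ λ m s′ → Run T m s s′ × Rep d s′)
    go _         rep []      = inj₂ (_ , _ , [] , rep)
    go (acc rec) rep (r ∷ p) with back rep r
    ... | _ , _ , s , q , rep′ with run-along q p
    ...   | inj₁ Pd             = inj₁ Pd
    ...   | inj₂ (m , refl , p′) with go (rec (s≤s (ℕ.m≤n+m m ∣ q ∣ᶠ))) rep′ p′
    ...     | inj₁ Pd                    = inj₁ Pd
    ...     | inj₂ (_ , s′ , q′ , rep″) = inj₂ (_ , s′ , s ∷ q′ , rep″)

module _ {σ} (M : NTM σ) (x : List (Fin σ)) where

  reach-run : ∀ {m n c d} → Reach M x m c → Run (Step M x) n c d → Reach M x (m + n) d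
  reach-run {m} r []      = subst (λ k → Reach M x k _) (≡.sym (ℕ.+-identityʳ m)) r
  reach-run {m} {suc n} {d = d} r (s ∷ p) = subst (λ k → Reach M x k d) (≡.sym (ℕ.+-suc m n)) (reach-run (step r s) p)

  run⇒reach : ∀ {n c} → Run (Step M x) n (initial M) c → Reach M x n c
  run⇒reach = reach-run start

  snoc-run : ∀ {n c d e} → Run (Step M x) n c d → Step M x d e → Run (Step M x) (suc n) c e
  snoc-run []      s = s ∷ []
  snoc-run (r ∷ p) s = r ∷ snoc-run p s

  reach⇒run : ∀ {n c} → Reach M x n c → Run (Step M x) n (initial M) c
  reach⇒run start      = []
  reach⇒run (step r s) = snoc-run (reach⇒run r) s

  only-step : ∀ {c o} → δ M (state c) (readIn x (ipos c)) (Vec.map readTape (tapes c)) ≡ o ∷ [] →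
              Only (Step M x) c (apply M x o c)
  only-step {c} {o} eq = (o , subst (o ∈_) (≡.sym eq) (here refl) , refl) , unique
    where
    unique : ∀ {u} → Step M x c u → u ≡ apply M x o c
    unique (o′ , o′∈ , refl) with subst (o′ ∈_) eq o′∈
    ... | here refl = refl

  no-step : ∀ {c} → δ M (state c) (readIn x (ipos c)) (Vec.map readTape (tapes c)) ≡ [] → Stuck (Step M x) c
  no-step eq (o , o∈ , _) with () ← subst (o ∈_) eq o∈

  step-unique : Deterministic M → ∀ {c d e} → Step M x c d → Step M x c e → d ≡ e
  step-unique det {c} (o , o∈ , refl) (o′ , o′∈ , refl)
    with δ M (state c) (readIn x (ipos c)) (Vec.map readTape (tapes c))
       | det (state c) (readIn x (ipos c)) (Vec.map readTape (tapes c))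
  step-unique det (o , here refl , refl) (o′ , here refl , refl) | _ ∷ [] | _ = refl
  step-unique det _ _ | _ ∷ _ ∷ _ | s≤s ()

module Halting {σ} (M : NTM σ) (x : List (Fin σ)) (s : ℕ) where

  Within : Config M → Set
  Within c = ∀ i → head (lookup (tapes c) i) ≤ s

  Inner : Config M → Set
  Inner c = Within c × state c ≢ qacc M

  -- From the initial configuration, one path serves three purposes: every reachable configuration
  -- lies on it (space), its length bounds all runs (time), and its last state separates `A` from
  -- `¬ A`, no earlier state being accepting (correctness).
  record Verdict (c : Config M) (A : Set) : Set where
    constructor verdict
    field
      {last}  : Config M
      path    : Forced (Step M x) Inner c last
      halted  : Stuck (Step M x) last
      inside  : Within last
      outcome : (state last ≡ qacc M × A) ⊎ (state last ≢ qacc M × ¬ A)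

  verdict-⇔ : ∀ {c A B} → (A → B) → (B → A) → Verdict c A → Verdict c B
  verdict-⇔ f g (verdict p h i (inj₁ (st , a)))   = verdict p h i (inj₁ (st , f a))
  verdict-⇔ f g (verdict p h i (inj₂ (rej , ¬a))) = verdict p h i (inj₂ (rej , ¬a ∘ g))

  verdict-after : ∀ {c d A} → Forced (Step M x) Inner c d → Verdict d A → Verdict c A
  verdict-after p (verdict q h i o) = verdict (p ++ᶠ q) h i o

  module _ {A : Set} (v : Verdict (initial M) A) where

    open Verdict v

    private
      end-of : ∀ {t d} → Reach M x t d → Inner d ⊎ d ≡ last
      end-of r with run-along path (reach⇒run M x r)
      ... | inj₁ inner       = inj₁ inner
      ... | inj₂ (_ , _ , p) = inj₂ (proj₂ (run-from-stuck halted p))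

    verdict-space : SpaceWithin M x (_≤ s)
    verdict-space t d r with end-of r
    ... | inj₁ (within , _) = VecAll.lookup⁻ within
    ... | inj₂ refl         = VecAll.lookup⁻ inside

    verdict-time : TimeWithin M x ∣ path ∣ᶠ
    verdict-time t d r = run-bounded path halted (reach⇒run M x r)

    verdict-accepts : A ⇔ Accepts M x
    verdict-accepts = mk⇔ to from
      where
      to : A → Accepts M x
      to a with outcome
      ... | inj₁ (final , _) = _ , last , run⇒reach M x (forced⇒run path) , final
      ... | inj₂ (_ , ¬a)    = contradiction a ¬a
      from : Accepts M x → A
      from (t , d , r , final) with end-of r | outcome
      ... | inj₁ (_ , ≢acc) | _                = contradiction final ≢acc
      ... | inj₂ _          | inj₁ (_ , a)     = a
      ... | inj₂ refl       | inj₂ (≢acc , _) = contradiction final ≢acc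

-- `us ʳ++ ys` is a text with a cursor between `us`, stored nearest letter first, and `ys`. Moving
-- the cursor over a letter does not change the text, and this holds by computation. Tapes and the
-- input are both described in this way.
lookupMaybe-ʳ++ : ∀ {A : Set} (us ys : List A) i → lookupMaybe (us ʳ++ ys) (length us + i) ≡ lookupMaybe ys i
lookupMaybe-ʳ++ []       ys i = refl
lookupMaybe-ʳ++ (u ∷ us) ys i =
  trans (cong (lookupMaybe (us ʳ++ (u ∷ ys))) (≡.sym (ℕ.+-suc (length us) i))) (lookupMaybe-ʳ++ us (u ∷ ys) (suc i))

lookupMaybe-zip : ∀ {A : Set} (us ys : List A) → lookupMaybe (us ʳ++ ys) (length us) ≡ lookupMaybe ys 0
lookupMaybe-zip us ys =
  trans (cong (lookupMaybe (us ʳ++ ys)) (≡.sym (ℕ.+-identityʳ (length us)))) (lookupMaybe-ʳ++ us ys 0)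

readIn-zip : ∀ {σ} (us : List (Fin σ)) {a ys} → readIn (us ʳ++ (a ∷ ys)) (suc (length us)) ≡ sym a
readIn-zip us {a} {ys} rewrite lookupMaybe-zip us (a ∷ ys) = refl

readIn-end : ∀ {σ} (x : List (Fin σ)) → readIn x (suc (length x)) ≡ ⊣
readIn-end []      = refl
readIn-end (a ∷ x) = readIn-end′ x
  where
  look : ∀ {σ} (x : List (Fin σ)) → lookupMaybe x (length x) ≡ nothing
  look []      = refl
  look (_ ∷ x) = look x
  readIn-end′ : ∀ x → readIn (a ∷ x) (suc (suc (length x))) ≡ ⊣
  readIn-end′ x rewrite look x = refl

readIn-suc : ∀ {σ} (x : List (Fin σ)) i → readIn x (suc i) ≢ ⊢
readIn-suc x i eq with lookupMaybe x i
readIn-suc x i () | just _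
readIn-suc x i () | nothing

-- Repetitions among the configurations of a space-bounded machine

vec-ext : ∀ {A : Set} {n} {xs ys : Vec A n} → (∀ i → lookup xs i ≡ lookup ys i) → xs ≡ ys
vec-ext {xs = []}     {[]}     eq = refl
vec-ext {xs = x ∷ xs} {y ∷ ys} eq = cong₂ _∷_ (eq zero) (vec-ext (eq ∘ suc))

_≋_ : ∀ {γ} → Tape γ → Tape γ → Set
s ≋ t = head s ≡ head t × (∀ j → cells s j ≡ cells t j)

read-≋ : ∀ {γ} {s t : Tape γ} → s ≋ t → readTape s ≡ readTape t
read-≋ {s = s} {t} (refl , eq) = eq (head s)

updTape-≋ : ∀ {γ} {s t : Tape γ} → s ≋ t → ∀ w → updTape s w ≋ updTape t w
updTape-≋ {s = record { cells = f ; head = h }} {record { cells = g }} (refl , eq) (a , _) = refl , cells-eq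
  where
  cells-eq : ∀ j → writeCell f h a j ≡ writeCell g h a j
  cells-eq j with j ℕ.≟ h
  ... | yes _ = refl
  ... | no  _ = eq j

record _≈_ {σ} {M : NTM σ} (c d : Config M) : Set where
  constructor ≈-intro
  field
    state-≡ : state c ≡ state d
    ipos-≡  : ipos c ≡ ipos d
    tapes-≋ : ∀ i → lookup (tapes c) i ≋ lookup (tapes d) i

-- Capping makes the code of a configuration total. Injectivity is only claimed for numbers within
-- the bound, which is where reachable configurations live.
clamp : ∀ s → ℕ → Fin (suc s)
clamp s m = fromℕ< (s≤s (ℕ.m⊓n≤n m s))

clamp-injective : ∀ {s m n} → m ≤ s → n ≤ s → clamp s m ≡ clamp s n → m ≡ n
clamp-injective {s} {m} {n} m≤ n≤ eq = trans (≡.sym (value m≤)) (trans (cong toℕ eq) (value n≤))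
  where
  value : ∀ {m} → m ≤ s → toℕ (clamp s m) ≡ m
  value {m} m≤ = trans (Fin.toℕ-fromℕ< (s≤s (ℕ.m⊓n≤n m s))) (ℕ.m≤n⇒m⊓n≡m m≤)

funToFin-injective : ∀ {m n} {f g : Fin m → Fin n} → funToFin f ≡ funToFin g → ∀ i → f i ≡ g i
funToFin-injective {f = f} {g} eq i =
  trans (≡.sym (Fin.finToFun-funToFin f i)) (trans (cong (λ h → finToFun h i) eq) (Fin.finToFun-funToFin g i))

tapeCode : ∀ {γ} s → Tape γ → Fin (suc s * suc γ ^ suc s)
tapeCode s t = combine (clamp s (head t)) (funToFin (λ (j : Fin (suc s)) → cells t (toℕ j)))

tapeCode-injective : ∀ {γ s} {t u : Tape γ} → head t ≤ s → head u ≤ s →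
                     (∀ j → s < j → cells t j ≡ zero) → (∀ j → s < j → cells u j ≡ zero) →
                     tapeCode s t ≡ tapeCode s u → t ≋ u
tapeCode-injective {γ} {s} {t} {u} t≤ u≤ blankₜ blankᵤ eq = clamp-injective t≤ u≤ (proj₁ both) , same
  where
  content : Tape γ → Fin (suc s) → Fin (suc γ)
  content t j = cells t (toℕ j)
  both : clamp s (head t) ≡ clamp s (head u) × funToFin (content t) ≡ funToFin (content u)
  both = Fin.combine-injective (clamp s (head t)) (funToFin (content t)) (clamp s (head u)) (funToFin (content u)) eq
  same : ∀ j → cells t j ≡ cells u j
  same j with j ℕ.≤? s
  ... | no  j≰s = trans (blankₜ j (ℕ.≰⇒> j≰s)) (≡.sym (blankᵤ j (ℕ.≰⇒> j≰s)))
  ... | yes j≤s = subst (λ m → cells t m ≡ cells u m) (Fin.toℕ-fromℕ< (s≤s j≤s))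
                    (funToFin-injective {f = content t} {content u} (proj₂ both) (fromℕ< (s≤s j≤s)))

-- The input head has the n + 2 positions 0, ..., n + 1, endmarkers included. Each work tape
-- contributes a head position and the contents of the cells 0, ..., s.
#configs : ∀ {σ} → NTM σ → ℕ → ℕ → ℕ
#configs M n s = Q M * (suc (suc n) * (suc s * suc (γ M) ^ suc s) ^ k M)

module _ {σ} (M : NTM σ) (x : List (Fin σ)) where

  private
    _⟶_ : Config M → Config M → Set
    _⟶_ = Step M x

  ≈-step : ∀ {c d c′} → c ≈ d → c ⟶ c′ → ∃ λ d′ → d ⟶ d′ × c′ ≈ d′
  ≈-step {c} {d} (≈-intro refl refl ts) (o@(q , m , ws) , o∈ , refl) =
    apply M x o d , (o , subst (λ v → o ∈ δ M (state c) (readIn x (ipos c)) v) reads o∈ , refl) ,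
    ≈-intro refl refl moved
    where
    reads : Vec.map readTape (tapes c) ≡ Vec.map readTape (tapes d)
    reads = vec-ext λ i → begin
      lookup (Vec.map readTape (tapes c)) i ≡⟨ Vec.lookup-map i readTape (tapes c) ⟩
      readTape (lookup (tapes c) i)         ≡⟨ read-≋ (ts i) ⟩
      readTape (lookup (tapes d) i)         ≡⟨ Vec.lookup-map i readTape (tapes d) ⟨
      lookup (Vec.map readTape (tapes d)) i ∎
      where open ≡.≡-Reasoning
    moved : ∀ i → lookup (Vec.zipWith updTape (tapes c) ws) i ≋ lookup (Vec.zipWith updTape (tapes d) ws) i
    moved i rewrite Vec.lookup-zipWith updTape i (tapes c) ws | Vec.lookup-zipWith updTape i (tapes d) ws =
      updTape-≋ (ts i) (lookup ws i)

  ≈-sym : ∀ {c d : Config M} → c ≈ d → d ≈ c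
  ≈-sym (≈-intro p q r) = ≈-intro (≡.sym p) (≡.sym q) λ i → ≡.sym (proj₁ (r i)) , λ j → ≡.sym (proj₂ (r i) j)

  ≈-run : ∀ {n c d c′} → c ≈ d → Run _⟶_ n c c′ → ∃ λ d′ → Run _⟶_ n d d′ × c′ ≈ d′
  ≈-run c≈d []      = _ , [] , c≈d
  ≈-run c≈d (r ∷ p) with ≈-step c≈d r
  ... | _ , r′ , c′≈d′ with ≈-run c′≈d′ p
  ...   | _ , p′ , eq = _ , r′ ∷ p′ , eq

  -- Both repeated configurations come with their runs to the end `c`: continuing from the earlier
  -- one as from the later cuts the loop out, and continuing from the later one as from the earlier
  -- traverses it again.
  record Repetition (t : ℕ) (c : Config M) : Set where
    constructor repetition
    field
      {i j}   : ℕ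
      {cᵢ cⱼ} : Config M
      i<j     : i < j
      j≤t     : j ≤ t
      reachᵢ  : Reach M x i cᵢ
      reachⱼ  : Reach M x j cⱼ
      runᵢ    : Run _⟶_ (t ∸ i) cᵢ c
      runⱼ    : Run _⟶_ (t ∸ j) cⱼ c
      repeats : cᵢ ≈ cⱼ

  visited : ∀ {t c i} → Reach M x t c → i ≤ t → ∃ λ d → Reach M x i d × Run _⟶_ (t ∸ i) d c
  visited {t} {c} {i} r i≤t
    with split-run i (subst (λ n → Run _⟶_ n (initial M) c) (≡.sym (ℕ.m+[n∸m]≡n i≤t)) (reach⇒run M x r))
  ... | d , p , q = d , run⇒reach M x p , q

  module _ {K : ℕ} (repeated : ∀ {t c} → Reach M x t c → K ≤ t → Repetition t c) where

    -- Cutting the loop between two equal configurations shortens an accepting run.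
    accepts-early : ∀ {t c} → Reach M x t c → state c ≡ qacc M →
                    ∃₂ λ u d → u < K × Reach M x u d × state d ≡ qacc M
    accepts-early {t} r = go t (<-wellFounded t) r
      where
      go : ∀ t → Acc _<_ t → ∀ {c} → Reach M x t c → state c ≡ qacc M →
           ∃₂ λ u d → u < K × Reach M x u d × state d ≡ qacc M
      go t (acc rec) {c} r final with t ℕ.<? K
      ... | yes t<K = t , c , t<K , r , final
      ... | no  t≮K with repeated r (ℕ.≮⇒≥ t≮K)
      ...   | repetition {i} {j} i<j j≤t rᵢ rⱼ pᵢ pⱼ cᵢ≈cⱼ
              with ≈-run (≈-sym cᵢ≈cⱼ) pⱼ
      ...     | _ , p , c≈d = go (i + (t ∸ j)) (rec shorter) (reach-run M x rᵢ p)
                                (trans (≡.sym (_≈_.state-≡ c≈d)) final)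
        where
        shorter : i + (t ∸ j) < t
        shorter = subst (i + (t ∸ j) <_) (ℕ.m+[n∸m]≡n j≤t) (ℕ.+-monoˡ-< (t ∸ j) i<j)

    -- A run that is longer than the number of configurations can be prolonged forever.
    halting⇒early : ∀ T → TimeWithin M x T → TimeWithin M x K
    halting⇒early T bound t c r with t ℕ.≤? K
    ... | yes t≤K = t≤K
    ... | no  t≰K = ⊥-elim forever
      where
      prolong : ∀ {t c} → Reach M x t c → K ≤ t → ∃₂ λ u d → t < u × Reach M x u d
      prolong {t} r K≤t with repeated r K≤t
      ... | repetition {i} {j} i<j j≤t rᵢ rⱼ pᵢ pⱼ cᵢ≈cⱼ with ≈-run cᵢ≈cⱼ pᵢ
      ...   | _ , p , _ = j + (t ∸ i) , _ , longer , reach-run M x rⱼ p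
        where
        longer : t < j + (t ∸ i)
        longer = subst (_< j + (t ∸ i)) (ℕ.m+[n∸m]≡n (ℕ.≤-trans (ℕ.<⇒≤ i<j) j≤t)) (ℕ.+-monoˡ-< (t ∸ i) i<j)
      long : ∀ m → ∃₂ λ u d → m ≤ u × K ≤ u × Reach M x u d
      long zero    = t , c , z≤n , ℕ.<⇒≤ (ℕ.≰⇒> t≰K) , r
      long (suc m) with long m
      ... | _ , _ , m≤u , K≤u , r′ with prolong r′ K≤u
      ...   | v , d , u<v , r″ = v , d , ℕ.≤-trans (s≤s m≤u) u<v , ℕ.≤-trans K≤u (ℕ.<⇒≤ u<v) , r″
      forever : ⊥
      forever with long (suc T)
      ... | u , d , T<u , _ , r′ = ℕ.<⇒≱ T<u (bound u d r′)

  module _ (s : ℕ) (space : SpaceWithin M x (_≤ s)) where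

    head≤ : ∀ {t c} → Reach M x t c → ∀ i → head (lookup (tapes c) i) ≤ s
    head≤ r = VecAll.lookup⁺ (space _ _ r)

    ipos≤ : ∀ {t c} → Reach M x t c → ipos c ≤ suc (length x)
    ipos≤ start                        = z≤n
    ipos≤ (step {c = c} r ((_ , m , _) , _ , refl)) = ℕ.m⊓n≤n (moveHead m (ipos c)) (suc (length x))

    -- A cell changes only while the head is on it. Together with the head position, the cells up to
    -- `s` thus determine a reachable tape.
    blank-beyond : ∀ {t c} → Reach M x t c → ∀ i j → s < j → cells (lookup (tapes c) i) j ≡ zero
    blank-beyond start i j s<j rewrite Vec.lookup-replicate i (blankTape {γ M}) = refl
    blank-beyond (step {c = c} r ((_ , _ , ws) , _ , refl)) i j s<j
      rewrite Vec.lookup-zipWith updTape i (tapes c) ws with j ℕ.≟ head (lookup (tapes c) i)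
    ... | yes refl = contradiction (head≤ r i) (ℕ.<⇒≱ s<j)
    ... | no  _    = blank-beyond r i j s<j

    code : Config M → Fin (#configs M (length x) s)
    code c = combine (state c) (combine (clamp (suc (length x)) (ipos c)) (funToFin (tapeCode s ∘ lookup (tapes c))))

    code-injective : ∀ {t u c d} → Reach M x t c → Reach M x u d → code c ≡ code d → c ≈ d
    code-injective {c = c} {d} r r′ eq =
      let state-eq , eq′ = Fin.combine-injective (state c) (codeᵢ c) (state d) (codeᵢ d) eq
          ipos-eq , eq″  = Fin.combine-injective (clamp _ (ipos c)) (codeₜ c) (clamp _ (ipos d)) (codeₜ d) eq′
      in ≈-intro state-eq (clamp-injective (ipos≤ r) (ipos≤ r′) ipos-eq) λ i →
           tapeCode-injective (head≤ r i) (head≤ r′ i) (blank-beyond r i) (blank-beyond r′ i)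
             (funToFin-injective {f = tapeCode s ∘ lookup (tapes c)} {tapeCode s ∘ lookup (tapes d)} eq″ i)
      where
      codeₜ : Config M → Fin ((suc s * suc (γ M) ^ suc s) ^ k M)
      codeₜ c = funToFin (tapeCode s ∘ lookup (tapes c))
      codeᵢ : Config M → Fin (suc (suc (length x)) * (suc s * suc (γ M) ^ suc s) ^ k M)
      codeᵢ c = combine (clamp (suc (length x)) (ipos c)) (codeₜ c)

    -- With K the number of codes, the configurations at the times 0, ..., K are one too many to
    -- have distinct codes.
    find-repetition : ∀ {t c} → Reach M x t c → #configs M (length x) s ≤ t → Repetition t c
    find-repetition {t} {c} r K≤t =
      let i , j , i<j , eq = Fin.pigeonhole (ℕ.≤-refl {suc (#configs M (length x) s)}) (code ∘ proj₁ ∘ at)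
          _ , rᵢ , pᵢ = at i
          _ , rⱼ , pⱼ = at j
      in repetition i<j (before j) rᵢ rⱼ pᵢ pⱼ (code-injective rᵢ rⱼ eq)
      where
      before : (i : Fin (suc (#configs M (length x) s))) → toℕ i ≤ t
      before i = ℕ.≤-trans (ℕ.≤-pred (Fin.toℕ<n i)) K≤t
      at : (i : Fin (suc (#configs M (length x) s))) → ∃ λ d → Reach M x (toℕ i) d × Run _⟶_ (t ∸ toℕ i) d c
      at i = visited r (before i)


-- Logarithms and exponential bounds

log₂-suc² : ∀ n → ⌊log₂ suc (suc n) ⌋ ≡ suc ⌊log₂ suc ⌊ n /2⌋ ⌋
log₂-suc² n = begin
  ⌊log₂ suc (suc n) ⌋             ≡⟨ ℕ.m+[n∸m]≡n positive-log ⟨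
  suc (⌊log₂ suc (suc n) ⌋ ∸ 1)   ≡⟨ cong suc (⌊log₂⌊n/2⌋⌋≡⌊log₂n⌋∸1 (suc (suc n))) ⟨
  suc ⌊log₂ suc ⌊ n /2⌋ ⌋         ∎
  where
  open ≡.≡-Reasoning
  positive-log : 1 ≤ ⌊log₂ suc (suc n) ⌋
  positive-log = ⌊log₂⌋-mono-≤ {2} {suc (suc n)} (s≤s (s≤s z≤n))

2^log₂≤ : ∀ n → 2 ^ ⌊log₂ suc n ⌋ ≤ suc n
2^log₂≤ n = go n (<-wellFounded n)
  where
  open ℕ.≤-Reasoning
  go : ∀ n → Acc _<_ n → 2 ^ ⌊log₂ suc n ⌋ ≤ suc n
  go zero          _         = ℕ.≤-refl
  go (suc n) (acc rec) = begin
    2 ^ ⌊log₂ suc (suc n) ⌋           ≡⟨ cong (2 ^_) (log₂-suc² n) ⟩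
    2 * 2 ^ ⌊log₂ suc ⌊ n /2⌋ ⌋       ≤⟨ ℕ.*-monoʳ-≤ 2 (go ⌊ n /2⌋ (rec (s≤s (ℕ.⌊n/2⌋≤n n)))) ⟩
    2 * suc ⌊ n /2⌋                   ≡⟨ cong (suc ⌊ n /2⌋ +_) (ℕ.+-identityʳ _) ⟩
    suc ⌊ n /2⌋ + suc ⌊ n /2⌋         ≤⟨ ℕ.+-monoʳ-≤ (suc ⌊ n /2⌋) (s≤s (ℕ.⌊n/2⌋≤⌈n/2⌉ n)) ⟩
    suc ⌊ n /2⌋ + suc ⌈ n /2⌉         ≡⟨ ℕ.⌊n/2⌋+⌈n/2⌉≡n (suc (suc n)) ⟩
    suc (suc n)                       ∎

<2^suc-log₂ : ∀ n → n < 2 ^ suc ⌊log₂ n ⌋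
<2^suc-log₂ n = go n (<-wellFounded n)
  where
  open ℕ.≤-Reasoning
  go : ∀ n → Acc _<_ n → n < 2 ^ suc ⌊log₂ n ⌋
  go zero          _         = s≤s z≤n
  go (suc zero)    _         = s≤s (s≤s z≤n)
  go (suc (suc n)) (acc rec) = begin
    suc (suc (suc n))                         ≡⟨ ℕ.⌊n/2⌋+⌈n/2⌉≡n (suc (suc (suc n))) ⟨
    suc ⌊ suc n /2⌋ + suc ⌈ suc n /2⌉         ≤⟨ ℕ.+-mono-≤ (s≤s (ℕ.⌊n/2⌋≤⌈n/2⌉ (suc n))) ℕ.≤-refl ⟩
    suc ⌈ suc n /2⌉ + suc ⌈ suc n /2⌉         ≡⟨ cong (suc ⌈ suc n /2⌉ +_) (ℕ.+-identityʳ _) ⟨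
    2 * suc (suc ⌊ n /2⌋)                     ≤⟨ ℕ.*-monoʳ-≤ 2 (go (suc ⌊ n /2⌋) (rec (s≤s (s≤s (ℕ.⌊n/2⌋≤n n))))) ⟩
    2 * 2 ^ suc ⌊log₂ suc ⌊ n /2⌋ ⌋           ≡⟨ cong (λ l → 2 * 2 ^ l) (log₂-suc² n) ⟨
    2 * 2 ^ ⌊log₂ suc (suc n) ⌋               ∎

log₂-suc≤ : ∀ n → ⌊log₂ suc n ⌋ ≤ suc ⌊log₂ n ⌋
log₂-suc≤ zero    = z≤n
log₂-suc≤ (suc n) = subst (_≤ suc ⌊log₂ suc n ⌋) (≡.sym (log₂-suc² n)) (s≤s (⌊log₂⌋-mono-≤ {suc ⌊ n /2⌋} {suc n} (s≤s (ℕ.⌊n/2⌋≤n n))))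

n<2^n : ∀ n → n < 2 ^ n
n<2^n zero    = s≤s z≤n
n<2^n (suc n) = ℕ.+-mono-≤ (ℕ.m^n>0 2 n) (ℕ.≤-trans (n<2^n n) (ℕ.≤-reflexive (≡.sym (ℕ.+-identityʳ _))))

^-distribʳ-* : ∀ m n l → (m * n) ^ l ≡ m ^ l * n ^ l
^-distribʳ-* m n zero    = refl
^-distribʳ-* m n (suc l) = begin
  m * n * (m * n) ^ l         ≡⟨ cong (m * n *_) (^-distribʳ-* m n l) ⟩
  m * n * (m ^ l * n ^ l)     ≡⟨ solve 4 (λ a b c d → a :* b :* (c :* d) := a :* c :* (b :* d)) refl m n (m ^ l) (n ^ l) ⟩
  m * m ^ l * (n * n ^ l)     ∎
  where
  open ≡.≡-Reasoning
  open +-*-Solver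

-- Polynomial growth, in a form closed under products and powers without care for degrees. It also
-- matches the clock: a counter with more than log n digits counts up to such a number. The `suc` in
-- the exponent keeps constants in the class when the logarithm is 0.
ExpBounded : (ℕ → ℕ) → Set
ExpBounded f = ∃ λ b → ∀ n → f n ≤ suc b ^ suc ⌊log₂ n ⌋

exp-≤ : ∀ {f g} → (∀ n → f n ≤ g n) → ExpBounded g → ExpBounded f
exp-≤ f≤g (b , g≤) = b , λ n → ℕ.≤-trans (f≤g n) (g≤ n)

exp-base : ∀ b → ExpBounded (λ n → b ^ suc ⌊log₂ n ⌋)
exp-base b = b , λ n → ℕ.^-monoˡ-≤ (suc ⌊log₂ n ⌋) (ℕ.n≤1+n b)

exp-const : ∀ m → ExpBounded (λ _ → m)
exp-const m = m , λ n → ℕ.≤-trans (ℕ.n≤1+n m) (ℕ.m≤m*n (suc m) (suc m ^ ⌊log₂ n ⌋) {{ℕ.m^n≢0 (suc m) ⌊log₂ n ⌋}})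

exp-* : ∀ {f g} → ExpBounded f → ExpBounded g → ExpBounded (λ n → f n * g n)
-- The base is chosen so that its successor computes to `suc a * suc b`.
exp-* (a , f≤) (b , g≤) = b + a * suc b , λ n →
  ℕ.≤-trans (ℕ.*-mono-≤ (f≤ n) (g≤ n)) (ℕ.≤-reflexive (≡.sym (^-distribʳ-* (suc a) (suc b) (suc ⌊log₂ n ⌋))))

exp-^ : ∀ {f} k → ExpBounded f → ExpBounded (λ n → f n ^ k)
exp-^ zero    ef = exp-const 1
exp-^ (suc k) ef = exp-* ef (exp-^ k ef)

-- The number of tape contents is exponential in the space. As the space is linear in log n, the
-- constant factor moves from the exponent into the base.
configs-bound : ∀ {σ} (M : NTM σ) c → ExpBounded (λ n → #configs M n (c * ⌊log₂ n ⌋ + c))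
configs-bound M c =
  exp-* (exp-const (Q M)) (exp-* positions (exp-^ (k M) (exp-* heads contents)))
  where
  positions : ExpBounded (λ n → suc (suc n))
  positions = exp-≤ (λ n → s≤s (s≤s (ℕ.m≤m*n n 2))) (exp-* (exp-≤ <2^suc-log₂ (exp-base 2)) (exp-const 2))
  space≤ : ∀ n → suc (c * ⌊log₂ n ⌋ + c) ≤ suc c * suc ⌊log₂ n ⌋
  space≤ n = begin
    suc (c * ⌊log₂ n ⌋ + c)                 ≡⟨ cong suc (solve 2 (λ c l → c :* l :+ c := c :* (con 1 :+ l)) refl c ⌊log₂ n ⌋) ⟩
    suc (c * suc ⌊log₂ n ⌋)                 ≤⟨ s≤s (ℕ.m≤n+m _ ⌊log₂ n ⌋) ⟩
    suc ⌊log₂ n ⌋ + c * suc ⌊log₂ n ⌋       ∎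
    where
    open ℕ.≤-Reasoning
    open +-*-Solver
  heads : ExpBounded (λ n → suc (c * ⌊log₂ n ⌋ + c))
  heads = exp-≤ space≤ (exp-* (exp-const (suc c)) (exp-≤ (λ n → ℕ.<⇒≤ (n<2^n (suc ⌊log₂ n ⌋))) (exp-base 2)))
  contents : ExpBounded (λ n → suc (γ M) ^ suc (c * ⌊log₂ n ⌋ + c))
  contents = exp-≤ (λ n → ℕ.≤-trans (ℕ.^-monoʳ-≤ (suc (γ M)) (space≤ n))
                                    (ℕ.≤-reflexive (≡.sym (ℕ.^-*-assoc (suc (γ M)) (suc c) (suc ⌊log₂ n ⌋)))))
                   (exp-base (suc (γ M) ^ suc c))

-- Up to the constant factor, B ^ log n is at most (2 ^ B) ^ log n = (2 ^ log n) ^ B, hence at most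
-- n ^ B. At n = 0, where 2 ^ log n exceeds n, the additive constant suffices.
exp⇒poly : ∀ {f} → ExpBounded f → ∃ λ c → ∀ n → f n ≤ c * n ^ c + c
exp⇒poly (b , f≤) = suc b , λ n → ℕ.≤-trans (f≤ n) (bound n)
  where
  open ℕ.≤-Reasoning
  bound : ∀ n → suc b ^ suc ⌊log₂ n ⌋ ≤ suc b * n ^ suc b + suc b
  bound zero    = ℕ.≤-trans (ℕ.≤-reflexive (ℕ.*-identityʳ (suc b))) (ℕ.m≤n+m _ (suc b * 0))
  bound (suc n) = begin
    suc b * suc b ^ l                ≤⟨ ℕ.*-monoʳ-≤ (suc b) (ℕ.^-monoˡ-≤ l (ℕ.<⇒≤ (n<2^n (suc b)))) ⟩
    suc b * (2 ^ suc b) ^ l          ≡⟨ cong (suc b *_) (ℕ.^-*-assoc 2 (suc b) l) ⟩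
    suc b * 2 ^ (suc b * l)          ≡⟨ cong (λ e → suc b * 2 ^ e) (ℕ.*-comm (suc b) l) ⟩
    suc b * 2 ^ (l * suc b)          ≡⟨ cong (suc b *_) (ℕ.^-*-assoc 2 l (suc b)) ⟨
    suc b * (2 ^ l) ^ suc b          ≤⟨ ℕ.*-monoʳ-≤ (suc b) (ℕ.^-monoˡ-≤ (suc b) (2^log₂≤ n)) ⟩
    suc b * suc n ^ suc b            ≤⟨ ℕ.m≤m+n _ (suc b) ⟩
    suc b * suc n ^ suc b + suc b    ∎
    where
    l : ℕ
    l = ⌊log₂ suc n ⌋

-- Unfolding these bounds would make type checking slow.
abstract

  accepting-time : ∀ {σ} (M : NTM σ) c → ∃ λ b → ∀ x → SpaceWithin M x (_≤ c * ⌊log₂ length x ⌋ + c) → Accepts M x →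
                   ∃₂ λ t d → t < suc b ^ suc ⌊log₂ length x ⌋ × Reach M x t d × state d ≡ qacc M
  accepting-time M c =
    let b , bound = configs-bound M c
    in b , λ x space (_ , _ , r , final) →
         let t , d , t<K , r′ , final′ = accepts-early M x (find-repetition M x _ space) r final
         in t , d , ℕ.≤-trans t<K (bound (length x)) , r′ , final′

  halting-time : ∀ {σ} (M : NTM σ) c → ∃ λ d → ∀ x T → SpaceWithin M x (_≤ c * ⌊log₂ length x ⌋ + c) → TimeWithin M x T →
                 TimeWithin M x (d * length x ^ d + d)
  halting-time M c =
    let d , bound = exp⇒poly (configs-bound M c)
    in d , λ x T space time t e r →
         ℕ.≤-trans (halting⇒early M x (find-repetition M x _ space) T time t e r) (bound (length x))

-- Finite types as sets of states and symbols

record Finite (A : Set) : Set where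
  field
    size      : ℕ
    toFin     : A → Fin size
    fromFin   : Fin size → A
    -- A retraction is enough: machines decode their state number with `fromFin` before they move,
    -- so numbers outside the image of `toFin` do no harm.
    from∘to   : ∀ a → fromFin (toFin a) ≡ a
open Finite

toFin-injective : ∀ {A} (F : Finite A) {a b} → toFin F a ≡ toFin F b → a ≡ b
toFin-injective F {a} {b} eq = trans (≡.sym (from∘to F a)) (trans (cong (fromFin F) eq) (from∘to F b))

finite-Fin : ∀ n → Finite (Fin n)
finite-Fin n = record { size = n ; toFin = id ; fromFin = id ; from∘to = λ _ → refl }

finite-enumeration : ∀ {A n} (xs : Vec A n) (index : A → Fin n) → (∀ a → lookup xs (index a) ≡ a) → Finite A
finite-enumeration {n = n} xs index found = record { size = n ; toFin = index ; fromFin = lookup xs ; from∘to = found }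

finite-× : ∀ {A B} → Finite A → Finite B → Finite (A × B)
finite-× F G = record
  { size    = size F * size G
  ; toFin   = λ (a , b) → combine (toFin F a) (toFin G b)
  ; fromFin = λ i → let j , l = remQuot (size G) i in fromFin F j , fromFin G l
  ; from∘to = λ (a , b) → trans (cong (λ (j , l) → fromFin F j , fromFin G l) (Fin.remQuot-combine (toFin F a) (toFin G b)))
                                  (cong₂ _,_ (from∘to F a) (from∘to G b))
  }

finite-⊎ : ∀ {A B} → Finite A → Finite B → Finite (A ⊎ B)
finite-⊎ {A} {B} F G = record
  { size    = size F + size G
  ; toFin   = into
  ; fromFin = out ∘ splitAt (size F)
  ; from∘to = out-into
  }
  where
  into : A ⊎ B → Fin (size F + size G)
  into (inj₁ a) = join (size F) (size G) (inj₁ (toFin F a))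
  into (inj₂ b) = join (size F) (size G) (inj₂ (toFin G b))
  out : Fin (size F) ⊎ Fin (size G) → A ⊎ B
  out (inj₁ i) = inj₁ (fromFin F i)
  out (inj₂ j) = inj₂ (fromFin G j)
  out-into : ∀ s → out (splitAt (size F) (into s)) ≡ s
  out-into (inj₁ a) = trans (cong out (Fin.splitAt-join (size F) (size G) (inj₁ (toFin F a)))) (cong inj₁ (from∘to F a))
  out-into (inj₂ b) = trans (cong out (Fin.splitAt-join (size F) (size G) (inj₂ (toFin G b)))) (cong inj₂ (from∘to G b))

finite-retract : ∀ {A B} → Finite B → (f : A → B) (g : B → A) → (∀ a → g (f a) ≡ a) → Finite A
finite-retract F f g gf = record
  { size    = size F
  ; toFin   = toFin F ∘ f
  ; fromFin = g ∘ fromFin F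
  ; from∘to = λ a → trans (cong g (from∘to F (f a))) (gf a)
  }

-- Counters on tapes

data Cell (b : ℕ) : Set where
  blank mark : Cell b
  digit      : Fin (suc (suc b)) → Cell b

-- A counter tape carries a mark in cell 0, followed by the digits, least significant first.
content : ∀ {b} → List (Fin (suc (suc b))) → ℕ → Cell b
content ds zero    = mark
content ds (suc i) = maybe′ digit blank (lookupMaybe ds i)

lookupMaybe-ʳ++-< : ∀ {A : Set} (us : List A) {ys zs i} → i < length us →
                    lookupMaybe (us ʳ++ ys) i ≡ lookupMaybe (us ʳ++ zs) i
lookupMaybe-ʳ++-< (u ∷ us) {ys} {zs} {i} (s≤s i≤) with i ℕ.≟ length us
... | yes refl = trans (lookupMaybe-zip us (u ∷ ys)) (≡.sym (lookupMaybe-zip us (u ∷ zs)))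
... | no  i≢   = lookupMaybe-ʳ++-< us (ℕ.≤∧≢⇒< i≤ i≢)

lookupMaybe-∷ : ∀ {A : Set} {a : A} xs {i} → i ≢ 0 → lookupMaybe (a ∷ List.drop 1 xs) i ≡ lookupMaybe xs i
lookupMaybe-∷ xs       {zero}  i≢0 = contradiction refl i≢0
lookupMaybe-∷ []       {suc i} _   = refl
lookupMaybe-∷ (x ∷ xs) {suc i} _   = refl

lookupMaybe-write : ∀ {A : Set} (us ys : List A) {a i} → i ≢ length us →
                    lookupMaybe (us ʳ++ (a ∷ List.drop 1 ys)) i ≡ lookupMaybe (us ʳ++ ys) i
lookupMaybe-write us ys {a} {i} i≢ with i ℕ.<? length us
... | yes i< = lookupMaybe-ʳ++-< us i<
... | no  i≮ with ℕ.m≤n⇒∃[o]m+o≡n (ℕ.≮⇒≥ i≮)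
...   | o , refl = begin
        lookupMaybe (us ʳ++ (a ∷ List.drop 1 ys)) (length us + o) ≡⟨ lookupMaybe-ʳ++ us _ o ⟩
        lookupMaybe (a ∷ List.drop 1 ys) o                        ≡⟨ lookupMaybe-∷ ys (λ { refl → i≢ (ℕ.+-identityʳ _) }) ⟩
        lookupMaybe ys o                                          ≡⟨ lookupMaybe-ʳ++ us ys o ⟨
        lookupMaybe (us ʳ++ ys) (length us + o)                   ∎
  where open ≡.≡-Reasoning

-- The alphabet is seen through `symb`, so that the same lemmas serve the four symbols of the
-- automaton's counters and the clock tape, whose symbols are pairs.
record Holds {b γ} (symb : Fin (suc γ) → Cell b) (t : Tape γ) (h : ℕ) (ds : List (Fin (suc (suc b)))) : Set where
  constructor holds
  field
    head-≡  : head t ≡ h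
    cells-≡ : ∀ i → symb (cells t i) ≡ content ds i
open Holds

module _ {b γ} {symb : Fin (suc γ) → Cell b} {t : Tape γ} where

  read-mark : ∀ {ds} → Holds symb t 0 ds → symb (readTape t) ≡ mark
  read-mark (holds refl eq) = eq (head t)

  read-digit : ∀ ls {d rs} → Holds symb t (suc (length ls)) (ls ʳ++ (d ∷ rs)) → symb (readTape t) ≡ digit d
  read-digit ls {d} {rs} (holds refl eq) = trans (eq (head t)) (cong (maybe′ digit blank) (lookupMaybe-zip ls (d ∷ rs)))

  read-blank : ∀ ls → Holds symb t (suc (length ls)) (ls ʳ++ []) → symb (readTape t) ≡ blank
  read-blank ls (holds refl eq) = trans (eq (head t)) (cong (maybe′ digit blank) (lookupMaybe-zip ls []))

  holds-same : ∀ {h ds a} m → Holds symb t h ds → symb a ≡ symb (readTape t) → Holds symb (updTape t (a , m)) (moveHead m h) ds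
  holds-same {ds = ds} {a} m (holds refl eq) a≡ = holds refl same
    where
    same : ∀ i → symb (writeCell (cells t) (head t) a i) ≡ content ds i
    same i with i ℕ.≟ head t
    ... | yes refl = trans a≡ (eq i)
    ... | no  _    = eq i

  holds-keep : ∀ {h ds} m → Holds symb t h ds → Holds symb (updTape t (readTape t , m)) (moveHead m h) ds
  holds-keep m held = holds-same m held refl

  -- `List.drop 1 rs` treats two cases alike: overwriting the digit under the head, and extending
  -- the number on the blank cell after its last digit.
  holds-write : ∀ ls {rs a d} m → Holds symb t (suc (length ls)) (ls ʳ++ rs) → symb a ≡ digit d →
                Holds symb (updTape t (a , m)) (moveHead m (suc (length ls))) (ls ʳ++ (d ∷ List.drop 1 rs))
  holds-write ls {rs} {a} {d} m (holds refl eq) a≡ = holds refl new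
    where
    new : ∀ i → symb (writeCell (cells t) (head t) a i) ≡ content (ls ʳ++ (d ∷ List.drop 1 rs)) i
    new i with i ℕ.≟ suc (length ls)
    ... | yes refl = trans a≡ (≡.sym (cong (maybe′ digit blank) (lookupMaybe-zip ls (d ∷ List.drop 1 rs))))
    new zero    | no _  = eq 0
    new (suc i) | no i≢ = trans (eq (suc i))
                            (cong (maybe′ digit blank) (≡.sym (lookupMaybe-write ls rs (i≢ ∘ cong suc))))

  holds-new : ∀ {a} → head t ≡ 0 → (∀ i → symb (cells t i) ≡ blank) → symb a ≡ mark →
              Holds symb (updTape t (a , stay)) 0 []
  holds-new {a} refl eq a≡ = holds refl new
    where
    new : ∀ i → symb (writeCell (cells t) (head t) a i) ≡ content [] i
    new i with i ℕ.≟ 0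
    ... | yes refl = a≡
    new zero    | no i≢ = contradiction refl i≢
    new (suc i) | no _  = eq (suc i)

-- The counters are binary. A digit other than 0 counts as 1, because the
-- same tape later serves as a counter in a larger base.
bin : ∀ {b} → List (Fin (suc (suc b))) → ℕ
bin []           = 0
bin (zero  ∷ ds) = 2 * bin ds
bin (suc _ ∷ ds) = suc (2 * bin ds)

inc : ∀ {b} → List (Fin (suc (suc b))) → List (Fin (suc (suc b)))
inc []           = suc zero ∷ []
inc (zero  ∷ ds) = suc zero ∷ ds
inc (suc _ ∷ ds) = zero ∷ inc ds

dec : ∀ {b} → List (Fin (suc (suc b))) → Maybe (List (Fin (suc (suc b))))
dec []           = nothing
dec (zero  ∷ ds) = maybe′ (λ ds′ → just (suc zero ∷ ds′)) nothing (dec ds)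
dec (suc _ ∷ ds) = just (zero ∷ ds)

bin-inc : ∀ {b} (ds : List (Fin (suc (suc b)))) → bin (inc ds) ≡ suc (bin ds)
bin-inc []           = refl
bin-inc (zero  ∷ ds) = refl
bin-inc (suc _ ∷ ds) = trans (cong (2 *_) (bin-inc ds)) (ℕ.*-suc 2 (bin ds))

bin-dec : ∀ {b} (ds : List (Fin (suc (suc b)))) {ds′} → dec ds ≡ just ds′ →
          bin ds ≡ suc (bin ds′) × length ds′ ≡ length ds
bin-dec (zero  ∷ ds) eq with dec ds in eq′
bin-dec (zero  ∷ ds) refl | just ds′ with bin-dec ds eq′
... | v , l = trans (cong (2 *_) v) (ℕ.*-suc 2 (bin ds′)) , cong suc l
bin-dec (suc _ ∷ ds) refl = refl , refl

bin-zero : ∀ {b} (ds : List (Fin (suc (suc b)))) → dec ds ≡ nothing → bin ds ≡ 0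
bin-zero []          eq = refl
bin-zero (zero ∷ ds) eq with dec ds in eq′
bin-zero (zero ∷ ds) eq | nothing = cong (2 *_) (bin-zero ds eq′)

zeros : ∀ {b} → List (Fin (suc (suc b))) → List (Fin (suc (suc b)))
zeros = List.map (λ _ → zero)

bin-zeros : ∀ {b} (ds : List (Fin (suc (suc b)))) → bin (zeros ds) ≡ 0
bin-zeros []       = refl
bin-zeros (_ ∷ ds) = cong (2 *_) (bin-zeros ds)

-- The number gets longer only if all its digits are nonzero. Then `suc (bin ds)` is
-- `2 ^ length ds`, and the bound leaves room for one more digit. Leading zeros are allowed, so
-- `length ds ≤ l` has to be assumed separately.
length-inc : ∀ {b} (ds : List (Fin (suc (suc b)))) {l} → length ds ≤ l → suc (bin ds) < 2 ^ l → length (inc ds) ≤ l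
length-inc []           {zero}  _        (s≤s ())
length-inc []           {suc l} _        _  = s≤s z≤n
length-inc (zero  ∷ ds)         le       lt = le
length-inc (suc _ ∷ ds) {suc l} (s≤s le) lt = s≤s (length-inc ds le (ℕ.*-cancelˡ-< 2 (suc (bin ds)) (2 ^ l)
                                                (subst (_< 2 ^ suc l) (≡.sym (ℕ.*-suc 2 (bin ds))) lt)))

bin<2^length : ∀ {b} (ds : List (Fin (suc (suc b)))) → bin ds < 2 ^ length ds
bin<2^length []           = s≤s z≤n
bin<2^length (zero  ∷ ds) = ℕ.*-monoʳ-< 2 (bin<2^length ds)
bin<2^length (suc _ ∷ ds) = subst (_≤ 2 ^ suc (length ds)) (ℕ.*-suc 2 (bin ds)) (ℕ.*-monoʳ-≤ 2 (bin<2^length ds))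

-- Counting in binary leaves only the digits 0 and 1; in the larger base of the clock these are
-- almost the smallest digits, which `remaining-small` exploits.
inc-small : ∀ {b} {ds : List (Fin (suc (suc b)))} → All (λ d → toℕ d ≤ 1) ds → All (λ d → toℕ d ≤ 1) (inc ds)
inc-small                  []       = s≤s z≤n ∷ []
inc-small {ds = zero  ∷ _} (_ ∷ ss) = s≤s z≤n ∷ ss
inc-small {ds = suc _ ∷ _} (_ ∷ ss) = z≤n ∷ inc-small ss

-- Multi-head automata in logarithmic space

-- In every step only the head selected by the label reads and moves, since the Turing machine that
-- runs the automaton has a single input head.
record Automaton (σ h : ℕ) : Set₁ where
  field
    Label   : Set
    labels  : Finite Label
    entry   : Label
    final   : Label
    active  : Label → Fin h
    moves   : Label → InSym σ → List (Label × Move)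
open Automaton

Position : ∀ {σ h} → Automaton σ h → Set
Position {h = h} A = Label A × Vec ℕ h

AStep : ∀ {σ h} (A : Automaton σ h) → List (Fin σ) → Position A → Position A → Set
AStep A x (l , ps) s =
  Σ (Label A × Move) λ (l′ , m) → (l′ , m) ∈ moves A l (readIn x (lookup ps (active A l)))
                 × s ≡ (l′ , Vec.updateAt ps (active A l) (λ p → moveHead m p ⊓ suc (length x)))

-- The automaton is run on a Turing machine with one counter tape per head. The
-- active head is the input head and its counter is 0, the other heads are stored in
-- their counters. To change the active head, the machine moves the input head to the
-- left end while incrementing one counter (save, incr, rewind), then to the right while
-- decrementing the other (decr, done, restore).
data Mode : Set where
  boot exec save incr rewind decr done restore : Mode

finite-Mode : Finite Mode
finite-Mode = finite-enumeration
  (boot ∷ exec ∷ save ∷ incr ∷ rewind ∷ decr ∷ done ∷ restore ∷ [])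
  (λ { boot → 0F ; exec → 1F ; save → 2F ; incr → 3F ; rewind → 4F ; decr → 5F ; done → 6F ; restore → 7F })
  (λ { boot → refl ; exec → refl ; save → refl ; incr → refl ; rewind → refl ; decr → refl ; done → refl ;
     restore → refl })

binary-cell : Fin 4 → Cell 0
binary-cell = lookup (blank ∷ mark ∷ digit 0F ∷ digit 1F ∷ [])

unchanged : Fin 4 → Fin 4 × Move
unchanged a = a , stay

idle : ∀ {h} → Vec (Fin 4) h → Vec (Fin 4 × Move) h
idle = Vec.map unchanged

on : ∀ {h} → Fin h → Fin 4 × Move → Vec (Fin 4) h → Vec (Fin 4 × Move) h
on i o w = Vec.updateAt (idle w) i (λ _ → o)

module Compiled {σ h : ℕ} (A : Automaton σ h) where

  Control : Set
  Control = Mode × Fin h × Label A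

  control : Finite Control
  control = finite-× finite-Mode (finite-× (finite-Fin h) (labels A))

  Options : Set
  Options = List (Control × Move × Vec (Fin 4 × Move) h)

  saving : Fin h → Label A → InSym σ → Vec (Fin 4) h → Options
  saving i l ⊢ w = ((decr , active A l , l) , stay , on (active A l) (lookup w (active A l) , right) w) ∷ []
  saving i l _ w = ((incr , i , l) , left , on i (lookup w i , right) w) ∷ []

  incrementing : Fin h → Label A → Cell 0 → Vec (Fin 4) h → Options
  incrementing i l mark       w = []
  incrementing i l blank      w = ((rewind , i , l) , stay , on i (3F , left) w) ∷ []
  incrementing i l (digit 0F) w = ((rewind , i , l) , stay , on i (3F , left) w) ∷ []
  incrementing i l (digit 1F) w = ((incr , i , l) , stay , on i (2F , right) w) ∷ []

  rewinding : Fin h → Label A → Cell 0 → Vec (Fin 4) h → Options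
  rewinding i l mark w = ((save , i , l) , stay , on i (lookup w i , stay) w) ∷ []
  rewinding i l _    w = ((rewind , i , l) , stay , on i (lookup w i , left) w) ∷ []

  decrementing : Fin h → Label A → Cell 0 → Vec (Fin 4) h → Options
  decrementing i l mark       w = []
  decrementing i l blank      w = ((restore , i , l) , stay , on i (lookup w i , left) w) ∷ []
  decrementing i l (digit 0F) w = ((decr , i , l) , stay , on i (3F , right) w) ∷ []
  decrementing i l (digit 1F) w = ((done , i , l) , stay , on i (2F , left) w) ∷ []

  advancing : Fin h → Label A → Cell 0 → Vec (Fin 4) h → Options
  advancing i l mark w = ((decr , i , l) , right , on i (lookup w i , right) w) ∷ []
  advancing i l _    w = ((done , i , l) , stay , on i (lookup w i , left) w) ∷ []

  restoring : Fin h → Label A → Cell 0 → Vec (Fin 4) h → Options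
  restoring i l mark w = ((exec , i , l) , stay , on i (lookup w i , stay) w) ∷ []
  restoring i l _    w = ((restore , i , l) , stay , on i (2F , left) w) ∷ []

  options : Control → InSym σ → Vec (Fin 4) h → Options
  options (boot    , i , l) a w = ((exec , i , l) , stay , Vec.replicate h (1F , stay)) ∷ []
  options (exec    , i , l) a w = List.map (λ (l′ , m) → (save , i , l′) , m , idle w) (moves A l a)
  options (save    , i , l) a w = saving i l a w
  options (incr    , i , l) a w = incrementing i l (binary-cell (lookup w i)) w
  options (rewind  , i , l) a w = rewinding i l (binary-cell (lookup w i)) w
  options (decr    , i , l) a w = decrementing i l (binary-cell (lookup w i)) w
  options (done    , i , l) a w = advancing i l (binary-cell (lookup w i)) w
  options (restore , i , l) a w = restoring i l (binary-cell (lookup w i)) w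

  encodeOption : Control × Move × Vec (Fin 4 × Move) h → Fin (size control) × Move × Vec (Fin 4 × Move) h
  encodeOption (c , o) = toFin control c , o

  machine : NTM σ
  machine = record
    { Q    = size control
    ; k    = h
    ; γ    = 3
    ; q₀   = toFin control (boot , active A (entry A) , entry A)
    ; qacc = toFin control (exec , active A (final A) , final A)
    ; δ    = λ q a w → List.map encodeOption (options (fromFin control q) a w)
    }

  -- Head positions go up to `suc (length x)`, and `fits` says that each of them can be written with
  -- `Λ` binary digits.
  module Simulation (x : List (Fin σ)) (Λ : ℕ) (fits : suc (length x) < 2 ^ Λ) where

    n : ℕ
    n = length x

    _⟶_ : Config machine → Config machine → Set
    _⟶_ = Step machine x

    Inner : Config machine → Set
    Inner c = (∀ i → head (lookup (tapes c) i) ≤ suc Λ) × state c ≢ qacc machine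

    _⇒_ : Config machine → Config machine → Set
    _⇒_ = Forced _⟶_ Inner

    reads : Config machine → Vec (Fin 4) h
    reads c = Vec.map readTape (tapes c)

    tape : Config machine → Fin h → Tape 3
    tape c = lookup (tapes c)

    record At (c : Config machine) (m : Mode) (i : Fin h) (l : Label A) (p : ℕ)
              (head : ℕ) (ds : List (Fin 2)) (D : Fin h → List (Fin 2)) : Set where
      constructor at
      field
        state-≡ : state c ≡ toFin control (m , i , l)
        ipos-≡  : ipos c ≡ p
        this    : Holds binary-cell (tape c i) head ds
        others  : ∀ j → j ≢ i → Holds binary-cell (tape c j) 0 (D j)

    after : ∀ (c : Config machine) {m i l o} → state c ≡ toFin control (m , i , l) →
            options (m , i , l) (readIn x (ipos c)) (reads c) ≡ o ∷ [] →
            Only _⟶_ c (apply machine x (encodeOption o) c)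
    after c {m} {i} {l} {o} st eq = only-step machine x (begin
      List.map encodeOption (options (fromFin control (state c)) a w)                 ≡⟨ cong (λ q → List.map encodeOption (options (fromFin control q) a w)) st ⟩
      List.map encodeOption (options (fromFin control (toFin control (m , i , l))) a w) ≡⟨ cong (λ q → List.map encodeOption (options q a w)) (from∘to control (m , i , l)) ⟩
      List.map encodeOption (options (m , i , l) a w)                                 ≡⟨ cong (List.map encodeOption) eq ⟩
      encodeOption o ∷ []                                                             ∎)
      where
      open ≡.≡-Reasoning
      a : InSym σ
      a = readIn x (ipos c)
      w : Vec (Fin 4) h
      w = reads c

    idle-tape : ∀ (c : Config machine) j → lookup (Vec.zipWith updTape (tapes c) (idle (reads c))) j
                                         ≡ updTape (tape c j) (readTape (tape c j) , stay)
    idle-tape c j rewrite Vec.lookup-zipWith updTape j (tapes c) (idle (reads c))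
                        | Vec.lookup-map j unchanged (reads c)
                        | Vec.lookup-map j readTape (tapes c) = refl

    on-this : ∀ (c : Config machine) i o → lookup (Vec.zipWith updTape (tapes c) (on i o (reads c))) i ≡ updTape (tape c i) o
    on-this c i o rewrite Vec.lookup-zipWith updTape i (tapes c) (on i o (reads c))
                        | Vec.lookup∘updateAt i {λ _ → o} (idle (reads c)) = refl

    on-other : ∀ (c : Config machine) i o j → j ≢ i → lookup (Vec.zipWith updTape (tapes c) (on i o (reads c))) j
                                                     ≡ updTape (tape c j) (readTape (tape c j) , stay)
    on-other c i o j j≢i rewrite Vec.lookup-zipWith updTape j (tapes c) (on i o (reads c))
                               | Vec.lookup∘updateAt′ j i {λ _ → o} j≢i (idle (reads c))
                               | Vec.lookup-map j unchanged (reads c)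
                               | Vec.lookup-map j readTape (tapes c) = refl

    read≡ : ∀ {c m i l p hd ds D s} → At c m i l p hd ds D → binary-cell (readTape (tape c i)) ≡ s → binary-cell (lookup (reads c) i) ≡ s
    read≡ {c} {i = i} _ eq = trans (cong binary-cell (Vec.lookup-map i readTape (tapes c))) eq

    mode≢exec⇒inner : ∀ {c m i l p hd ds D} → At c m i l p hd ds D → m ≢ exec → hd ≤ suc Λ → Inner c
    mode≢exec⇒inner {c} {i = i} (at st _ this others) m≢ hd≤ = heads , λ eq → m≢ (cong proj₁ (toFin-injective control (trans (≡.sym st) eq)))
      where
      heads : ∀ j → head (tape c j) ≤ suc Λ
      heads j with j Fin.≟ i
      ... | yes refl = subst (_≤ suc Λ) (≡.sym (head-≡ this)) hd≤
      ... | no  j≢i  = subst (_≤ suc Λ) (≡.sym (head-≡ (others j j≢i))) z≤n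

    advance : ∀ {c m m′ i l p p′ hd hd′ ds ds′ D o mv} → At c m i l p hd ds D → m ≢ exec → hd ≤ suc Λ →
              options (m , i , l) (readIn x p) (reads c) ≡ ((m′ , i , l) , mv , on i o (reads c)) ∷ [] →
              Holds binary-cell (updTape (tape c i) o) hd′ ds′ → moveHead mv p ⊓ suc n ≡ p′ →
              ∃ λ c′ → c ⇒ c′ × At c′ m′ i l p′ hd′ ds′ D
    advance {c} {m} {i = i} {l} {o = o} a@(at st refl this others) m≢ hd≤ opt written pos =
      _ , (mode≢exec⇒inner a m≢ hd≤ , after c {m} {i} {l} st opt) ∷ [] ,
      at refl pos (subst (λ t → Holds binary-cell t _ _) (≡.sym (on-this c i o)) written)
        (λ j j≢i → subst (λ t → Holds binary-cell t _ _) (≡.sym (on-other c i o j j≢i)) (holds-keep stay (others j j≢i)))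

    _▷_ : ∀ {c} {B C : Config machine → Set} → (∃ λ c′ → c ⇒ c′ × B c′) →
          (∀ {c′} → B c′ → ∃ λ c″ → c′ ⇒ c″ × C c″) → ∃ λ c″ → c ⇒ c″ × C c″
    (_ , p , b) ▷ f with f b
    ... | _ , q , c = _ , p ++ᶠ q , c

    keep : ∀ {c m i l p hd ds D} mv → At c m i l p hd ds D →
           Holds binary-cell (updTape (tape c i) (lookup (reads c) i , mv)) (moveHead mv hd) ds
    keep {c} {i = i} mv (at _ _ this _) rewrite Vec.lookup-map i readTape (tapes c) = holds-keep mv this

    ⊓-bounded : ∀ {p} → p ≤ suc n → p ⊓ suc n ≡ p
    ⊓-bounded = ℕ.m≤n⇒m⊓n≡m

    -- `ls` are the digits over which the carry has passed, already set to 0. The recursive call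
    -- leaves the head on the last of them, and one rewinding step passes over it; so every call
    -- ends one cell to the left of where it began.
    increment : ∀ rs ls {c i l p D} → At c incr i l p (suc (length ls)) (ls ʳ++ rs) D → p ≤ suc n →
                length ls + length rs ≤ Λ →
                ∃ λ c′ → c ⇒ c′ × At c′ rewind i l p (length ls) (ls ʳ++ inc rs) D
    increment [] ls {c} {i} {l} a p≤ len = advance a (λ ()) (s≤s (ℕ.m+n≤o⇒m≤o (length ls) len))
      (cong (λ s → incrementing i l s (reads c)) (read≡ a (read-blank ls (At.this a))))
      (holds-write ls left (At.this a) refl) (⊓-bounded p≤)
    increment (0F ∷ rs) ls {c} {i} {l} a p≤ len = advance a (λ ()) (s≤s (ℕ.m+n≤o⇒m≤o (length ls) len))
      (cong (λ s → incrementing i l s (reads c)) (read≡ a (read-digit ls (At.this a))))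
      (holds-write ls left (At.this a) refl) (⊓-bounded p≤)
    increment (1F ∷ rs) ls {c} {i} {l} a p≤ len =
      advance a (λ ()) (s≤s (ℕ.m+n≤o⇒m≤o (length ls) len))
        (cong (λ s → incrementing i l s (reads c)) (read≡ a (read-digit ls (At.this a))))
        (holds-write ls right (At.this a) refl) (⊓-bounded p≤) ▷ λ a′ →
      increment rs (0F ∷ ls) a′ p≤ (subst (_≤ Λ) (ℕ.+-suc (length ls) (length rs)) len) ▷ λ {c′} a″ →
      advance a″ (λ ()) (s≤s (ℕ.m+n≤o⇒m≤o (length ls) len))
        (cong (λ s → rewinding i l s (reads c′)) (read≡ a″ (read-digit ls {rs = inc rs} (At.this a″))))
        (keep left a″) (⊓-bounded p≤)

    decrement⁺ : ∀ rs ls {rs′ c i l p D} → dec rs ≡ just rs′ → At c decr i l p (suc (length ls)) (ls ʳ++ rs) D →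
                 p ≤ suc n → length ls + length rs ≤ Λ →
                 ∃ λ c′ → c ⇒ c′ × At c′ done i l p (length ls) (ls ʳ++ rs′) D
    decrement⁺ (1F ∷ rs) ls {c = c} {i} {l} refl a p≤ len = advance a (λ ()) (s≤s (ℕ.m+n≤o⇒m≤o (length ls) len))
      (cong (λ s → decrementing i l s (reads c)) (read≡ a (read-digit ls (At.this a))))
      (holds-write ls left (At.this a) refl) (⊓-bounded p≤)
    decrement⁺ (0F ∷ rs) ls eq a p≤ len with dec rs in eq′
    decrement⁺ (0F ∷ rs) ls {c = c} {i} {l} refl a p≤ len | just rs′ =
      advance a (λ ()) (s≤s (ℕ.m+n≤o⇒m≤o (length ls) len))
        (cong (λ s → decrementing i l s (reads c)) (read≡ a (read-digit ls (At.this a))))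
        (holds-write ls right (At.this a) refl) (⊓-bounded p≤) ▷ λ a′ →
      decrement⁺ rs (1F ∷ ls) eq′ a′ p≤ (subst (_≤ Λ) (ℕ.+-suc (length ls) (length rs)) len) ▷ λ {c′} a″ →
      advance a″ (λ ()) (s≤s (ℕ.m+n≤o⇒m≤o (length ls) len))
        (cong (λ s → advancing i l s (reads c′)) (read≡ a″ (read-digit ls {rs = rs′} (At.this a″))))
        (keep left a″) (⊓-bounded p≤)

    -- The machine notices that the counter is 0 only when the borrow runs off its end. By then all
    -- zeros have been turned into ones, and `restore` turns them back on the way to the mark.
    decrement⁰ : ∀ rs ls {c i l p D} → dec rs ≡ nothing → At c decr i l p (suc (length ls)) (ls ʳ++ rs) D →
                 p ≤ suc n → length ls + length rs ≤ Λ →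
                 ∃ λ c′ → c ⇒ c′ × At c′ restore i l p (length ls) (ls ʳ++ zeros rs) D
    decrement⁰ [] ls {c} {i} {l} eq a p≤ len = advance a (λ ()) (s≤s (ℕ.m+n≤o⇒m≤o (length ls) len))
      (cong (λ s → decrementing i l s (reads c)) (read≡ a (read-blank ls (At.this a))))
      (keep left a) (⊓-bounded p≤)
    decrement⁰ (0F ∷ rs) ls eq a p≤ len with dec rs in eq′
    decrement⁰ (0F ∷ rs) ls {c} {i} {l} eq a p≤ len | nothing =
      advance a (λ ()) (s≤s (ℕ.m+n≤o⇒m≤o (length ls) len))
        (cong (λ s → decrementing i l s (reads c)) (read≡ a (read-digit ls (At.this a))))
        (holds-write ls right (At.this a) refl) (⊓-bounded p≤) ▷ λ a′ →
      decrement⁰ rs (1F ∷ ls) eq′ a′ p≤ (subst (_≤ Λ) (ℕ.+-suc (length ls) (length rs)) len) ▷ λ {c′} a″ →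
      advance a″ (λ ()) (s≤s (ℕ.m+n≤o⇒m≤o (length ls) len))
        (cong (λ s → restoring i l s (reads c′)) (read≡ a″ (read-digit ls {rs = zeros rs} (At.this a″))))
        (holds-write ls left (At.this a″) refl) (⊓-bounded p≤)

    saving-left : ∀ i l p w → saving i l (readIn x (suc p)) w ≡ ((incr , i , l) , left , on i (lookup w i , right) w) ∷ []
    saving-left i l p w with readIn x (suc p) in eq
    ... | ⊢     = contradiction eq (readIn-suc x p)
    ... | ⊣     = refl
    ... | sym _ = refl

    -- Every move to the left is matched by one increment, so the sum of counter and head position
    -- is invariant. It is at most n + 1, which keeps the counter within `Λ` digits.
    save-position : ∀ p {c i l ds D} → At c save i l p 0 ds D → bin ds + p ≤ suc n → length ds ≤ Λ →
                    ∃ λ c′ → c ⇒ c′ × (∃ λ ds′ → At c′ save i l 0 0 ds′ D × bin ds′ ≡ bin ds + p × length ds′ ≤ Λ)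
    save-position zero {ds = ds} a v≤ len = _ , [] , ds , a , ≡.sym (ℕ.+-identityʳ (bin ds)) , len
    save-position (suc p) {c} {i} {l} {ds} a v≤ len =
      advance a (λ ()) z≤n (saving-left i l p (reads c)) (keep right a) (⊓-bounded p≤) ▷ λ a′ →
      increment ds [] a′ p≤ len ▷ λ {c″} a″ →
      advance a″ (λ ()) z≤n (cong (λ s → rewinding i l s (reads c″)) (read≡ a″ (read-mark (At.this a″))))
        (keep stay a″) (⊓-bounded p≤) ▷ λ a‴ →
      save-position p a‴ (subst (_≤ suc n) (≡.sym value) v≤)
        (length-inc ds len (ℕ.≤-<-trans (ℕ.≤-trans (s≤s (ℕ.m≤m+n (bin ds) p)) suc-v≤) fits)) ▷ λ (ds′ , a⁗ , v , len′) →
      _ , [] , ds′ , a⁗ , trans v value , len′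
      where
      value : bin (inc ds) + p ≡ bin ds + suc p
      value = trans (cong (_+ p) (bin-inc ds)) (≡.sym (ℕ.+-suc (bin ds) p))
      suc-v≤ : suc (bin ds + p) ≤ suc n
      suc-v≤ = subst (_≤ suc n) (ℕ.+-suc (bin ds) p) v≤
      p≤ : p ≤ suc n
      p≤ = ℕ.≤-trans (ℕ.n≤1+n p) (ℕ.m+n≤o⇒n≤o (bin ds) v≤)

    -- The same invariant in the other direction: a successful decrement pays for one move to the
    -- right. The failing decrement at value 0 ends the loop and leaves a counter of zeros.
    load-position : ∀ v {c i l p ds D} → bin ds ≡ v → At c decr i l p 1 ds D → v + p ≤ suc n → length ds ≤ Λ →
                    ∃ λ c′ → c ⇒ c′ × (∃ λ ds′ → At c′ exec i l (v + p) 0 ds′ D × bin ds′ ≡ 0 × length ds′ ≤ Λ)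
    load-position v {c} {i} {l} {p} {ds} v≡ a v≤ len with dec ds in eq
    load-position v {c} {i} {l} {p} {ds} refl a v≤ len | nothing rewrite bin-zero ds eq =
      decrement⁰ ds [] eq a v≤ len ▷ λ {c′} a′ →
      advance a′ (λ ()) z≤n (cong (λ s → restoring i l s (reads c′)) (read≡ a′ (read-mark (At.this a′))))
        (keep stay a′) (⊓-bounded v≤) ▷ λ a″ →
      _ , [] , zeros ds , a″ , bin-zeros ds , subst (_≤ Λ) (≡.sym (List.length-map _ ds)) len
    load-position v {c} {i} {l} {p} {ds} v≡ a v≤ len | just ds′ with bin-dec ds eq
    load-position (suc v) {c} {i} {l} {p} {ds} {D} v≡ a v≤ len | just ds′ | b , len≡ =
      decrement⁺ ds [] eq a (ℕ.m+n≤o⇒n≤o (suc v) v≤) len ▷ λ {c′} a′ →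
      advance a′ (λ ()) z≤n (cong (λ s → advancing i l s (reads c′)) (read≡ a′ (read-mark (At.this a′))))
        (keep right a′) (⊓-bounded (ℕ.≤-trans (s≤s (ℕ.m≤n+m p v)) v≤)) ▷ λ a″ →
      load-position v (ℕ.suc-injective (trans (≡.sym b) v≡)) a″ (subst (_≤ suc n) (≡.sym (ℕ.+-suc v p)) v≤)
        (subst (_≤ Λ) (≡.sym len≡) len) ▷ λ {c‴} (ds″ , a‴ , z , len′) →
      _ , [] , ds″ , subst (λ q → At c‴ exec i l q 0 ds″ D) (ℕ.+-suc v p) a‴ , z , len′
    load-position zero {ds = ds} v≡ a v≤ len | just ds′ | b , _ with () ← trans (≡.sym v≡) b

    _[_↦_] : (Fin h → List (Fin 2)) → Fin h → List (Fin 2) → Fin h → List (Fin 2)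
    (D [ i ↦ ds ]) j with j Fin.≟ i
    ... | yes _ = ds
    ... | no  _ = D j

    ↦-elim : ∀ (B : Fin h → List (Fin 2) → Set) {D i ds} → B i ds → (∀ j → j ≢ i → B j (D j)) → ∀ j → B j ((D [ i ↦ ds ]) j)
    ↦-elim B {i = i} b bs j with j Fin.≟ i
    ... | yes refl = b
    ... | no  j≢i  = bs j j≢i

    ↦-same : ∀ D i ds → (D [ i ↦ ds ]) i ≡ ds
    ↦-same D i ds with i Fin.≟ i
    ... | yes _   = refl
    ... | no  i≢i = contradiction refl i≢i

    ↦-other : ∀ D i ds {j} → j ≢ i → (D [ i ↦ ds ]) j ≡ D j
    ↦-other D i ds {j} j≢i with j Fin.≟ i
    ... | yes j≡i = contradiction j≡i j≢i
    ... | no  _   = refl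

    -- The position of head `i` is split between its counter and the input head. One record
    -- therefore describes both the start of saving, with counter 0, and its end, with the input
    -- head at 0.
    record Represents (c : Config machine) (m : Mode) (i : Fin h) (l : Label A) (p : ℕ) (ps : Vec ℕ h) : Set where
      constructor represents
      field
        {stored}   : Fin h → List (Fin 2)
        state-≡    : state c ≡ toFin control (m , i , l)
        ipos-≡     : ipos c ≡ p
        all-hold   : ∀ j → Holds binary-cell (tape c j) 0 (stored j)
        all-length : ∀ j → length (stored j) ≤ Λ
        this-value : bin (stored i) + p ≡ lookup ps i
        values     : ∀ j → j ≢ i → bin (stored j) ≡ lookup ps j
        ps-bounded : ∀ j → lookup ps j ≤ suc n

    -- With the input head on the left endmarker, all positions are in the counters and any head can
    -- become active, including the one that was active before.
    turn : ∀ {c i l ps} → Represents c save i l 0 ps →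
           ∃ λ c′ → c ⇒ c′ × Represents c′ exec (active A l) l (lookup ps (active A l)) ps
    turn {c} {i} {l} {ps} (represents {D} st refl hold len this vals ps≤) =
      (_ , (inner , after c {save} {i} {l} st refl) ∷ [] , a) ▷ λ a′ →
      load-position (bin (D j)) {ds = D j} {D} refl a′ bounded (len j) ▷ λ {c′} (ds , a″ , z , len′) →
      _ , [] , represents (At.state-≡ a″) (trans (At.ipos-≡ a″) (trans (ℕ.+-identityʳ _) (all-values j)))
        (↦-elim (λ k ds → Holds binary-cell (tape c′ k) 0 ds) (At.this a″) (At.others a″))
        (↦-elim (λ _ ds → length ds ≤ Λ) len′ (λ k _ → len k))
        (cong (_+ lookup ps j) (trans (cong bin (↦-same D j ds)) z))
        (λ k k≢j → trans (cong bin (↦-other D j ds k≢j)) (all-values k)) ps≤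
      where
      j : Fin h
      j = active A l
      all-values : ∀ k → bin (D k) ≡ lookup ps k
      all-values k with k Fin.≟ i
      ... | yes refl = trans (≡.sym (ℕ.+-identityʳ _)) this
      ... | no  k≢i  = vals k k≢i
      bounded : bin (D j) + 0 ≤ suc n
      bounded = subst (_≤ suc n) (≡.sym (trans (ℕ.+-identityʳ _) (all-values j))) (ps≤ j)
      inner : Inner c
      inner = mode≢exec⇒inner {c} {save} {i} {l} {D = D} (at st refl (hold i) (λ k _ → hold k)) (λ ()) z≤n
      a : At (apply machine x (encodeOption ((decr , j , l) , stay , on j (lookup (reads c) j , right) (reads c))) c)
             decr j l 0 1 (D j) D
      a = at refl refl
            (subst (λ t → Holds binary-cell t 1 (D j)) (≡.sym (on-this c j _))
              (subst (λ s → Holds binary-cell (updTape (tape c j) (s , right)) 1 (D j)) (≡.sym (Vec.lookup-map j readTape (tapes c)))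
                (holds-keep right (hold j))))
            (λ k k≢j → subst (λ t → Holds binary-cell t 0 (D k)) (≡.sym (on-other c j _ k k≢j)) (holds-keep stay (hold k)))

    switch : ∀ {c i l p ps} → Represents c save i l p ps →
             ∃ λ c′ → c ⇒ c′ × Represents c′ exec (active A l) l (lookup ps (active A l)) ps
    switch {i = i} {p = p} {ps} (represents {D} st ip hold len this vals ps≤) =
      save-position p (at st ip (hold i) (λ k _ → hold k)) (subst (_≤ suc n) (≡.sym this) (ps≤ i)) (len i) ▷ λ {c′} (ds , a , v , len′) →
      turn (represents (At.state-≡ a) (At.ipos-≡ a)
        (↦-elim (λ k ds → Holds binary-cell (tape c′ k) 0 ds) (At.this a) (At.others a))
        (↦-elim (λ _ ds → length ds ≤ Λ) len′ (λ k _ → len k))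
        (trans (ℕ.+-identityʳ _) (trans (cong bin (↦-same D i ds)) (trans v this)))
        (λ k k≢i → trans (cong bin (↦-other D i ds k≢i)) (vals k k≢i)) ps≤)

    Rep : Config machine → Position A → Set
    Rep c (l , ps) = Represents c exec (active A l) l (lookup ps (active A l)) ps

    shift : Label A × Move → Position A → Position A
    shift (l′ , m) (l , ps) = l′ , Vec.updateAt ps (active A l) (λ p → moveHead m p ⊓ suc n)

    branch : Fin h → Vec (Fin 4) h → Label A × Move → Fin (size control) × Move × Vec (Fin 4 × Move) h
    branch i w (l′ , m) = toFin control (save , i , l′) , m , idle w

    δ-exec : ∀ {c l ps} → Rep c (l , ps) →
             δ machine (state c) (readIn x (ipos c)) (reads c)
             ≡ List.map (branch (active A l) (reads c)) (moves A l (readIn x (lookup ps (active A l))))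
    δ-exec {c} {l} {ps} (represents st ip _ _ _ _ _) = begin
      List.map encodeOption (options (fromFin control (state c)) a w)
        ≡⟨ cong (λ q → List.map encodeOption (options (fromFin control q) a w)) st ⟩
      List.map encodeOption (options (fromFin control (toFin control (exec , active A l , l))) a w)
        ≡⟨ cong (λ q → List.map encodeOption (options q a w)) (from∘to control (exec , active A l , l)) ⟩
      List.map encodeOption (options (exec , active A l , l) a w)
        ≡⟨ List.map-∘ (moves A l a) ⟨
      List.map (branch (active A l) w) (moves A l a)
        ≡⟨ cong (λ p → List.map (branch (active A l) w) (moves A l (readIn x p))) ip ⟩
      List.map (branch (active A l) w) (moves A l (readIn x (lookup ps (active A l)))) ∎
      where
      open ≡.≡-Reasoning
      a : InSym σ
      a = readIn x (ipos c)
      w : Vec (Fin 4) h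
      w = reads c

    choose : ∀ {c l ps} → Rep c (l , ps) → ∀ o →
             ∃ λ c′ → apply machine x (branch (active A l) (reads c) o) c ⇒ c′ × Rep c′ (shift o (l , ps))
    choose {c} {l} {ps} (represents {D} st ip hold len this vals ps≤) (l′ , m) = switch {ps = ps′} (represents refl refl
      (λ j → subst (λ t → Holds binary-cell t 0 (D j)) (≡.sym (idle-tape c j)) (holds-keep stay (hold j)))
      len
      (trans (cong (_+ moved (ipos c)) zero-value)
        (trans (cong moved ip) (≡.sym (Vec.lookup∘updateAt i ps))))
      (λ j j≢i → trans (vals j j≢i) (≡.sym (Vec.lookup∘updateAt′ j i j≢i ps)))
      bounded)
      where
      i : Fin h
      i = active A l
      moved : ℕ → ℕ
      moved p = moveHead m p ⊓ suc n
      ps′ : Vec ℕ h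
      ps′ = Vec.updateAt ps i moved
      -- While the automaton's own step is executed, the input head carries the whole position of
      -- the active head.
      zero-value : bin (D i) ≡ 0
      zero-value = ℕ.+-cancelʳ-≡ (lookup ps i) (bin (D i)) 0 this
      bounded : ∀ j → lookup ps′ j ≤ suc n
      bounded j with j Fin.≟ i
      ... | yes refl = subst (_≤ suc n) (≡.sym (Vec.lookup∘updateAt i ps)) (ℕ.m⊓n≤n (moveHead m (lookup ps i)) (suc n))
      ... | no  j≢i  = subst (_≤ suc n) (≡.sym (Vec.lookup∘updateAt′ j i j≢i ps)) (ps≤ j)

    forth : ∀ {c s s′} → Rep c s → AStep A x s s′ → ∃₂ λ c₁ c′ → c ⟶ c₁ × c₁ ⇒ c′ × Rep c′ s′
    forth {c} {l , ps} r (o , o∈ , refl) =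
      let c′ , p , r′ = choose r o
          b = branch (active A l) (reads c)
      in apply machine x (b o) c , c′ , (b o , subst (b o ∈_) (≡.sym (δ-exec r)) (Membership.∈-map⁺ b o∈) , refl) , p , r′

    back : ∀ {c s c₁} → Rep c s → c ⟶ c₁ → ∃₂ λ s′ c′ → AStep A x s s′ × c₁ ⇒ c′ × Rep c′ s′
    back {c} {l , ps} r (b , b∈ , refl) = back-from (Membership.∈-map⁻ _ (subst (b ∈_) (δ-exec r) b∈))
      where
      back-from : ∀ {b} → (∃ λ o → o ∈ moves A l (readIn x (lookup ps (active A l))) × b ≡ branch (active A l) (reads c) o) →
                  ∃₂ λ s′ c′ → AStep A x (l , ps) s′ × apply machine x b c ⇒ c′ × Rep c′ s′
      back-from (o , o∈ , refl) =
        let c′ , p , r′ = choose r o in shift o (l , ps) , c′ , (o , o∈ , refl) , p , r′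

    boot-up : ∃ λ c → initial machine ⇒ c × Rep c (entry A , Vec.replicate h 0)
    boot-up = _ , (inner , after (initial machine) {boot} {active A (entry A)} {entry A} refl refl) ∷ [] ,
              represents {stored = λ _ → []} refl (≡.sym (Vec.lookup-replicate (active A (entry A)) 0)) hold (λ _ → z≤n)
                refl (λ j _ → ≡.sym (Vec.lookup-replicate j 0)) (λ j → subst (_≤ suc n) (≡.sym (Vec.lookup-replicate j 0)) z≤n)
      where
      inner : Inner (initial machine)
      inner = (λ j → subst (λ t → head t ≤ suc Λ) (≡.sym (Vec.lookup-replicate {n = h} j blankTape)) z≤n) ,
              λ eq → boot≢exec (cong proj₁ (toFin-injective control {boot , active A (entry A) , entry A} eq))
        where
        boot≢exec : boot ≢ exec
        boot≢exec ()
      hold : ∀ j → Holds binary-cell (lookup (Vec.zipWith updTape (Vec.replicate h blankTape) (Vec.replicate h (1F , stay))) j) 0 []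
      hold j rewrite Vec.lookup-zipWith (updTape {3}) j (Vec.replicate h blankTape) (Vec.replicate h (1F , stay))
                   | Vec.lookup-replicate {n = h} j (blankTape {3})
                   | Vec.lookup-replicate {n = h} {A = Fin 4 × Move} j (1F , stay) = holds-new refl (λ _ → refl) refl

    Finishes : Set
    Finishes = ∃₂ λ t ps → Run (AStep A x) t (entry A , Vec.replicate h 0) (final A , ps)

    finishes⇒accepts : Finishes → Accepts machine x
    finishes⇒accepts (_ , _ , p) =
      let _ , q , rep       = boot-up
          _ , d , q′ , rep′ = simulate forth back rep p
      in _ , d , run⇒reach machine x (forced⇒run q ++ʳ q′) , Represents.state-≡ rep′

    after-boot : ∀ {t c} → Reach machine x t c →
                 Inner c ⊎ (∃₂ λ u s → Run (AStep A x) u (entry A , Vec.replicate h 0) s × Rep c s)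
    after-boot r = let _ , q , rep = boot-up in resume ∣ q ∣ᶠ rep (run-along q (reach⇒run machine x r))
      where
      resume : ∀ {c d s t} k → Rep c s → Inner d ⊎ (∃ λ m → t ≡ k + m × Run _⟶_ m c d) →
               Inner d ⊎ (∃₂ λ u s′ → Run (AStep A x) u s s′ × Rep d s′)
      resume _ rep (inj₁ inner)       = inj₁ inner
      resume _ rep (inj₂ (_ , _ , p)) = unsimulate forth back rep p

    accepts⇒finishes : Accepts machine x → Finishes
    accepts⇒finishes (_ , _ , r , eq) = from-reach eq (after-boot r)
      where
      from-reach : ∀ {c} → state c ≡ qacc machine →
                   Inner c ⊎ (∃₂ λ u s → Run (AStep A x) u (entry A , Vec.replicate h 0) s × Rep c s) → Finishes
      from-reach eq (inj₁ (_ , ≢acc)) = contradiction eq ≢acc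
      from-reach eq (inj₂ (u , (l , ps) , p , rep)) =
        u , ps , subst (λ l → Run (AStep A x) u (entry A , Vec.replicate h 0) (l , ps)) (cong (proj₂ ∘ proj₂) modes) p
        where
        modes : (exec , active A l , l) ≡ (exec , active A (final A) , final A)
        modes = toFin-injective control (trans (≡.sym (Represents.state-≡ rep)) eq)

    confined : ∀ {t c} → Reach machine x t c → ∀ i → head (tape c i) ≤ suc Λ
    confined r = bounded (after-boot r)
      where
      bounded : ∀ {c} → Inner c ⊎ (∃₂ λ u s → Run (AStep A x) u (entry A , Vec.replicate h 0) s × Rep c s) →
                ∀ i → head (tape c i) ≤ suc Λ
      bounded (inj₁ (heads , _))        i = heads i
      bounded (inj₂ (_ , _ , _ , rep)) i = subst (_≤ suc Λ) (≡.sym (head-≡ (Represents.all-hold rep i))) z≤n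

  counter-length : List (Fin σ) → ℕ
  counter-length x = suc ⌊log₂ suc (length x) ⌋

  accepts⇔run : ∀ x → Accepts machine x ⇔ (∃₂ λ t ps → Run (AStep A x) t (entry A , Vec.replicate h 0) (final A , ps))
  accepts⇔run x = mk⇔ accepts⇒finishes finishes⇒accepts
    where open Simulation x (counter-length x) (<2^suc-log₂ (suc (length x)))

  logSpace : LogSpace machine
  -- Work heads stay within `suc Λ`, that is ⌊log₂ (n + 1)⌋ + 2, which is at most ⌊log₂ n⌋ + 3.
  logSpace = 3 , λ x t c r → VecAll.lookup⁻ (λ i → ℕ.≤-trans
               (Simulation.confined x (counter-length x) (<2^suc-log₂ (suc (length x))) r i) (room (length x)))
    where
    room : ∀ n → suc (suc ⌊log₂ suc n ⌋) ≤ 3 * ⌊log₂ n ⌋ + 3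
    room n = ℕ.≤-trans (s≤s (s≤s (log₂-suc≤ n)))
               (ℕ.≤-trans (ℕ.≤-reflexive (ℕ.+-comm 3 ⌊log₂ n ⌋)) (ℕ.+-monoˡ-≤ 3 (ℕ.m≤m+n ⌊log₂ n ⌋ (2 * ⌊log₂ n ⌋))))

-- Satisfiability and chains of implications

neg : Literal → Literal
neg (lit b v) = lit (not b) v

neg-involutive : ∀ l → neg (neg l) ≡ l
neg-involutive (lit b v) = cong (λ b → lit b v) (Bool.not-involutive b)

eval-neg : ∀ a l → evalLit a l ≡ true → evalLit a (neg l) ≢ true
eval-neg a (lit true  v) p q with () ← trans (≡.sym (cong not p)) q
eval-neg a (lit false v) p q with () ← trans (≡.sym (cong not q)) p

eval-either : ∀ a l → evalLit a l ≡ true ⊎ evalLit a (neg l) ≡ true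
eval-either a (lit true  v) with a v
... | true  = inj₁ refl
... | false = inj₂ refl
eval-either a (lit false v) with a v
... | true  = inj₂ refl
... | false = inj₁ refl

Satisfies : (ℕ → Bool) → Formula → Set
Satisfies a φ = All (Any (λ l → evalLit a l ≡ true)) φ

-- A clause with one literal counts as the disjunction of this literal with itself, so the literal
-- is its own sibling and is implied by its negation.
data Sibling (φ : Formula) : Literal → Literal → Set where
  first  : ∀ {a b} → (a ∷ b ∷ []) ∈ φ → Sibling φ a b
  second : ∀ {a b} → (a ∷ b ∷ []) ∈ φ → Sibling φ b a
  unit   : ∀ {a} → (a ∷ []) ∈ φ → Sibling φ a a

data Implies (φ : Formula) : Literal → Literal → Set where
  implies : ∀ {a b} → Sibling φ a b → Implies φ (neg a) b

Chain : Formula → Literal → Literal → Set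
Chain φ = Star (Implies φ)

sibling-sym : ∀ {φ a b} → Sibling φ a b → Sibling φ b a
sibling-sym (first p)  = second p
sibling-sym (second p) = first p
sibling-sym (unit p)   = unit p

contrapose : ∀ {φ y z} → Implies φ y z → Implies φ (neg z) (neg y)
contrapose {φ} (implies {a} {b} s) = subst (Implies φ (neg b)) (≡.sym (neg-involutive a)) (implies (sibling-sym s))

contrapose* : ∀ {φ y z} → Chain φ y z → Chain φ (neg z) (neg y)
contrapose* ε       = ε
contrapose* (e ◅ p) = contrapose* p ◅◅ (contrapose e ◅ ε)

Contradictory : Formula → Set
Contradictory φ = ∃ λ z → Chain φ z (neg z) × Chain φ (neg z) z

implies-eval : ∀ {φ a y z} → Satisfies a φ → Implies φ y z → evalLit a y ≡ true → evalLit a z ≡ true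
implies-eval {a = a} sat (implies {l} s) y-true = go s
  where
  l-false : evalLit a l ≢ true
  l-false l-true = eval-neg a l l-true y-true
  go : ∀ {m} → Sibling _ l m → evalLit a m ≡ true
  go (first p) with All.lookup sat p
  ... | here l-true          = contradiction l-true l-false
  ... | there (here m-true) = m-true
  go (second p) with All.lookup sat p
  ... | here m-true          = m-true
  ... | there (here l-true) = contradiction l-true l-false
  go (unit p) with All.lookup sat p
  ... | here l-true = l-true

chain-eval : ∀ {φ a y z} → Satisfies a φ → Chain φ y z → evalLit a y ≡ true → evalLit a z ≡ true
chain-eval sat ε       = id
chain-eval sat (e ◅ p) = chain-eval sat p ∘ implies-eval sat e

satisfiable⇒consistent : ∀ {φ} → Satisfiable φ → ¬ Contradictory φ
satisfiable⇒consistent (a , sat) (z , p , q) with eval-either a z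
... | inj₁ z-true  = eval-neg a z z-true (chain-eval sat p z-true)
... | inj₂ z̄-true = eval-neg a z (chain-eval sat q z̄-true) z̄-true

_[_≔_] : (ℕ → Bool) → ℕ → Bool → ℕ → Bool
(a [ v ≔ b ]) u with u ℕ.≟ v
... | yes _ = b
... | no  _ = a u

≔-outside : ∀ {a v b vs u} → u ∉ v ∷ vs → (a [ v ≔ b ]) u ≡ a u
≔-outside {v = v} {u = u} u∉ with u ℕ.≟ v
... | yes u≡v = contradiction (here u≡v) u∉
... | no  _   = refl

SatisfiableOn : Formula → (ℕ → Bool) → List ℕ → Set
SatisfiableOn φ base vs = ∃ λ a → (∀ v → v ∉ vs → a v ≡ base v) × Satisfies a φ

eval-cong : ∀ {a b} l → (∀ v → a v ≡ b v) → evalLit a l ≡ evalLit b l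
eval-cong (lit true  v) eq = eq v
eval-cong (lit false v) eq = cong not (eq v)

-- Fixing the values outside `vs` makes the search finite. The resulting decidability makes
-- satisfiability stable under double negation, so the assignment below may be constructed by
-- classical reasoning.
satisfiableOn? : ∀ φ base vs → Dec (SatisfiableOn φ base vs)
satisfiableOn? φ base [] with All.all? (Any.any? (λ l → evalLit base l Bool.≟ true)) φ
... | yes sat = yes (base , (λ _ _ → refl) , sat)
... | no unsat = no λ (a , agree , sat) → unsat (All.map (Any.map λ {l} p →
      trans (≡.sym (eval-cong l (λ v → agree v λ ()))) p) sat)
satisfiableOn? φ base (v ∷ vs) with satisfiableOn? φ (base [ v ≔ true ]) vs | satisfiableOn? φ (base [ v ≔ false ]) vs
... | yes (a , agree , sat) | _ = yes (a , (λ u u∉ → trans (agree u (u∉ ∘ there)) (≔-outside u∉)) , sat)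
... | no _ | yes (a , agree , sat) = yes (a , (λ u u∉ → trans (agree u (u∉ ∘ there)) (≔-outside u∉)) , sat)
... | no ¬t | no ¬f = no λ (a , agree , sat) → neither a agree sat
  where
  inside : ∀ {b} (a : ℕ → Bool) → a v ≡ b → (∀ u → u ∉ v ∷ vs → a u ≡ base u) → ∀ u → u ∉ vs → a u ≡ (base [ v ≔ b ]) u
  inside a eq agree u u∉ with u ℕ.≟ v
  ... | yes refl = eq
  ... | no  u≢v  = agree u λ { (here u≡v) → u≢v u≡v ; (there u∈) → u∉ u∈ }
  neither : ∀ a → (∀ u → u ∉ v ∷ vs → a u ≡ base u) → ¬ Satisfies a φ
  neither a agree sat with a v in eq
  ... | true  = ¬t (a , inside a eq agree , sat)
  ... | false = ¬f (a , inside a eq agree , sat)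

module _ {φ : Formula} (clauses : All (λ c → 1 ≤ length c × length c ≤ 2) φ) (consistent : ¬ Contradictory φ) where

  private
    -- The literals made true are those implied by one of the seeds.
    Derived : List Literal → Literal → Set
    Derived seeds l = Any (λ s → Chain φ s l) seeds

    Coherent : List Literal → Set
    Coherent seeds = ∀ l → Derived seeds l → ¬ Derived seeds (neg l)

    Decided : List Literal → ℕ → Set
    Decided seeds v = Derived seeds (lit true v) ⊎ Derived seeds (lit false v)

    derived-chain : ∀ {seeds l m} → Derived seeds l → Chain φ l m → Derived seeds m
    derived-chain d p = Any.map (_◅◅ p) d

    -- If the new seed and an old one imply opposite literals, contraposition carries the old one to
    -- `neg s`, against the second hypothesis. If the new seed implies both of two opposite
    -- literals, contraposition gives a chain from `s` to `neg s`, against the third.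
    add-seed : ∀ {seeds} s → Coherent seeds → ¬ Derived seeds (neg s) → ¬ Chain φ s (neg s) → Coherent (s ∷ seeds)
    add-seed s coh s̄∉ safe l (here p)  (here q)  = safe (p ◅◅ subst (λ m → Chain φ m (neg s)) (neg-involutive l) (contrapose* q))
    add-seed s coh s̄∉ safe l (here p)  (there q) = s̄∉ (derived-chain q (contrapose* p))
    add-seed s coh s̄∉ safe l (there p) (here q)  =
      s̄∉ (derived-chain p (subst (λ m → Chain φ m (neg s)) (neg-involutive l) (contrapose* q)))
    add-seed s coh s̄∉ safe l (there p) (there q) = coh l p q

    -- A variable left open by the seeds is made true unless this literal implies its own negation.
    -- In that case making it false is safe, since the formula is consistent. Both distinctions ask
    -- for the existence of chains, whence the double negation.
    decide-all : ∀ vs → ¬ ¬ (∃ λ seeds → Coherent seeds × All (Decided seeds) vs)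
    decide-all []       k = k ([] , (λ _ ()) , [])
    decide-all (v ∷ vs) k = decide-all vs λ (seeds , coh , decided) →
      ¬¬-excluded-middle λ where
        (yes d) → k (seeds , coh , d ∷ decided)
        (no ¬d) → ¬¬-excluded-middle λ where
          (no safe) → k (lit true v ∷ seeds , add-seed (lit true v) coh (¬d ∘ inj₂) safe , inj₁ (here ε) ∷ All.map grow decided)
          (yes p)   → k (lit false v ∷ seeds ,
                         add-seed (lit false v) coh (¬d ∘ inj₁) (λ q → consistent (lit true v , p , q)) ,
                         inj₂ (here ε) ∷ All.map grow decided)
      where
      grow : ∀ {s seeds v} → Decided seeds v → Decided (s ∷ seeds) v
      grow (inj₁ d) = inj₁ (there d)
      grow (inj₂ d) = inj₂ (there d)

    vars : List ℕ
    vars = List.map var (literals φ)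

    assignment : ∀ {seeds} → All (Decided seeds) vars → ℕ → Bool
    assignment decided v with v ∈? vars
    ... | no  _  = false
    ... | yes v∈ with All.lookup decided v∈
    ...   | inj₁ _ = true
    ...   | inj₂ _ = false

    assignment-spec : ∀ {seeds} (decided : All (Decided seeds) vars) {v} → v ∈ vars →
                      (assignment decided v ≡ true × Derived seeds (lit true v))
                      ⊎ (assignment decided v ≡ false × Derived seeds (lit false v))
    assignment-spec decided {v} v∈′ with v ∈? vars
    ... | no  v∉ = contradiction v∈′ v∉
    ... | yes v∈ with All.lookup decided v∈
    ...   | inj₁ t = inj₁ (refl , t)
    ...   | inj₂ f = inj₂ (refl , f)

    derived-true : ∀ {seeds} (decided : All (Decided seeds) vars) → Coherent seeds →
                   ∀ l → var l ∈ vars → Derived seeds l → evalLit (assignment decided) l ≡ true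
    derived-true decided coh (lit b v) v∈ d with assignment-spec decided v∈
    derived-true decided coh (lit true  v) _ d | inj₁ (eq , _) = eq
    derived-true decided coh (lit false v) _ d | inj₁ (_ , t)  = contradiction d (coh (lit true v) t)
    derived-true decided coh (lit true  v) _ d | inj₂ (_ , f)  = contradiction f (coh (lit true v) d)
    derived-true decided coh (lit false v) _ d | inj₂ (eq , _) = cong not eq

    derived-either : ∀ {seeds} → All (Decided seeds) vars → ∀ l → var l ∈ vars → Derived seeds l ⊎ Derived seeds (neg l)
    derived-either decided (lit true  v) v∈ = All.lookup decided v∈
    derived-either decided (lit false v) v∈ with All.lookup decided v∈
    ... | inj₁ t = inj₂ t
    ... | inj₂ f = inj₁ f

    var∈ : ∀ {c l} → c ∈ φ → l ∈ c → var l ∈ vars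
    var∈ c∈ l∈ = Membership.∈-map⁺ var (Membership.∈-concat⁺′ l∈ (Membership.∈-map⁺ _ c∈))

    satisfies : ∀ {seeds} (decided : All (Decided seeds) vars) → Coherent seeds → Satisfies (assignment decided) φ
    satisfies {seeds} decided coh = All.tabulate λ {c} c∈ → clause-true c c∈ (All.lookup clauses c∈)
      where
      make-true : ∀ {c l} → c ∈ φ → l ∈ c → Derived seeds l → Any (λ l → evalLit (assignment decided) l ≡ true) c
      make-true {l = l} c∈ l∈ d = Any.map (λ { refl → derived-true decided coh l (var∈ c∈ l∈) d }) l∈
      clause-true : ∀ c → c ∈ φ → 1 ≤ length c × length c ≤ 2 → Any (λ l → evalLit (assignment decided) l ≡ true) c
      clause-true []              _  (() , _)
      clause-true (a ∷ [])        c∈ _ with derived-either decided a (var∈ c∈ (here refl))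
      ... | inj₁ d = make-true c∈ (here refl) d
      ... | inj₂ d = make-true c∈ (here refl) (derived-chain d (implies (unit c∈) ◅ ε))
      clause-true (a ∷ b ∷ [])    c∈ _ with derived-either decided a (var∈ c∈ (here refl))
      ... | inj₁ d = make-true c∈ (here refl) d
      ... | inj₂ d = make-true c∈ (there (here refl)) (derived-chain d (implies (first c∈) ◅ ε))
      clause-true (_ ∷ _ ∷ _ ∷ _) _  (_ , s≤s (s≤s ()))

  consistent⇒satisfiable : Satisfiable φ
  consistent⇒satisfiable = proj₁ found , proj₂ (proj₂ found)
    where
    outside-vars : ∀ {seeds} (decided : All (Decided seeds) vars) v → v ∉ vars → assignment decided v ≡ false
    outside-vars decided v v∉ with v ∈? vars
    ... | yes v∈ = contradiction v∈ v∉
    ... | no  _  = refl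
    found : SatisfiableOn φ (λ _ → false) vars
    found = decidable-stable (satisfiableOn? φ (λ _ → false) vars) λ k →
      decide-all vars λ (seeds , coh , decided) → k (assignment decided , outside-vars decided , satisfies decided coh)

-- An automaton that finds contradictory chains

-- The three heads: on the literal reached so far (current), on a clause using its
-- negation (scout), and on the literal z of the contradiction z ⇝ ¬z ⇝ z (goal).
pattern scout   = 0F
pattern current = 1F
pattern goal    = 2F

-- A comparison of the literal under the scout or goal head with the one under the
-- current head. The Boolean is false on the way from z to ¬z and true on the way back.
data Task : Set where
  origin half close : Task
  jump land        : Bool → Task

-- Index 1 refers to the head chosen by the task, index 2 to `current`. A letter read by the first
-- is remembered in the label until the second has read its own; `digit₂ nothing` means that the
-- first name is over. After success both heads return to their signs. `back₁′` takes the first head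
-- off the letter that ended its name; for `current` this move is part of leaving `digit₂ nothing`.
data Stage : Set where
  sign₁ : Stage
  sign₂ : Bool → Stage
  digit₁ : Stage
  digit₂ : Maybe Bool → Stage
  back₂ back₁′ back₁ : Stage

-- From a literal the scout goes to the next one, to the previous one, or stays on it if it is alone
-- in its clause. The `alone` states verify the last case: the letter on the left must be a clause
-- end or the endmarker, and the letter after the name a clause end. The head then returns by
-- `to-left`.
data Walk : Set where
  loop wander-scout sibling wander-current to-right to-left alone alone-right alone-end : Walk

data Label₃ : Set where
  compare              : Task → Stage → Label₃
  walk                 : Walk → Bool → Label₃
  place-goal place-current accept : Label₃

finite-Bool : Finite Bool
finite-Bool = finite-enumeration
  (false ∷ true ∷ [])
  (λ { false → 0F ; true → 1F })
  (λ { false → refl ; true → refl })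

finite-Task : Finite Task
finite-Task = finite-enumeration
  (origin ∷ half ∷ close ∷ jump false ∷ jump true ∷ land false ∷ land true ∷ [])
  (λ { origin → 0F ; half → 1F ; close → 2F ; (jump false) → 3F ; (jump true) → 4F ; (land false) → 5F ; (land true) → 6F })
  (λ { origin → refl ; half → refl ; close → refl ; (jump false) → refl ; (jump true) → refl ; (land false) → refl ;
       (land true) → refl })

finite-Stage : Finite Stage
finite-Stage = finite-enumeration
  (sign₁ ∷ sign₂ false ∷ sign₂ true ∷ digit₁ ∷ digit₂ (just false) ∷ digit₂ (just true) ∷
   digit₂ nothing ∷ back₂ ∷ back₁′ ∷ back₁ ∷ [])
  (λ { sign₁ → 0F ; (sign₂ false) → 1F ; (sign₂ true) → 2F ; digit₁ → 3F ; (digit₂ (just false)) → 4F ;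
     (digit₂ (just true)) → 5F ; (digit₂ nothing) → 6F ; back₂ → 7F ; back₁′ → 8F ; back₁ → 9F })
  (λ { sign₁ → refl ; (sign₂ false) → refl ; (sign₂ true) → refl ; digit₁ → refl ;
     (digit₂ (just false)) → refl ; (digit₂ (just true)) → refl ; (digit₂ nothing) → refl ;
     back₂ → refl ; back₁′ → refl ; back₁ → refl })

finite-Walk : Finite Walk
finite-Walk = finite-enumeration
  (loop ∷ wander-scout ∷ sibling ∷ wander-current ∷ to-right ∷ to-left ∷ alone ∷ alone-right ∷
   alone-end ∷ [])
  (λ { loop → 0F ; wander-scout → 1F ; sibling → 2F ; wander-current → 3F ; to-right → 4F ; to-left → 5F ;
     alone → 6F ; alone-right → 7F ; alone-end → 8F })
  (λ { loop → refl ; wander-scout → refl ; sibling → refl ; wander-current → refl ; to-right → refl ;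
     to-left → refl ; alone → refl ; alone-right → refl ; alone-end → refl })

finite-Label : Finite Label₃
finite-Label = finite-retract (finite-⊎ (finite-× finite-Task finite-Stage) (finite-⊎ (finite-× finite-Walk finite-Bool) (finite-Fin 3)))
                 to from from-to
  where
  to : Label₃ → (Task × Stage) ⊎ ((Walk × Bool) ⊎ Fin 3)
  to (compare t s) = inj₁ (t , s)
  to (walk w b)    = inj₂ (inj₁ (w , b))
  to place-goal    = inj₂ (inj₂ 0F)
  to place-current = inj₂ (inj₂ 1F)
  to accept        = inj₂ (inj₂ 2F)
  from : (Task × Stage) ⊎ ((Walk × Bool) ⊎ Fin 3) → Label₃
  from (inj₁ (t , s))        = compare t s
  from (inj₂ (inj₁ (w , b))) = walk w b
  from (inj₂ (inj₂ i))       = lookup (place-goal ∷ place-current ∷ accept ∷ []) i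
  from-to : ∀ l → from (to l) ≡ l
  from-to (compare _ _) = refl
  from-to (walk _ _)    = refl
  from-to place-goal    = refl
  from-to place-current = refl
  from-to accept        = refl

data Class : Set where
  digit sign : Bool → Class
  end edge   : Class

classify : InSym 5 → Class
classify ⊢        = edge
classify ⊣        = edge
classify (sym 0F) = digit false
classify (sym 1F) = digit true
classify (sym 2F) = sign true
classify (sym 3F) = sign false
classify (sym 4F) = end

by-scout : Task → Bool
by-scout origin    = false
by-scout half     = false
by-scout close    = false
by-scout (jump _) = true
by-scout (land _) = true

compared : Task → Fin 3
compared t with by-scout t
... | true  = scout
... | false = goal

expected : Task → Bool → Bool
expected origin    b = b
expected half     b = not b
expected close    b = b
expected (jump _) b = not b
expected (land _) b = b

exit : Task → Label₃
exit origin    = walk loop false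
exit half     = walk loop true
exit close    = accept
exit (jump b) = walk sibling b
exit (land b) = walk loop b

closing : Bool → Task
closing false = half
closing true  = close

stage-head : Task → Stage → Fin 3
stage-head t sign₁      = compared t
stage-head t (sign₂ _)  = current
stage-head t digit₁     = compared t
stage-head t (digit₂ _) = current
stage-head t back₂      = current
stage-head t back₁′     = compared t
stage-head t back₁      = compared t

walk-head : Walk → Fin 3
walk-head wander-current = current
walk-head _              = scout

label-head : Label₃ → Fin 3
label-head (compare t s) = stage-head t s
label-head (walk w _)    = walk-head w
label-head place-goal    = goal
label-head place-current = current
label-head accept        = scout

if-equal : Bool → Bool → Label₃ × Move → List (Label₃ × Move)
if-equal b c o with b Bool.≟ c
... | yes _ = o ∷ []
... | no  _ = []

compare-moves : Task → Stage → Class → List (Label₃ × Move)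
compare-moves t sign₁               (sign b)  = (compare t (sign₂ b) , right) ∷ []
compare-moves t (sign₂ b)           (sign c)  = if-equal b (expected t c) (compare t digit₁ , right)
compare-moves t digit₁              (digit b) = (compare t (digit₂ (just b)) , right) ∷ []
compare-moves t digit₁              (sign _)  = (compare t (digit₂ nothing) , stay) ∷ []
compare-moves t digit₁              end       = (compare t (digit₂ nothing) , stay) ∷ []
compare-moves t (digit₂ (just b))   (digit c) = if-equal b c (compare t digit₁ , right)
compare-moves t (digit₂ nothing)    (sign _)  = (compare t back₂ , left) ∷ []
compare-moves t (digit₂ nothing)    end       = (compare t back₂ , left) ∷ []
compare-moves t back₂               (digit _) = (compare t back₂ , left) ∷ []
compare-moves t back₂               (sign _)  = (compare t back₁′ , stay) ∷ []
compare-moves t back₁′              _         = (compare t back₁ , left) ∷ []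
compare-moves t back₁               (digit _) = (compare t back₁ , left) ∷ []
compare-moves t back₁               (sign _)  = (exit t , stay) ∷ []
compare-moves _ _                   _         = []

wander : Label₃ → Label₃ → List (Label₃ × Move)
wander l l′ = (l , left) ∷ (l , right) ∷ (l′ , stay) ∷ []

walk-moves : Bool → Walk → Class → List (Label₃ × Move)
walk-moves b loop           _         = (walk wander-scout b , stay) ∷ (compare (closing b) sign₁ , stay) ∷ []
walk-moves b wander-scout   _         = wander (walk wander-scout b) (compare (jump b) sign₁)
walk-moves b sibling        _         = (walk to-right b , right) ∷ (walk to-left b , left) ∷ (walk alone b , left) ∷ []
walk-moves b wander-current _         = wander (walk wander-current b) (compare (land b) sign₁)
walk-moves b to-right       (digit _) = (walk to-right b , right) ∷ []
walk-moves b to-right       (sign _)  = (walk wander-current b , stay) ∷ []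
walk-moves b to-left        (digit _) = (walk to-left b , left) ∷ []
walk-moves b to-left        (sign _)  = (walk wander-current b , stay) ∷ []
walk-moves b alone          end       = (walk alone-right b , right) ∷ []
walk-moves b alone          edge      = (walk alone-right b , right) ∷ []
walk-moves b alone-right    _         = (walk alone-end b , right) ∷ []
walk-moves b alone-end      (digit _) = (walk alone-end b , right) ∷ []
walk-moves b alone-end      end       = (walk to-left b , left) ∷ []
walk-moves _ _              _         = []

label-moves : Label₃ → Class → List (Label₃ × Move)
label-moves (compare t s) c = compare-moves t s c
label-moves (walk w b)    c = walk-moves b w c
label-moves place-goal    c = wander place-goal place-current
label-moves place-current c = wander place-current (compare origin sign₁)
label-moves accept        c = []

prover : Automaton 5 3
prover = record
  { Label  = Label₃
  ; labels = finite-Label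
  ; entry  = place-goal
  ; final  = accept
  ; active = label-head
  ; moves  = λ l a → label-moves l (classify a)
  }

-- Encoded formulas as sequences of tokens

data Token : Set where
  literal : Literal → Token
  close-clause : Token

bits : ℕᵇ → List Bool
bits ℕᵇ.zero  = []
bits 2[1+ b ] = true ∷ bits b
bits 1+[2 b ] = false ∷ bits b

bits-injective : ∀ a b → bits a ≡ bits b → a ≡ b
bits-injective ℕᵇ.zero  ℕᵇ.zero  _  = refl
bits-injective 2[1+ a ] 2[1+ b ] eq = cong 2[1+_] (bits-injective a b (List.∷-injectiveʳ eq))
bits-injective 1+[2 a ] 1+[2 b ] eq = cong 1+[2_] (bits-injective a b (List.∷-injectiveʳ eq))

name : Literal → List Bool
name l = bits (fromℕ (var l))

digit-char sign-char : Bool → Fin 5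
digit-char false = 0F
digit-char true  = 1F
sign-char true  = 2F
sign-char false = 3F

literal-≡ : ∀ {l m} → positive l ≡ positive m → name l ≡ name m → l ≡ m
literal-≡ {lit b v} {lit _ w} refl eq = cong (lit b) (fromℕ-injective (bits-injective (fromℕ v) (fromℕ w) eq))

digits : List Bool → List (Fin 5)
digits = List.map digit-char

encBin≡digits : ∀ b → encBin b ≡ digits (bits b)
encBin≡digits ℕᵇ.zero  = refl
encBin≡digits 2[1+ b ] = cong (1F ∷_) (encBin≡digits b)
encBin≡digits 1+[2 b ] = cong (0F ∷_) (encBin≡digits b)

spell : Token → List (Fin 5)
spell (literal l)  = sign-char (positive l) ∷ digits (name l)
spell close-clause = 4F ∷ []

spell-all : List Token → List (Fin 5)
spell-all = List.concatMap spell

-- The text on the left of a head, nearest letter first, if `us` are the tokens there, nearest token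
-- first.
spell-reversed : List Token → List (Fin 5)
spell-reversed []       = []
spell-reversed (t ∷ us) = spell t ʳ++ spell-reversed us

clause-tokens : Clause → List Token
clause-tokens c = List.map literal c ++ close-clause ∷ []

tokens : Formula → List Token
tokens = List.concatMap clause-tokens

encLit≡spell : ∀ l → encLit l ≡ spell (literal l)
encLit≡spell (lit true  v) = cong (2F ∷_) (encBin≡digits (fromℕ v))
encLit≡spell (lit false v) = cong (3F ∷_) (encBin≡digits (fromℕ v))

spell-++ : ∀ ts us → spell-all (ts ++ us) ≡ spell-all ts ++ spell-all us
spell-++ = List.concatMap-++ spell

encClause≡spell : ∀ c → encClause c ≡ spell-all (clause-tokens c)
encClause≡spell []      = refl
encClause≡spell (l ∷ c) = cong₂ _++_ (encLit≡spell l) (encClause≡spell c)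

encode≡spell : ∀ φ → encode φ ≡ spell-all (tokens φ)
encode≡spell []      = refl
encode≡spell (c ∷ φ) = trans (cong₂ _++_ (encClause≡spell c) (encode≡spell φ)) (≡.sym (spell-++ (clause-tokens c) (tokens φ)))

spell-ʳ++ : ∀ us ts → spell-all (us ʳ++ ts) ≡ spell-reversed us ʳ++ spell-all ts
spell-ʳ++ []       ts = refl
spell-ʳ++ (u ∷ us) ts = trans (spell-ʳ++ us (u ∷ ts)) (≡.sym (List.ʳ++-ʳ++ (spell u)))

digits-reversed : ∀ bs us → digits bs ʳ++ us ≡ digits (List.reverse bs) ++ us
digits-reversed bs us = trans (List.ʳ++-defn (digits bs)) (cong (_++ us) (≡.sym (List.reverse-map digit-char bs)))

spell-literal-reversed : ∀ l us → spell-reversed (literal l ∷ us)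
                                 ≡ digits (List.reverse (name l)) ++ sign-char (positive l) ∷ spell-reversed us
spell-literal-reversed l us = digits-reversed (name l) (sign-char (positive l) ∷ spell-reversed us)

NonDigit : List (Fin 5) → Set
NonDigit y = ∃₂ λ c w → y ≡ c ∷ w × (∀ d → c ≢ digit-char d)

spell-nonDigit : ∀ t ts → NonDigit (spell-all (t ∷ ts))
spell-nonDigit (literal (lit true  v)) ts = _ , _ , refl , λ { false () ; true () }
spell-nonDigit (literal (lit false v)) ts = _ , _ , refl , λ { false () ; true () }
spell-nonDigit close-clause            ts = _ , _ , refl , λ { false () ; true () }

digit≢sign : ∀ d b → just (digit-char d) ≢ just (sign-char b)
digit≢sign false false ()
digit≢sign false true  ()
digit≢sign true  false ()
digit≢sign true  true  ()

-- Digits and clause ends differ from signs, so a sign can only be the first letter of a literal. A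
-- head that has wandered anywhere and reads a sign therefore stands on an occurrence.
sign-starts-literal : ∀ us ts i b → lookupMaybe (spell-all ts) i ≡ just (sign-char b) →
  ∃ λ us′ → ∃₂ λ l ts′ → us ʳ++ ts ≡ us′ ʳ++ (literal l ∷ ts′) × length (spell-reversed us) + i ≡ length (spell-reversed us′)
sign-starts-literal us (close-clause ∷ ts) zero true ()
sign-starts-literal us (close-clause ∷ ts) zero false ()
sign-starts-literal us (close-clause ∷ ts) (suc i) b eq with sign-starts-literal (close-clause ∷ us) ts i b eq
... | us′ , l , ts′ , split , len = us′ , l , ts′ , split , trans (ℕ.+-suc _ i) len
sign-starts-literal us (literal l ∷ ts) zero b eq = us , l , ts , refl , ℕ.+-identityʳ _
sign-starts-literal us (literal l ∷ ts) (suc i) b eq with skip-digits (name l) i eq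
  where
  skip-digits : ∀ bs i → lookupMaybe (digits bs ++ spell-all ts) i ≡ just (sign-char b) →
                ∃ λ j → i ≡ length bs + j × lookupMaybe (spell-all ts) j ≡ just (sign-char b)
  skip-digits []           i       eq = i , refl , eq
  skip-digits (d ∷ _)      zero    eq = contradiction eq (digit≢sign d b)
  skip-digits (_ ∷ bs)     (suc i) eq with skip-digits bs i eq
  ... | j , refl , eq′ = j , refl , eq′
... | j , refl , eq′ with sign-starts-literal (literal l ∷ us) ts j b eq′
...   | us′ , m , ts′ , split , len = us′ , m , ts′ , split , trans width len
  where
  open ≡.≡-Reasoning
  width : length (spell-reversed us) + suc (length (name l) + j) ≡ length (spell-reversed (literal l ∷ us)) + j
  width = begin
    length (spell-reversed us) + (suc (length (name l)) + j)             ≡⟨ ℕ.+-assoc (length (spell-reversed us)) _ j ⟨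
    length (spell-reversed us) + suc (length (name l)) + j               ≡⟨ cong (_+ j) (ℕ.+-comm (length (spell-reversed us)) _) ⟩
    suc (length (name l)) + length (spell-reversed us) + j               ≡⟨ cong (λ k → suc k + length (spell-reversed us) + j) (List.length-map digit-char (name l)) ⟨
    length (spell (literal l)) + length (spell-reversed us) + j          ≡⟨ cong (_+ j) (List.length-ʳ++ (spell (literal l))) ⟨
    length (spell-reversed (literal l ∷ us)) + j                         ∎

TwoSat : Formula → Set
TwoSat = All (λ c → 1 ≤ length c × length c ≤ 2)

-- Every clause is closed, so each literal is followed by a token, whose first letter marks the end
-- of the name.
tokens-end : ∀ φ {us l} → tokens φ ≢ us ++ literal l ∷ []
tokens-end []              {[]}            ()
tokens-end []              {_ ∷ _}         ()
tokens-end ([] ∷ φ)        {[]}            ()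
tokens-end ([] ∷ φ)        {_ ∷ us}        eq = tokens-end φ {us} (List.∷-injectiveʳ eq)
tokens-end ((a ∷ []) ∷ φ)  {[]}            ()
tokens-end ((a ∷ b ∷ c) ∷ φ) {[]}          ()
tokens-end ((a ∷ c) ∷ φ)   {_ ∷ us}        eq = tokens-end (c ∷ φ) {us} (List.∷-injectiveʳ eq)

-- Clauses have at most two literals, so two literals without a clause end between them make up a
-- whole clause.
adjacent⇒clause : ∀ {φ} → TwoSat φ → ∀ us {a b ts} → tokens φ ≡ us ++ literal a ∷ literal b ∷ ts → (a ∷ b ∷ []) ∈ φ
adjacent⇒clause []                                []      ()
adjacent⇒clause []                                (_ ∷ _) ()
adjacent⇒clause {[] ∷ φ}              ((() , _) ∷ _)
adjacent⇒clause {(c ∷ []) ∷ φ}        (_ ∷ ok) []                 ()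
adjacent⇒clause {(c ∷ []) ∷ φ}        (_ ∷ ok) (_ ∷ [])           ()
adjacent⇒clause {(c ∷ []) ∷ φ}        (_ ∷ ok) (_ ∷ _ ∷ us)       eq = there (adjacent⇒clause ok us (List.∷-injectiveʳ (List.∷-injectiveʳ eq)))
adjacent⇒clause {(c ∷ d ∷ []) ∷ φ}    (_ ∷ ok) []                 refl = here refl
adjacent⇒clause {(c ∷ d ∷ []) ∷ φ}    (_ ∷ ok) (_ ∷ [])           ()
adjacent⇒clause {(c ∷ d ∷ []) ∷ φ}    (_ ∷ ok) (_ ∷ _ ∷ [])       ()
adjacent⇒clause {(c ∷ d ∷ []) ∷ φ}    (_ ∷ ok) (_ ∷ _ ∷ _ ∷ us)   eq =
  there (adjacent⇒clause ok us (List.∷-injectiveʳ (List.∷-injectiveʳ (List.∷-injectiveʳ eq))))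
adjacent⇒clause {(_ ∷ _ ∷ _ ∷ _) ∷ φ} ((_ , s≤s (s≤s ())) ∷ _)

-- The additional `close-clause` in front gives the first clause the same left boundary as all
-- others.
alone⇒clause : ∀ {φ} → TwoSat φ → ∀ us {a ts} →
               close-clause ∷ tokens φ ≡ us ++ close-clause ∷ literal a ∷ close-clause ∷ ts → (a ∷ []) ∈ φ
alone⇒clause {[]}                  _        []           ()
alone⇒clause {[]}                  _        (_ ∷ [])     ()
alone⇒clause {[]}                  _        (_ ∷ _ ∷ _)  ()
alone⇒clause {[] ∷ φ}              ((() , _) ∷ _)
alone⇒clause {(c ∷ []) ∷ φ}        (_ ∷ ok) []                   refl = here refl
alone⇒clause {(c ∷ []) ∷ φ}        (_ ∷ ok) (_ ∷ [])             ()
alone⇒clause {(c ∷ []) ∷ φ}        (_ ∷ ok) (_ ∷ _ ∷ us)         eq = there (alone⇒clause ok us (List.∷-injectiveʳ (List.∷-injectiveʳ eq)))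
alone⇒clause {(c ∷ d ∷ []) ∷ φ}    (_ ∷ ok) []                   ()
alone⇒clause {(c ∷ d ∷ []) ∷ φ}    (_ ∷ ok) (_ ∷ [])             ()
alone⇒clause {(c ∷ d ∷ []) ∷ φ}    (_ ∷ ok) (_ ∷ _ ∷ [])         ()
alone⇒clause {(c ∷ d ∷ []) ∷ φ}    (_ ∷ ok) (_ ∷ _ ∷ _ ∷ us)     eq =
  there (alone⇒clause ok us (List.∷-injectiveʳ (List.∷-injectiveʳ (List.∷-injectiveʳ eq))))
alone⇒clause {(_ ∷ _ ∷ _ ∷ _) ∷ φ} ((_ , s≤s (s≤s ())) ∷ _)

∈⇒tokens : ∀ {c φ} → c ∈ φ → ∃₂ λ us ts → close-clause ∷ tokens φ ≡ us ++ close-clause ∷ clause-tokens c ++ ts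
∈⇒tokens {c} {_ ∷ φ} (here refl) = [] , tokens φ , refl
∈⇒tokens {c} {d ∷ φ} (there c∈) with ∈⇒tokens c∈
... | us , ts , eq = close-clause ∷ List.map literal d ++ us , ts , cong (close-clause ∷_) (begin
  (List.map literal d ++ close-clause ∷ []) ++ tokens φ               ≡⟨ List.++-assoc (List.map literal d) _ _ ⟩
  List.map literal d ++ close-clause ∷ tokens φ                       ≡⟨ cong (List.map literal d ++_) eq ⟩
  List.map literal d ++ us ++ close-clause ∷ clause-tokens c ++ ts    ≡⟨ List.++-assoc (List.map literal d) us _ ⟨
  (List.map literal d ++ us) ++ close-clause ∷ clause-tokens c ++ ts  ∎)
  where open ≡.≡-Reasoning

-- Heads on the input text

module Reading {σ} (x : List (Fin σ)) where

  private
    n : ℕ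
    n = length x

  -- The head at position p has the (reversed) text u on its left, and reads the first character of y.
  record At (p : ℕ) (u y : List (Fin σ)) : Set where
    constructor at
    field
      text : u ʳ++ y ≡ x
      pos  : p ≡ suc (length u)

  at-read : ∀ {p u c y} → At p u (c ∷ y) → readIn x p ≡ sym c
  at-read {u = u} (at text refl) = subst (λ x → readIn x (suc (length u)) ≡ sym _) text (readIn-zip u)

  at-length : ∀ {p u y} → At p u y → length u + length y ≡ n
  at-length {u = u} (at text refl) = trans (≡.sym (List.length-ʳ++ u)) (cong length text)

  at-bounded : ∀ {p u y} → At p u y → p ≤ suc n
  at-bounded {u = u} a@(at text refl) = s≤s (subst (length u ≤_) (at-length a) (ℕ.m≤m+n _ _))

  at-stay : ∀ {p u y} → At p u y → moveHead stay p ⊓ suc n ≡ p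
  at-stay a = ℕ.m≤n⇒m⊓n≡m (at-bounded a)

  at-right : ∀ {p u c y} → At p u (c ∷ y) → At (moveHead right p ⊓ suc n) (c ∷ u) y
  at-right {u = u} {y = y} a@(at text refl) = at text (ℕ.m≤n⇒m⊓n≡m (s≤s
    (subst (suc (length u) ≤_) (at-length a) (ℕ.m<m+n (length u) (s≤s z≤n)))))

  at-left : ∀ {p u c y} → At p (c ∷ u) y → At (moveHead left p ⊓ suc n) u (c ∷ y)
  at-left {u = u} a@(at text refl) = at text (ℕ.m≤n⇒m⊓n≡m (ℕ.≤-trans (ℕ.n≤1+n _) (at-bounded a)))


updateAt≡≔ : ∀ {A : Set} {n} (xs : Vec A n) i {f} → Vec.updateAt xs i f ≡ xs Vec.[ i ]≔ f (lookup xs i)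
updateAt≡≔ (x ∷ xs) zero    = refl
updateAt≡≔ (x ∷ xs) (suc i) = cong (x ∷_) (updateAt≡≔ xs i)

classify-digit : ∀ b → classify (sym (digit-char b)) ≡ digit b
classify-digit false = refl
classify-digit true  = refl

classify-sign : ∀ b → classify (sym (sign-char b)) ≡ sign b
classify-sign false = refl
classify-sign true  = refl

classified-sign : ∀ {c b} → classify (sym c) ≡ sign b → c ≡ sign-char b
classified-sign {2F} refl = refl
classified-sign {3F} refl = refl
classified-sign {4F} ()

data Terminator : Class → Set where
  sign : ∀ b → Terminator (sign b)
  end  : Terminator end

terminator : ∀ {c} → (∀ d → c ≢ digit-char d) → Terminator (classify (sym c))
terminator {0F} ¬digit = contradiction refl (¬digit false)
terminator {1F} ¬digit = contradiction refl (¬digit true)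
terminator {2F} ¬digit = sign true
terminator {3F} ¬digit = sign false
terminator {4F} ¬digit = end

if-equal-≡ : ∀ {b c} o → b ≡ c → if-equal b c o ≡ o ∷ []
if-equal-≡ {b} o refl with b Bool.≟ b
... | yes _   = refl
... | no  b≢b = contradiction refl b≢b

if-equal-≢ : ∀ {b c} o → b ≢ c → if-equal b c o ≡ []
if-equal-≢ {b} {c} o b≢c with b Bool.≟ c
... | yes b≡c = contradiction b≡c b≢c
... | no  _   = refl

-- One notation for both kinds of comparison: `h` is the compared head, `b` is `current`, and `o` is
-- the head at rest.
arrange : Task → ℕ → ℕ → ℕ → Vec ℕ 3
arrange t h b o with by-scout t
... | true  = h ∷ b ∷ o ∷ []
... | false = o ∷ b ∷ h ∷ []

arrange-compared : ∀ t {h b o} → lookup (arrange t h b o) (compared t) ≡ h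
arrange-compared t with by-scout t
... | true  = refl
... | false = refl

arrange-current : ∀ t {h b o} → lookup (arrange t h b o) current ≡ b
arrange-current t with by-scout t
... | true  = refl
... | false = refl

arrange-≔-compared : ∀ t {h b o p} → arrange t h b o Vec.[ compared t ]≔ p ≡ arrange t p b o
arrange-≔-compared t with by-scout t
... | true  = refl
... | false = refl

arrange-≔-current : ∀ t {h b o p} → arrange t h b o Vec.[ current ]≔ p ≡ arrange t h p o
arrange-≔-current t with by-scout t
... | true  = refl
... | false = refl

-- The cases in which a literal to the right of the tokens `us` begins its clause.
data Boundary : List Token → Set where
  first-token  : Boundary []
  after-clause : ∀ {us} → Boundary (close-clause ∷ us)

-- Accepting runs of the automaton are contradictory chains

module ProverRuns (φ : Formula) (clauses : TwoSat φ) where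

  private
    x : List (Fin 5)
    x = encode φ

    n : ℕ
    n = length x

    _⟶_ : Position prover → Position prover → Set
    _⟶_ = AStep prover x

    NotFinal : Position prover → Set
    NotFinal (l , _) = l ≢ accept

    _⇒_ : Position prover → Position prover → Set
    _⇒_ = Forced _⟶_ NotFinal

  open Reading x

  Wins : Position prover → Set
  Wins s = ∃₂ λ k ps → Run _⟶_ k s (accept , ps)

  private
    moved : Move → ℕ → ℕ
    moved m p = moveHead m p ⊓ suc n

    move-options : ∀ {l ps p c} → lookup ps (label-head l) ≡ p → classify (readIn x p) ≡ c →
                   label-moves l (classify (readIn x (lookup ps (label-head l)))) ≡ label-moves l c
    move-options {l} at-p is-c = cong (label-moves l) (trans (cong (classify ∘ readIn x) at-p) is-c)

    may : ∀ {l ps p c l′ m} → lookup ps (label-head l) ≡ p → classify (readIn x p) ≡ c → (l′ , m) ∈ label-moves l c →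
          (l , ps) ⟶ (l′ , ps Vec.[ label-head l ]≔ moved m p)
    may {l} {ps} {l′ = l′} {m} refl is-c o∈ =
      (l′ , m) , subst ((l′ , m) ∈_) (≡.sym (move-options {l} {ps} refl is-c)) o∈ , cong (l′ ,_) (≡.sym (updateAt≡≔ ps (label-head l)))

    must : ∀ {l ps p c l′ m q} → lookup ps (label-head l) ≡ p → classify (readIn x p) ≡ c → l ≢ accept →
           label-moves l c ≡ (l′ , m) ∷ [] → moved m p ≡ q → (l , ps) ⇒ (l′ , ps Vec.[ label-head l ]≔ q)
    must {l} {ps} {c = c} {l′} {m} refl is-c ≢acc eq refl = (≢acc , may {l} {c = c} {l′} {m} refl is-c (subst ((l′ , m) ∈_) (≡.sym eq) (here refl)) , only) ∷ []
      where
      only : ∀ {u} → (l , ps) ⟶ u → u ≡ (l′ , ps Vec.[ label-head l ]≔ moved m (lookup ps (label-head l)))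
      only (_ , o∈ , refl) with subst (_ ∈_) (trans (move-options {l} {ps} refl is-c) eq) o∈
      ... | here refl = cong (l′ ,_) (updateAt≡≔ ps (label-head l))

    blocked : ∀ {l ps p c} → lookup ps (label-head l) ≡ p → classify (readIn x p) ≡ c → label-moves l c ≡ [] → Stuck _⟶_ (l , ps)
    blocked {l} {ps} at-p is-c eq (_ , o∈ , _) with () ← subst (_ ∈_) (trans (move-options {l} {ps} at-p is-c) eq) o∈

    Dead : Position prover → Set
    Dead s = ∃ λ u → s ⇒ u × Stuck _⟶_ u × NotFinal u

    dead-after : ∀ {s u} → s ⇒ u → Dead u → Dead s
    dead-after p (v , q , st , nf) = v , p ++ᶠ q , st , nf

    dead-here : ∀ {s} → Stuck _⟶_ s → NotFinal s → Dead s
    dead-here st nf = _ , [] , st , nf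

    dead-loses : ∀ {s k ps} → Dead s → ¬ Run _⟶_ k s (accept , ps)
    dead-loses (u , p , st , nf) r with run-along p r
    ... | inj₁ ≢acc = ≢acc refl
    ... | inj₂ (_ , _ , q) with run-from-stuck st q
    ...   | _ , refl = nf refl

    continue : ∀ {s u k ps} → s ⇒ u → Run _⟶_ k s (accept , ps) → ∃ λ m → m ≤ k × Run _⟶_ m u (accept , ps)
    continue p r with run-along p r
    ... | inj₁ ≢acc             = contradiction refl ≢acc
    ... | inj₂ (m , refl , q) = m , ℕ.m≤n+m m ∣ p ∣ᶠ , q

    wins-after : ∀ {s u} → s ⇒ u → Wins u → Wins s
    wins-after p (_ , ps , q) = _ , ps , forced⇒run p ++ʳ q

    wins-step : ∀ {s u} → s ⟶ u → Wins u → Wins s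
    wins-step r (_ , ps , q) = _ , ps , r ∷ q

    -- `p` is the cell to the right of the head: the first move to the left has been made before the
    -- walk begins, so that the head starts on the last letter of the literal.
    walk-left : ∀ l l′ → (∀ d → label-moves l (digit d) ≡ (l , left) ∷ []) → (∀ d → label-moves l (sign d) ≡ (l′ , stay) ∷ []) →
                l ≢ accept → ∀ r {p u s y ps} → At p (digits r ++ sign-char s ∷ u) y → lookup ps (label-head l) ≡ moved left p →
                (l , ps) ⇒ (l′ , ps Vec.[ label-head l ]≔ suc (length u))
    walk-left l l′ on-digit on-sign ≢acc [] {u = u} {s} a at-p = must at-p (trans (cong classify (at-read a′)) (classify-sign s)) ≢acc (on-sign s)
        (trans (at-stay a′) (At.pos a′))
      where
      a′ : At _ u (sign-char s ∷ _)
      a′ = at-left a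
    walk-left l l′ on-digit on-sign ≢acc (d ∷ r) {u = u} {ps = ps} a at-p =
      must at-p (trans (cong classify (at-read a′)) (classify-digit d)) ≢acc (on-digit d) refl ++ᶠ
      subst (λ qs → (l , ps Vec.[ label-head l ]≔ _) ⇒ (l′ , qs)) (Vec.[]≔-idempotent ps (label-head l))
        (walk-left l l′ on-digit on-sign ≢acc r a′ (Vec.lookup∘updateAt (label-head l) ps))
      where
      a′ : At _ (digits r ++ sign-char _ ∷ u) (digit-char d ∷ _)
      a′ = at-left a

    walk-right : ∀ l → (∀ d → label-moves l (digit d) ≡ (l , right) ∷ []) → l ≢ accept →
                 ∀ ds {p u y ps} → At p u (digits ds ++ y) → lookup ps (label-head l) ≡ p →
                 ∃ λ q → (l , ps) ⇒ (l , ps Vec.[ label-head l ]≔ q) × At q (digits ds ʳ++ u) y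
    walk-right l on-digit ≢acc [] {ps = ps} a at-p = _ , subst (λ qs → (l , ps) ⇒ (l , qs)) (≡.sym unchanged-ps) [] , a
      where
      unchanged-ps : ps Vec.[ label-head l ]≔ _ ≡ ps
      unchanged-ps = trans (cong (ps Vec.[ label-head l ]≔_) (≡.sym at-p)) (Vec.[]≔-lookup ps (label-head l))
    walk-right l on-digit ≢acc (d ∷ ds) {ps = ps} a at-p
      with walk-right l on-digit ≢acc ds {ps = ps Vec.[ label-head l ]≔ _} (at-right a) (Vec.lookup∘updateAt (label-head l) ps)
    ... | q , r , a′ = q , must at-p (trans (cong classify (at-read a)) (classify-digit d)) ≢acc (on-digit d) refl ++ᶠ
      subst (λ qs → (l , ps Vec.[ label-head l ]≔ _) ⇒ (l , qs)) (Vec.[]≔-idempotent ps (label-head l)) r , a′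

    must-compared : ∀ t s {h b o p c l′ m} → stage-head t s ≡ compared t → classify (readIn x h) ≡ c →
                    compare-moves t s c ≡ (l′ , m) ∷ [] → moved m h ≡ p →
                    (compare t s , arrange t h b o) ⇒ (l′ , arrange t p b o)
    must-compared t s {h} {b} {o} {p} {l′ = l′} eq is-c opt pos =
      subst (λ qs → (compare t s , arrange t h b o) ⇒ (l′ , qs))
        (trans (cong (λ i → arrange t h b o Vec.[ i ]≔ p) eq) (arrange-≔-compared t))
        (must (trans (cong (lookup (arrange t h b o)) eq) (arrange-compared t)) is-c (λ ()) opt pos)

    must-current : ∀ t s {h b o p c l′ m} → stage-head t s ≡ current → classify (readIn x b) ≡ c →
                   compare-moves t s c ≡ (l′ , m) ∷ [] → moved m b ≡ p →
                   (compare t s , arrange t h b o) ⇒ (l′ , arrange t h p o)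
    must-current t s {h} {b} {o} {p} {l′ = l′} eq is-c opt pos =
      subst (λ qs → (compare t s , arrange t h b o) ⇒ (l′ , qs))
        (trans (cong (λ i → arrange t h b o Vec.[ i ]≔ p) eq) (arrange-≔-current t))
        (must (trans (cong (lookup (arrange t h b o)) eq) (arrange-current t)) is-c (λ ()) opt pos)

    blocked-compared : ∀ t s {h b o c} → stage-head t s ≡ compared t → classify (readIn x h) ≡ c →
                       compare-moves t s c ≡ [] → Dead (compare t s , arrange t h b o)
    blocked-compared t s {h} {b} {o} eq is-c opt = dead-here
      (blocked {compare t s} (trans (cong (lookup (arrange t h b o)) eq) (arrange-compared t)) is-c opt) (λ ())

    blocked-current : ∀ t s {h b o c} → stage-head t s ≡ current → classify (readIn x b) ≡ c →
                      compare-moves t s c ≡ [] → Dead (compare t s , arrange t h b o)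
    blocked-current t s {h} {b} {o} eq is-c opt = dead-here
      (blocked {compare t s} (trans (cong (lookup (arrange t h b o)) eq) (arrange-current t)) is-c opt) (λ ())

    at-digit : ∀ {p u d y} → At p u (digit-char d ∷ y) → classify (readIn x p) ≡ digit d
    at-digit {d = d} a = trans (cong classify (at-read a)) (classify-digit d)

    at-terminator : ∀ {p u y} → At p u y → NonDigit y → ∃ λ c → classify (readIn x p) ≡ c × Terminator c
    at-terminator a (c , _ , refl , ¬digit) = _ , cong classify (at-read a) , terminator ¬digit

    digit₁-terminator : ∀ t {c} → Terminator c → compare-moves t digit₁ c ≡ (compare t (digit₂ nothing) , stay) ∷ []
    digit₁-terminator t (sign _) = refl
    digit₁-terminator t end      = refl

    digit₂-terminator : ∀ t {c} → Terminator c → compare-moves t (digit₂ nothing) c ≡ (compare t back₂ , left) ∷ []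
    digit₂-terminator t (sign _) = refl
    digit₂-terminator t end      = refl

    digit₂-mismatch : ∀ t {c} d → Terminator c → compare-moves t (digit₂ (just d)) c ≡ []
    digit₂-mismatch t d (sign _) = refl
    digit₂-mismatch t d end      = refl

    go-back : ∀ t {h b o u u′ r r′ s s′ y y′} → At h (digits r ++ sign-char s ∷ u) y → At b (digits r′ ++ sign-char s′ ∷ u′) y′ →
              (compare t back₂ , arrange t h (moved left b) o) ⇒ (exit t , arrange t (suc (length u)) (suc (length u′)) o)
    go-back t {h} {b} {o} {u} {u′} {r} {r′} a a′ =
      subst (λ qs → (compare t back₂ , arrange t h (moved left b) o) ⇒ (compare t back₁′ , qs)) (arrange-≔-current t)
        (walk-left (compare t back₂) (compare t back₁′) (λ _ → refl) (λ _ → refl) (λ ()) r′ a′ (arrange-current t)) ++ᶠ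
      must-compared t back₁′ refl refl refl refl ++ᶠ
      subst (λ qs → (compare t back₁ , arrange t (moved left h) _ o) ⇒ (exit t , qs)) (arrange-≔-compared t)
        (walk-left (compare t back₁) (exit t) (λ _ → refl) (λ _ → refl) (λ ()) r a (arrange-compared t))

    -- `r` and `r′` are the digits already compared, over which the heads must return in case of
    -- success. The `NonDigit` hypotheses make a name that is a proper prefix of the other one
    -- detectable.
    compare-digits : ∀ t ds es {h b o u u′ r r′ s s′ y y′} →
      At h (digits r ++ sign-char s ∷ u) (digits ds ++ y) → At b (digits r′ ++ sign-char s′ ∷ u′) (digits es ++ y′) →
      NonDigit y → NonDigit y′ →
      (ds ≡ es × (compare t digit₁ , arrange t h b o) ⇒ (exit t , arrange t (suc (length u)) (suc (length u′)) o))
      ⊎ (ds ≢ es × Dead (compare t digit₁ , arrange t h b o))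
    compare-digits t [] [] {r = r} {r′} a a′ nd nd′ with at-terminator a nd | at-terminator a′ nd′
    ... | c , is-c , term | c′ , is-c′ , term′ = inj₁ (refl ,
      (must-compared t digit₁ refl is-c (digit₁-terminator t term) (at-stay a) ++ᶠ
       must-current t (digit₂ nothing) refl is-c′ (digit₂-terminator t term′) refl ++ᶠ
       go-back t {r = r} {r′} a a′))
    compare-digits t [] (e ∷ es) a a′ nd nd′ with at-terminator a nd
    ... | c , is-c , term = inj₂ ((λ ()) ,
      dead-after (must-compared t digit₁ refl is-c (digit₁-terminator t term) refl)
                 (blocked-current t (digit₂ nothing) refl (at-digit a′) refl))
    compare-digits t (d ∷ ds) [] a a′ nd nd′ with at-terminator a′ nd′
    ... | c′ , is-c′ , term′ = inj₂ ((λ ()) ,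
      dead-after (must-compared t digit₁ refl (at-digit a) refl refl)
                 (blocked-current t (digit₂ (just d)) refl is-c′ (digit₂-mismatch t d term′)))
    compare-digits t (d ∷ ds) (e ∷ es) {r = r} {r′} a a′ nd nd′ with d Bool.≟ e
    ... | no d≢e = inj₂ ((λ eq → d≢e (List.∷-injectiveˡ eq)) ,
      dead-after (must-compared t digit₁ refl (at-digit a) refl refl)
                 (blocked-current t (digit₂ (just d)) refl (at-digit a′) (if-equal-≢ _ d≢e)))
    ... | yes refl with compare-digits t ds es {r = d ∷ r} {d ∷ r′} (at-right a) (at-right a′) nd nd′
    ...   | inj₁ (refl , p) = inj₁ (refl ,
            (must-compared t digit₁ refl (at-digit a) refl refl ++ᶠ
             must-current t (digit₂ (just d)) refl (at-digit a′) (if-equal-≡ {d} _ refl) refl ++ᶠ p))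
    ...   | inj₂ (ds≢es , dead) = inj₂ ((λ eq → ds≢es (List.∷-injectiveʳ eq)) ,
            dead-after (must-compared t digit₁ refl (at-digit a) refl refl ++ᶠ
                        must-current t (digit₂ (just d)) refl (at-digit a′) (if-equal-≡ {d} _ refl) refl) dead)

    -- The token after the literal is part of the data because comparisons rely on its first letter
    -- to end the name.
    record Occurs (p : ℕ) (l : Literal) : Set where
      constructor occurs
      field
        {before after} : List Token
        {next}         : Token
        split          : tokens φ ≡ before ʳ++ (literal l ∷ next ∷ after)
        pos            : p ≡ suc (length (spell-reversed before))

    token-at : ∀ {us ts} → tokens φ ≡ us ʳ++ ts → At (suc (length (spell-reversed us))) (spell-reversed us) (spell-all ts)
    token-at {us} {ts} split = at (trans (≡.sym (spell-ʳ++ us ts)) (trans (cong spell-all (≡.sym split)) (≡.sym (encode≡spell φ)))) refl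

    occurs-at : ∀ {p l} (o : Occurs p l) → At p (spell-reversed (Occurs.before o))
                  (sign-char (positive l) ∷ digits (name l) ++ spell-all (Occurs.next o ∷ Occurs.after o))
    occurs-at {l = l} (occurs {us} {ts} {t} split refl) = token-at {us} {literal l ∷ t ∷ ts} split

    occurs-sign : ∀ {p l} → Occurs p l → classify (readIn x p) ≡ sign (positive l)
    occurs-sign {l = l} o = trans (cong classify (at-read (occurs-at o))) (classify-sign (positive l))

    occurs-bounded : ∀ {p l} → Occurs p l → p ≤ suc n
    occurs-bounded o = at-bounded (occurs-at o)

    Matches : Task → Literal → Literal → Set
    Matches t l m = positive l ≡ expected t (positive m) × name l ≡ name m

    compare-literals : ∀ t {h b o l m} → Occurs h l → Occurs b m →
      (Matches t l m × (compare t sign₁ , arrange t h b o) ⇒ (exit t , arrange t h b o))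
      ⊎ (¬ Matches t l m × Dead (compare t sign₁ , arrange t h b o))
    compare-literals t {h} {b} {o} {l} {m} occ@(occurs _ refl) occ′@(occurs _ refl)
      with must-compared t sign₁ {b = b} {o} refl (occurs-sign occ) refl refl | positive l Bool.≟ expected t (positive m)
    ... | start-up | no differ = inj₂ ((λ (eq , _) → differ eq) ,
      dead-after start-up (blocked-current t (sign₂ (positive l)) refl (occurs-sign occ′) (if-equal-≢ _ differ)))
    ... | start-up | yes same
      with compare-digits t (name l) (name m) {o = o} {r = []} {[]} (at-right (occurs-at occ)) (at-right (occurs-at occ′))
             (spell-nonDigit (Occurs.next occ) (Occurs.after occ)) (spell-nonDigit (Occurs.next occ′) (Occurs.after occ′))
    ...   | inj₁ (same-name , p) = inj₁ ((same , same-name) ,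
            (start-up ++ᶠ must-current t (sign₂ (positive l)) refl (occurs-sign occ′) (if-equal-≡ _ same) refl ++ᶠ p))
    ...   | inj₂ (differ , dead) = inj₂ ((λ (_ , eq) → differ eq) ,
            dead-after (start-up ++ᶠ must-current t (sign₂ (positive l)) refl (occurs-sign occ′) (if-equal-≡ _ same) refl) dead)

    after-literal : ∀ {us l ts} → tokens φ ≡ us ʳ++ (literal l ∷ ts) → ∃₂ λ t ts′ → ts ≡ t ∷ ts′
    after-literal {us} {ts = []}     split = contradiction (trans split (List.ʳ++-defn us)) (tokens-end φ)
    after-literal {us} {ts = t ∷ ts} split = t , ts , refl

    literal-occurs : ∀ {us l ts} → tokens φ ≡ us ʳ++ (literal l ∷ ts) → Occurs (suc (length (spell-reversed us))) l
    literal-occurs {us} {l} split with after-literal {us} {l} split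
    ... | t , ts′ , refl = occurs {before = us} {ts′} {t} split refl

    sign-occurs : ∀ {p b} → classify (readIn x p) ≡ sign b → ∃ λ l → Occurs p l
    sign-occurs {zero} ()
    sign-occurs {suc i} {b} is-sign with lookupMaybe x i in eq
    ... | just c with sign-starts-literal [] (tokens φ) i b
                       (trans (cong (λ y → lookupMaybe y i) (≡.sym (encode≡spell φ))) (trans eq (cong just (classified-sign is-sign))))
    ...   | us , l , ts , split , refl = l , literal-occurs {us} {l} {ts} split

    scout-must : ∀ w b {a c g p k l′ m} → walk-head w ≡ scout → classify (readIn x a) ≡ k → walk-moves b w k ≡ (l′ , m) ∷ [] →
                 moved m a ≡ p → (walk w b , a ∷ c ∷ g ∷ []) ⇒ (l′ , p ∷ c ∷ g ∷ [])
    scout-must w b {a} {c} {g} {p} {l′ = l′} eq is-k opt pos =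
      subst (λ i → (walk w b , a ∷ c ∷ g ∷ []) ⇒ (l′ , (a ∷ c ∷ g ∷ []) Vec.[ i ]≔ p)) eq
        (must (cong (lookup (a ∷ c ∷ g ∷ [])) eq) is-k (λ ()) opt pos)

    scout-dead : ∀ w b {a c g k} → walk-head w ≡ scout → classify (readIn x a) ≡ k → walk-moves b w k ≡ [] →
                 Dead (walk w b , a ∷ c ∷ g ∷ [])
    scout-dead w b {a} {c} {g} eq is-k opt = dead-here (blocked {walk w b} (cong (lookup (a ∷ c ∷ g ∷ [])) eq) is-k opt) (λ ())

    left-of-literal : ∀ {us l y p} → At p (spell-reversed (literal l ∷ us)) y →
                      At p (digits (List.reverse (name l)) ++ sign-char (positive l) ∷ spell-reversed us) y
    left-of-literal {us} {l} = subst (λ u → At _ u _) (spell-literal-reversed l us)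

    return-left : ∀ b {us l y p c g} → At p (spell-reversed (literal l ∷ us)) y →
                  (walk to-left b , moved left p ∷ c ∷ g ∷ []) ⇒ (walk wander-current b , suc (length (spell-reversed us)) ∷ c ∷ g ∷ [])
    return-left b {us} {l} a = walk-left (walk to-left b) (walk wander-current b) (λ _ → refl) (λ _ → refl) (λ ())
                                 (List.reverse (name l)) (left-of-literal {us} {l} a) refl

    module _ (b : Bool) {us : List Token} {l : Literal} {t : Token} {ts : List Token} {c g : ℕ}
             (split : tokens φ ≡ us ʳ++ (literal l ∷ t ∷ ts)) where

      private
        a : ℕ
        a = suc (length (spell-reversed us))

        at-a : At a (spell-reversed us) (spell-all (literal l ∷ t ∷ ts))
        at-a = token-at {us} {literal l ∷ t ∷ ts} split

        a⁺ : ℕ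
        a⁺ = suc (length (spell-reversed (literal l ∷ us)))

        at-a⁺ : At a⁺ (spell-reversed (literal l ∷ us)) (spell-all (t ∷ ts))
        at-a⁺ = token-at {literal l ∷ us} {t ∷ ts} split

        is-sign : classify (readIn x a) ≡ sign (positive l)
        is-sign = trans (cong classify (at-read at-a)) (classify-sign (positive l))

        cross : ∀ w → walk-head w ≡ scout → (∀ d → walk-moves b w (digit d) ≡ (walk w b , right) ∷ []) →
                (walk w b , moved right a ∷ c ∷ g ∷ []) ⇒ (walk w b , a⁺ ∷ c ∷ g ∷ [])
        cross w eq on-digit with walk-right (walk w b) on-digit (λ ()) (name l) {ps = moved right a ∷ c ∷ g ∷ []} (at-right at-a)
                                   (cong (lookup (moved right a ∷ c ∷ g ∷ [])) eq)
        ... | q , r , at _ refl = subst (λ i → (walk w b , moved right a ∷ c ∷ g ∷ []) ⇒ (walk w b , (moved right a ∷ c ∷ g ∷ []) Vec.[ i ]≔ q)) eq r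

      right-sibling : ∀ {m} → t ≡ literal m → (walk to-right b , moved right a ∷ c ∷ g ∷ []) ⇒ (walk wander-current b , a⁺ ∷ c ∷ g ∷ [])
      right-sibling {m} refl = cross to-right refl (λ _ → refl) ++ᶠ
        scout-must to-right b refl (trans (cong classify (at-read at-a⁺)) (classify-sign (positive m))) refl (at-stay at-a⁺)

      right-dead : t ≡ close-clause → Dead (walk to-right b , moved right a ∷ c ∷ g ∷ [])
      right-dead refl = dead-after (cross to-right refl (λ _ → refl)) (scout-dead to-right b refl (cong classify (at-read at-a⁺)) refl)

      left-sibling : ∀ {m us′} → us ≡ literal m ∷ us′ →
                     (walk to-left b , moved left a ∷ c ∷ g ∷ []) ⇒ (walk wander-current b , suc (length (spell-reversed us′)) ∷ c ∷ g ∷ [])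
      left-sibling {m} {us′} refl = return-left b {us′} {m} at-a

      boundary-class : Boundary us → classify (readIn x (moved left a)) ≡ edge ⊎ classify (readIn x (moved left a)) ≡ end
      boundary-class first-token  = inj₁ refl
      boundary-class after-clause = inj₂ (cong classify (at-read (at-left at-a)))

      left-dead : Boundary us → Dead (walk to-left b , moved left a ∷ c ∷ g ∷ [])
      left-dead bd with boundary-class bd
      ... | inj₁ is-edge = scout-dead to-left b refl is-edge refl
      ... | inj₂ is-end  = scout-dead to-left b refl is-end refl

      bounce : Boundary us → moved right (moved left a) ≡ a
      bounce first-token  = refl
      bounce after-clause = At.pos (at-right (at-left at-a))

      alone-starts : Boundary us → (walk alone b , moved left a ∷ c ∷ g ∷ []) ⇒ (walk alone-end b , a⁺ ∷ c ∷ g ∷ [])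
      alone-starts bd = check (boundary-class bd) ++ᶠ scout-must alone-right b refl is-sign refl refl ++ᶠ cross alone-end refl (λ _ → refl)
        where
        check : classify (readIn x (moved left a)) ≡ edge ⊎ classify (readIn x (moved left a)) ≡ end →
                (walk alone b , moved left a ∷ c ∷ g ∷ []) ⇒ (walk alone-right b , a ∷ c ∷ g ∷ [])
        check (inj₁ is-edge) = scout-must alone b refl is-edge refl (bounce bd)
        check (inj₂ is-end)  = scout-must alone b refl is-end refl (bounce bd)

      unit-sibling : Boundary us → t ≡ close-clause → (walk alone b , moved left a ∷ c ∷ g ∷ []) ⇒ (walk wander-current b , a ∷ c ∷ g ∷ [])
      unit-sibling bd refl = alone-starts bd ++ᶠ
        scout-must alone-end b refl (cong classify (at-read at-a⁺)) refl refl ++ᶠ return-left b {us} {l} at-a⁺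

      alone-dead-right : ∀ {m} → Boundary us → t ≡ literal m → Dead (walk alone b , moved left a ∷ c ∷ g ∷ [])
      alone-dead-right {m} bd refl = dead-after (alone-starts bd)
        (scout-dead alone-end b refl (trans (cong classify (at-read at-a⁺)) (classify-sign (positive m))) refl)

      alone-dead-left : ∀ {m us′} → us ≡ literal m ∷ us′ → Dead (walk alone b , moved left a ∷ c ∷ g ∷ [])
      alone-dead-left {m} {us′} refl = inside (List.reverse (name m)) (left-of-literal {us′} {m} at-a)
        where
        inside : ∀ r {s u y} → At a (digits r ++ sign-char s ∷ u) y → Dead (walk alone b , moved left a ∷ c ∷ g ∷ [])
        inside []      {s} at-l = scout-dead alone b refl (trans (cong classify (at-read (at-left at-l))) (classify-sign s)) refl
        inside (d ∷ r)     at-l = scout-dead alone b refl (at-digit (at-left at-l)) refl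

    boundary? : ∀ us → Boundary us ⊎ (∃₂ λ m us′ → us ≡ literal m ∷ us′)
    boundary? []                  = inj₁ first-token
    boundary? (literal m ∷ us)    = inj₂ (m , us , refl)
    boundary? (close-clause ∷ us) = inj₁ after-clause

    adjacent : ∀ us {l m ts} → tokens φ ≡ us ʳ++ (literal l ∷ literal m ∷ ts) → (l ∷ m ∷ []) ∈ φ
    adjacent us split = adjacent⇒clause clauses (List.reverse us) (trans split (List.ʳ++-defn us))

    isolated : ∀ {us l ts} → Boundary us → tokens φ ≡ us ʳ++ (literal l ∷ close-clause ∷ ts) → (l ∷ []) ∈ φ
    isolated first-token split = alone⇒clause clauses [] (cong (close-clause ∷_) split)
    isolated {_ ∷ us} after-clause split =
      alone⇒clause clauses (close-clause ∷ List.reverse us) (cong (close-clause ∷_) (trans split (List.ʳ++-defn us)))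

    sibling-sound : ∀ {b a c g l k ps} → Occurs a l → Run _⟶_ k (walk sibling b , a ∷ c ∷ g ∷ []) (accept , ps) →
                    ∃₂ λ m a′ → ∃ λ k′ → Sibling φ l m × Occurs a′ m × k′ ≤ k
                                       × Run _⟶_ k′ (walk wander-current b , a′ ∷ c ∷ g ∷ []) (accept , ps)
    sibling-sound {b} {l = l} (occurs {us} {ts} {literal m} split refl) ((_ , here refl , refl) ∷ r) with continue (right-sibling b {us} split refl) r
    ... | k′ , k′≤ , r′ = m , _ , k′ , first (adjacent us split) , literal-occurs {literal l ∷ us} split , ℕ.m≤n⇒m≤1+n k′≤ , r′
    sibling-sound {b} (occurs {us} {ts} {close-clause} split refl) ((_ , here refl , refl) ∷ r) =
      contradiction r (dead-loses (right-dead b {us} split refl))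
    sibling-sound {b} {l = l} (occurs {us} {ts} {t} split refl) ((_ , there (here refl) , refl) ∷ r) with boundary? us
    ... | inj₁ bd = contradiction r (dead-loses (left-dead b {us} split bd))
    ... | inj₂ (m , us′ , refl) with continue (left-sibling b {us} split refl) r
    ...   | k′ , k′≤ , r′ = m , _ , k′ , second (adjacent us′ split) , literal-occurs {us′} split , ℕ.m≤n⇒m≤1+n k′≤ , r′
    sibling-sound {b} {l = l} o@(occurs {us} split refl) ((_ , there (there (here refl)) , refl) ∷ r) with boundary? us
    ... | inj₂ (m , us′ , us≡) = contradiction r (dead-loses (alone-dead-left b {us} split us≡))
    sibling-sound {b} {l = l} o@(occurs {us} {next = literal m} split refl) ((_ , there (there (here refl)) , refl) ∷ r) | inj₁ bd =
      contradiction r (dead-loses (alone-dead-right b {us} split bd refl))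
    sibling-sound {b} {l = l} o@(occurs {us} {next = close-clause} split refl) ((_ , there (there (here refl)) , refl) ∷ r) | inj₁ bd
      with continue (unit-sibling b {us} split bd refl) r
    ... | k′ , k′≤ , r′ = l , _ , k′ , unit (isolated bd split) , o , ℕ.m≤n⇒m≤1+n k′≤ , r′

    clause-at : ∀ {c} → c ∈ φ → ∃₂ λ us ts → tokens φ ≡ us ʳ++ (clause-tokens c ++ ts) × Boundary us
    clause-at c∈ with ∈⇒tokens c∈
    ... | []     , ts , eq = [] , ts , List.∷-injectiveʳ eq , first-token
    ... | _ ∷ us , ts , eq = close-clause ∷ List.reverse us , ts ,
            trans (List.∷-injectiveʳ eq) (trans (cong (_++ _) (≡.sym (List.reverse-involutive us))) (≡.sym (List.ʳ++-defn (List.reverse us)))) ,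
            after-clause

    -- The edge fixes a clause, and the clause fixes the occurrence that the scout has to guess and
    -- the one that it reaches. What follows the walk is left open as an implication between `Wins`.
    sibling-complete : ∀ {l m} → Sibling φ l m →
                       ∃₂ λ a a′ → Occurs a l × Occurs a′ m ×
                         (∀ {b c g} → Wins (walk wander-current b , a′ ∷ c ∷ g ∷ []) → Wins (walk sibling b , a ∷ c ∷ g ∷ []))
    sibling-complete {l} {m} (first c∈) with clause-at c∈
    ... | us , ts , split , _ = _ , _ , literal-occurs {us} split , literal-occurs {literal l ∷ us} split ,
          λ {b} win → wins-step (_ , here refl , refl) (wins-after (right-sibling b {us} split refl) win)
    sibling-complete {l} {m} (second c∈) with clause-at c∈
    ... | us , ts , split , _ = _ , _ , literal-occurs {literal m ∷ us} split , literal-occurs {us} split ,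
          λ {b} win → wins-step (_ , there (here refl) , refl) (wins-after (left-sibling b {literal m ∷ us} {l} split refl) win)
    sibling-complete {l} (unit c∈) with clause-at c∈
    ... | us , ts , split , bd = _ , _ , literal-occurs {us} split , literal-occurs {us} split ,
          λ {b} win → wins-step (_ , there (there (here refl)) , refl) (wins-after (unit-sibling b {us} {l} split bd refl) win)

    module _ (l l′ : Label₃) (wanders : ∀ c → label-moves l c ≡ wander l l′) where

      Settled : ℕ → Vec ℕ 3 → Vec ℕ 3 → Set
      Settled k ps qs = ∃₂ λ p m → m ≤ k × Run _⟶_ m (l′ , ps Vec.[ label-head l ]≔ p) (accept , qs)

      later : ∀ {k f qs} ps → Settled k (Vec.updateAt ps (label-head l) f) qs → Settled (suc k) ps qs
      later {qs = qs} ps (p , m , m≤ , r) = p , m , ℕ.m≤n⇒m≤1+n m≤ ,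
        subst (λ xs → Run _⟶_ m (l′ , xs) (accept , qs)) (Vec.updateAt-updateAt (label-head l) ps) r

      wander-sound : l ≢ accept → ∀ {k ps qs} → Run _⟶_ k (l , ps) (accept , qs) → Settled k ps qs
      wander-sound ≢acc [] = contradiction refl ≢acc
      wander-sound ≢acc {suc k} {ps} {qs} ((o , o∈ , refl) ∷ r) with subst (o ∈_) (wanders _) o∈
      ... | there (there (here refl)) = _ , k , ℕ.n≤1+n k , subst (λ xs → Run _⟶_ k (l′ , xs) (accept , qs)) (updateAt≡≔ ps (label-head l)) r
      ... | here refl         = later ps (wander-sound ≢acc r)
      ... | there (here refl) = later ps (wander-sound ≢acc r)

      -- The head goes to the left end first and then right to `q`, which avoids a distinction by
      -- the order of the two positions.
      wander-complete : ∀ {p q ps} → lookup ps (label-head l) ≡ p → p ≤ suc n → q ≤ suc n →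
                        Wins (l′ , ps Vec.[ label-head l ]≔ q) → Wins (l , ps)
      wander-complete {q = q} at-p p≤ q≤ win = down _ at-p p≤ win
        where
        option : ∀ {c o} → o ∈ wander l l′ → o ∈ label-moves l c
        option {o = o} = subst (o ∈_) (≡.sym (wanders _))
        up : ∀ d {p ps} → lookup ps (label-head l) ≡ p → d + p ≡ q → Wins (l′ , ps Vec.[ label-head l ]≔ q) → Wins (l , ps)
        up zero {ps = ps} at-p refl win = wins-step (may {l} at-p refl (option (there (there (here refl)))))
          (subst (λ p → Wins (l′ , ps Vec.[ label-head l ]≔ p)) (≡.sym (ℕ.m≤n⇒m⊓n≡m q≤)) win)
        up (suc d) {p} {ps} at-p eq win = wins-step (may {l} at-p refl (option (there (here refl))))
          (up d (trans (Vec.lookup∘updateAt (label-head l) ps) (ℕ.m≤n⇒m⊓n≡m (ℕ.≤-trans (subst (suc p ≤_) eq (s≤s (ℕ.m≤n+m p d))) q≤)))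
             (trans (ℕ.+-suc d p) eq) (subst (λ xs → Wins (l′ , xs)) (≡.sym (Vec.[]≔-idempotent ps (label-head l))) win))
        down : ∀ p {ps} → lookup ps (label-head l) ≡ p → p ≤ suc n → Wins (l′ , ps Vec.[ label-head l ]≔ q) → Wins (l , ps)
        down zero    at-p _  win = up q at-p (ℕ.+-identityʳ q) win
        down (suc p) {ps} at-p p≤ win = wins-step (may {l} at-p refl (option (here refl)))
          (down p (trans (Vec.lookup∘updateAt (label-head l) ps) (ℕ.m≤n⇒m⊓n≡m (ℕ.≤-trans (ℕ.n≤1+n p) p≤))) (ℕ.≤-trans (ℕ.n≤1+n p) p≤)
             (subst (λ xs → Wins (l′ , xs)) (≡.sym (Vec.[]≔-idempotent ps (label-head l))) win))

    -- A head may have wandered into the middle of a name or onto an endmarker. There the comparison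
    -- is stuck at once, so an accepting run must have begun it on a sign.
    first-literal : ∀ t {h b o k ps} → Run _⟶_ k (compare t sign₁ , arrange t h b o) (accept , ps) → ∃ λ l → Occurs h l
    first-literal t {h} {b} {o} r with classify (readIn x h) in eq
    ... | digit _ = contradiction r (dead-loses (blocked-compared t sign₁ refl eq refl))
    ... | end     = contradiction r (dead-loses (blocked-compared t sign₁ refl eq refl))
    ... | edge    = contradiction r (dead-loses (blocked-compared t sign₁ refl eq refl))
    ... | sign _  = sign-occurs eq

    second-literal : ∀ t {h b o k ps l} → Occurs h l → Run _⟶_ k (compare t sign₁ , arrange t h b o) (accept , ps) → ∃ λ m → Occurs b m
    second-literal t {h} {b} {o} {l = l} occ r with continue (must-compared t sign₁ {b = b} {o} refl (occurs-sign occ) refl refl) r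
    ... | _ , _ , r′ with classify (readIn x b) in eq
    ...   | digit _ = contradiction r′ (dead-loses (blocked-current t (sign₂ (positive l)) refl eq refl))
    ...   | end     = contradiction r′ (dead-loses (blocked-current t (sign₂ (positive l)) refl eq refl))
    ...   | edge    = contradiction r′ (dead-loses (blocked-current t (sign₂ (positive l)) refl eq refl))
    ...   | sign _  = sign-occurs eq

    comparison-sound : ∀ t {h b o k ps l m} → Occurs h l → Occurs b m → Run _⟶_ k (compare t sign₁ , arrange t h b o) (accept , ps) →
                       Matches t l m × (∃ λ k′ → k′ ≤ k × Run _⟶_ k′ (exit t , arrange t h b o) (accept , ps))
    comparison-sound t occ occ′ r with compare-literals t occ occ′
    ... | inj₁ (matches , p) = matches , continue p r
    ... | inj₂ (_ , dead)    = contradiction r (dead-loses dead)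

    comparison-complete : ∀ t {h b o l m} → Occurs h l → Occurs b m → Matches t l m →
                          Wins (exit t , arrange t h b o) → Wins (compare t sign₁ , arrange t h b o)
    comparison-complete t occ occ′ matches win with compare-literals t occ occ′
    ... | inj₁ (_ , p)         = wins-after p win
    ... | inj₂ (¬matches , _) = contradiction matches ¬matches

    equal : ∀ {l m} → positive l ≡ positive m × name l ≡ name m → l ≡ m
    equal (s , e) = literal-≡ s e

    opposite : ∀ {l m} → positive l ≡ not (positive m) × name l ≡ name m → l ≡ neg m
    opposite {m = lit _ _} (s , e) = literal-≡ s e

    opposite-neg : ∀ l → positive l ≡ not (positive (neg l)) × name l ≡ name (neg l)
    opposite-neg (lit b _) = ≡.sym (Bool.not-involutive b) , refl

    -- What remains to be shown when `current` is on `y` and `goal` on `z`: on the way out both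
    -- halves of the contradiction, on the way back only the rest of the second half.
    Target : Bool → Literal → Literal → Set
    Target false y z = Chain φ y (neg z) × Chain φ (neg z) z
    Target true  y z = Chain φ y z

    extend : ∀ b {y m z} → Implies φ y m → Target b m z → Target b y z
    extend false e (p , q) = e ◅ p , q
    extend true  e p       = e ◅ p

    -- One round of the loop is one edge: the scout finds `neg y`, moves to its sibling, and
    -- `current` moves to a literal equal to this sibling. The remaining accepting run is shorter,
    -- although it is not a subterm.
    loop-sound : ∀ {k} → Acc _<_ k → ∀ b {a c g y z ps} → Occurs c y → Occurs g z →
                 Run _⟶_ k (walk loop b , a ∷ c ∷ g ∷ []) (accept , ps) → Target b y z
    loop-sound (acc rec) b {y = y} {z} c-y g-z ((_ , here refl , refl) ∷ r₁)
      with wander-sound (walk wander-scout b) (compare (jump b) sign₁) (λ _ → refl) (λ ()) r₁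
    ... | _ , _ , k₂≤ , r₂ with first-literal (jump b) r₂
    ...   | l , a-l with comparison-sound (jump b) a-l c-y r₂
    ...     | l≡ , _ , k₃≤ , r₃ with sibling-sound a-l r₃
    ...       | m , _ , _ , sib , a-m , k₄≤ , r₄
                with wander-sound (walk wander-current b) (compare (land b) sign₁) (λ _ → refl) (λ ()) r₄
    ...         | _ , _ , k₅≤ , r₅ with second-literal (land b) a-m r₅
    ...           | m′ , c-m with comparison-sound (land b) a-m c-m r₅
    ...             | m≡ , _ , k₆≤ , r₆ =
      extend b (subst (λ y → Implies φ y m′) (trans (cong neg (opposite l≡)) (neg-involutive y))
                 (implies (subst (Sibling φ l) (equal m≡) sib)))
        (loop-sound (rec (s≤s (ℕ.≤-trans k₆≤ (ℕ.≤-trans k₅≤ (ℕ.≤-trans k₄≤ (ℕ.≤-trans k₃≤ k₂≤)))))) b c-m g-z r₆)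
    loop-sound (acc rec) false {y = y} {z} c-y g-z ((_ , there (here refl) , refl) ∷ r₁)
      with comparison-sound half g-z c-y r₁
    ... | z≡ , _ , k₂≤ , r₂ with loop-sound (rec (s≤s k₂≤)) true c-y g-z r₂
    ...   | p = subst (Chain φ y) (≡.sym z̄≡y) ε , subst (λ w → Chain φ w z) (≡.sym z̄≡y) p
      where
      z̄≡y : neg z ≡ y
      z̄≡y = trans (cong neg (opposite z≡)) (neg-involutive y)
    loop-sound (acc rec) true c-y g-z ((_ , there (here refl) , refl) ∷ r₁) with comparison-sound close g-z c-y r₁
    ... | z≡ , _ = subst (λ w → Chain φ w _) (equal z≡) ε

    -- `next` takes over at the end of the chain. For the first half it is the comparison `half`
    -- followed by the whole second half, for the second half it is the final comparison.
    loop-complete : ∀ b {y w g} → Chain φ y w →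
                    (∀ {a c} → a ≤ suc n → Occurs c w → Wins (walk loop b , a ∷ c ∷ g ∷ [])) →
                    ∀ {a c} → a ≤ suc n → Occurs c y → Wins (walk loop b , a ∷ c ∷ g ∷ [])
    loop-complete b ε next a≤ c-y = next a≤ c-y
    loop-complete b {g = g} (implies {l} {m} sib ◅ p) next {a} {c} a≤ c-y with sibling-complete sib
    ... | a′ , a″ , a-l , a-m , to-sibling =
      wins-step (_ , here refl , refl)
        (wander-complete (walk wander-scout b) (compare (jump b) sign₁) (λ _ → refl) refl (ℕ.m⊓n≤n a (suc n)) (occurs-bounded a-l)
          (comparison-complete (jump b) a-l c-y (opposite-neg l)
            (to-sibling
              (wander-complete (walk wander-current b) (compare (land b) sign₁) (λ _ → refl) refl (occurs-bounded c-y) (occurs-bounded a-m)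
                -- `current` is sent to the very occurrence under the scout, so the comparison
                -- succeeds trivially.
                (comparison-complete (land b) a-m a-m (refl , refl)
                  (loop-complete b p next (occurs-bounded a-m) a-m))))))

    -- The goal head needs an occurrence of the literal. The last edge of a nonempty chain supplies
    -- one, and the chain from `neg z` to `z` cannot be empty.
    chain-occurs : ∀ {y z} → Chain φ y z → y ≢ z → ∃ λ p → Occurs p z
    chain-occurs ε y≢z = contradiction refl y≢z
    chain-occurs (implies s ◅ p) _ = go s p
      where
      go : ∀ {l m z} → Sibling φ l m → Chain φ m z → ∃ λ p → Occurs p z
      go s ε               = let _ , a′ , _ , o , _ = sibling-complete s in a′ , o
      go s (implies s′ ◅ p) = go s′ p

    neg≢ : ∀ z → neg z ≢ z
    neg≢ (lit true  _) ()
    neg≢ (lit false _) ()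

  wins⇒contradictory : ∀ {k ps} → Run (AStep prover x) k (place-goal , Vec.replicate 3 0) (accept , ps) → Contradictory φ
  wins⇒contradictory r with wander-sound place-goal place-current (λ _ → refl) (λ ()) r
  ... | _ , _ , _ , r₁ with wander-sound place-current (compare origin sign₁) (λ _ → refl) (λ ()) r₁
  ...   | _ , _ , _ , r₂ with first-literal origin r₂
  ...     | z , g-z with second-literal origin g-z r₂
  ...       | y , c-y with comparison-sound origin g-z c-y r₂
  ...         | z≡y , k , _ , r₃ with loop-sound (<-wellFounded k) false c-y g-z r₃
  ...           | p , q = z , subst (λ w → Chain φ w (neg z)) (≡.sym (equal z≡y)) p , q

  contradictory⇒wins : Contradictory φ → Wins (place-goal , Vec.replicate 3 0)
  contradictory⇒wins (z , p , q) with chain-occurs q (neg≢ z)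
  ... | g , g-z =
    wander-complete place-goal place-current (λ _ → refl) refl z≤n (occurs-bounded g-z)
      (wander-complete place-current (compare origin sign₁) (λ _ → refl) refl z≤n (occurs-bounded g-z)
        (comparison-complete origin g-z g-z (refl , refl)
          (loop-complete false p
            (λ {a} a≤ c-z̄ → wins-step (_ , there (here refl) , refl)
              (comparison-complete half g-z c-z̄ (opposite-neg z)
                (loop-complete true q
                  (λ {a} a≤ c-z → wins-step (_ , there (here refl) , refl)
                    (comparison-complete close g-z c-z (refl , refl) (0 , _ , [])))
                  (ℕ.m⊓n≤n a (suc n)) c-z̄)))
            z≤n g-z)))

-- The clock: a counter that runs until it overflows

next : ∀ {n} → Fin (suc n) → Maybe (Fin (suc n))
next {zero}  zero    = nothing
next {suc n} zero    = just (suc zero)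
next {suc n} (suc i) = maybe′ (just ∘ suc) nothing (next i)

next-just : ∀ {n} (d : Fin (suc n)) {d′} → next d ≡ just d′ → toℕ d′ ≡ suc (toℕ d)
next-just {suc n} zero    refl = refl
next-just {suc n} (suc i) eq with next i in eq′
next-just {suc n} (suc i) refl | just i′ = cong suc (next-just i eq′)

next-nothing : ∀ {n} (d : Fin (suc n)) → next d ≡ nothing → toℕ d ≡ n
next-nothing {zero}  zero    refl = refl
next-nothing {suc n} (suc i) eq with next i in eq′
... | nothing = cong suc (next-nothing i eq′)

Digits : ℕ → Set
Digits b = List (Fin (suc (suc b)))

-- Ticks T up ls rs: a counter in base b + 2, whose head moves up (carrying) or down
-- (returning to the mark) between the digits ls, below the head and in reverse order, and
-- rs, makes T moves until it overflows.
data Ticks {b : ℕ} : ℕ → Bool → Digits b → Digits b → Set where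
  overflow : ∀ {ls} → Ticks 0 true ls []
  bump     : ∀ {T ls d d′ rs} → next d ≡ just d′ → Ticks T false ls (d′ ∷ rs) → Ticks (suc T) true ls (d ∷ rs)
  carry    : ∀ {T ls d rs} → next d ≡ nothing → Ticks T true (zero ∷ ls) rs → Ticks (suc T) true ls (d ∷ rs)
  descend  : ∀ {T d ls rs} → Ticks T false ls (d ∷ rs) → Ticks (suc T) false (d ∷ ls) rs
  turn-up  : ∀ {T rs} → Ticks T true [] rs → Ticks (suc T) false [] rs

successor : ∀ {b} → Digits b → Maybe (Digits b)
successor []       = nothing
successor (d ∷ ds) = maybe′ (λ d′ → just (d′ ∷ ds)) (maybe′ (λ ds′ → just (zero ∷ ds′)) nothing (successor ds)) (next d)

-- The number of increments, in base `b + 2`, until all digits are maximal.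
remaining : ∀ {b} → Digits b → ℕ
remaining         []       = 0
remaining {b = b} (d ∷ ds) = (suc b ∸ toℕ d) + suc (suc b) * remaining ds

remaining-successor : ∀ {b} (ds : Digits b) {ds′} → successor ds ≡ just ds′ → remaining ds ≡ suc (remaining ds′)
remaining-successor {b} (d ∷ ds) eq with next d in eq′
remaining-successor {b} (d ∷ ds) refl | just d′ rewrite next-just d eq′ =
  cong (_+ suc (suc b) * remaining ds) (ℕ.+-∸-assoc 1 (subst (_≤ suc b) (next-just d eq′) (ℕ.≤-pred (Fin.toℕ<n d′))))
remaining-successor {b} (d ∷ ds) eq | nothing with successor ds in eq″
remaining-successor {b} (d ∷ ds) refl | nothing | just ds′
  rewrite next-nothing d eq′ | ℕ.n∸n≡0 b | remaining-successor ds eq″ = ℕ.*-suc (suc (suc b)) (remaining ds′)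

remaining-last : ∀ {b} (ds : Digits b) → successor ds ≡ nothing → remaining ds ≡ 0
remaining-last []       _  = refl
remaining-last {b} (d ∷ ds) eq with next d in eq′
... | nothing with successor ds in eq″
...   | nothing rewrite next-nothing d eq′ | ℕ.n∸n≡0 b | remaining-last ds eq″ = ℕ.*-zeroʳ b

-- The moves of one increment are put in front of those that follow it: the carry climbs over
-- maximal digits, one of the later digits is raised, and the head descends over the zeros left
-- behind.
sweep : ∀ {b} (rs : Digits b) {rs′ ls T} → successor rs ≡ just rs′ → Ticks T false ls rs′ → ∃ λ T′ → T ≤ T′ × Ticks T′ true ls rs
sweep (d ∷ rs) eq ticks with next d in eq′
sweep (d ∷ rs) refl ticks | just d′ = _ , ℕ.n≤1+n _ , bump eq′ ticks
sweep (d ∷ rs) eq ticks | nothing with successor rs in eq″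
sweep (d ∷ rs) refl ticks | nothing | just rs′ with sweep rs eq″ (descend ticks)
... | T′ , T≤T′ , ticks′ = suc T′ , ℕ.≤-trans (ℕ.n≤1+n _) (ℕ.≤-trans T≤T′ (ℕ.n≤1+n T′)) , carry eq′ ticks′

last-sweep : ∀ {b} (rs : Digits b) {ls} → successor rs ≡ nothing → ∃ λ T → Ticks T true ls rs
last-sweep []       _  = 0 , overflow
last-sweep (d ∷ rs) eq with next d in eq′
... | nothing with successor rs in eq″
...   | nothing with last-sweep rs eq″
...     | T , ticks = suc T , carry eq′ ticks

-- An increment takes several moves, but a lower bound on the running time of the clock is all that
-- the race asks for, so one move per increment is counted.
ticks : ∀ {b} v (ds : Digits b) → remaining ds ≡ v → ∃ λ T → v ≤ T × Ticks T false [] ds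
ticks v ds v≡ with successor ds in eq
ticks zero    ds v≡ | just ds′ with () ← trans (≡.sym v≡) (remaining-successor ds eq)
ticks (suc v) ds v≡ | just ds′ with ticks v ds′ (ℕ.suc-injective (trans (≡.sym (remaining-successor ds eq)) v≡))
... | T , v≤T , t with sweep ds eq t
...   | T′ , T≤T′ , t′ = suc T′ , s≤s (ℕ.≤-trans v≤T T≤T′) , turn-up t′
ticks v ds v≡ | nothing with last-sweep ds eq
... | T , t = suc T , subst (_≤ suc T) (trans (≡.sym (remaining-last ds eq)) v≡) z≤n , turn-up t

-- A digit that is at most 1 can still be raised `b` times, as often as a digit 0 in base `b + 1`.
-- The base is one larger than in the bound to make up for the digits already there.
remaining-small : ∀ {b} {ds : Digits b} → All (λ d → toℕ d ≤ 1) ds → suc b ^ length ds ≤ suc (remaining ds)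
remaining-small                  []                     = ℕ.≤-refl
remaining-small {b} {ds = d ∷ ds} (small ∷ smalls) = begin
  suc b * suc b ^ length ds                           ≤⟨ ℕ.*-monoʳ-≤ (suc b) (remaining-small smalls) ⟩
  suc b * suc (remaining ds)                          ≡⟨ ℕ.*-suc (suc b) (remaining ds) ⟩
  suc b + suc b * remaining ds                        ≤⟨ s≤s (ℕ.+-mono-≤ (ℕ.∸-monoʳ-≤ (suc b) small) (ℕ.m≤n+m (suc b * remaining ds) (remaining ds))) ⟩
  suc ((suc b ∸ toℕ d) + suc (suc b) * remaining ds)  ∎
  where open ℕ.≤-Reasoning

-- The complement of a deterministic logarithmic space machine

-- Scanning rejects formulas with an empty clause and accepts the empty formula, without
-- touching the work tapes: no space is allowed for them. Then the clock tape is built.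
-- In state race, the given machine and the clock move simultaneously.
data Control : Set where
  scan-start scan-clause scan-next build incr rewind accept reject : Control

data State (q : ℕ) : Set where
  prepare : Control → State q
  race    : Bool → Fin q → State q

finite-Control : Finite Control
finite-Control = finite-enumeration
  (scan-start ∷ scan-clause ∷ scan-next ∷ build ∷ incr ∷ rewind ∷ accept ∷ reject ∷ [])
  (λ { scan-start → 0F ; scan-clause → 1F ; scan-next → 2F ; build → 3F ; incr → 4F ; rewind → 5F ;
     accept → 6F ; reject → 7F })
  (λ { scan-start → refl ; scan-clause → refl ; scan-next → refl ; build → refl ; incr → refl ;
     rewind → refl ; accept → refl ; reject → refl })

finite-State : ∀ q → Finite (State q)
finite-State q = finite-retract (finite-⊎ finite-Control (finite-× finite-Bool (finite-Fin q))) to from from-to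
  where
  to : State q → Control ⊎ (Bool × Fin q)
  to (prepare c) = inj₁ c
  to (race u s)  = inj₂ (u , s)
  from : Control ⊎ (Bool × Fin q) → State q
  from (inj₁ c)       = prepare c
  from (inj₂ (u , s)) = race u s
  from-to : ∀ s → from (to s) ≡ s
  from-to (prepare _) = refl
  from-to (race _ _)  = refl

finite-Cell : ∀ b → Finite (Cell b)
finite-Cell b = record { size = 4 + b ; toFin = to ; fromFin = from ; from∘to = from-to }
  where
  to : Cell b → Fin (4 + b)
  to blank     = zero
  to mark      = suc zero
  to (digit d) = suc (suc d)
  from : Fin (4 + b) → Cell b
  from zero          = blank
  from (suc zero)    = mark
  from (suc (suc d)) = digit d
  from-to : ∀ c → from (to c) ≡ c
  from-to blank     = refl
  from-to mark      = refl
  from-to (digit _) = refl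

optional : ∀ {A : Set} → Maybe A → List A
optional (just a) = a ∷ []
optional nothing  = []

clock : ∀ {b} → Bool → Cell b → Maybe (Bool × Cell b × Move)
clock true  (digit d) = just (maybe′ (λ d′ → false , digit d′ , left) (true , digit zero , right) (next d))
clock true  _         = nothing
clock false mark      = just (true , mark , right)
clock false (digit d) = just (false , digit d , left)
clock false blank     = nothing

log₂<length : ∀ {b} (ds : Digits b) n → bin ds ≡ suc n → ⌊log₂ n ⌋ < length ds
log₂<length ds n value = ℕ.≰⇒> λ short → ℕ.<⇒≱ (bin<2^length ds) (begin
  2 ^ length ds           ≤⟨ ℕ.^-monoʳ-≤ 2 short ⟩
  2 ^ ⌊log₂ n ⌋           ≤⟨ ℕ.^-monoʳ-≤ 2 (⌊log₂⌋-mono-≤ (ℕ.n≤1+n n)) ⟩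
  2 ^ ⌊log₂ suc n ⌋       ≤⟨ 2^log₂≤ n ⟩
  suc n                   ≡⟨ value ⟨
  bin ds                  ∎)
  where open ℕ.≤-Reasoning

module Complement (M : NTM 5) (det : Deterministic M) (b : ℕ) where

  open ≡.≡-Reasoning

  -- The number of symbols computes to `suc (γ M) * (4 + b)`: pairs of a symbol of `M` and a clock
  -- cell, because all tapes of a machine share one alphabet. Symbol 0, the blank, decodes by
  -- computation to the pair of both blanks.
  Sym : Set
  Sym = Fin (suc (3 + b + γ M * (4 + b)))

  symbol : Sym → Fin (suc (γ M))
  symbol a = proj₁ (remQuot {suc (γ M)} (4 + b) a)

  cell : Sym → Cell b
  cell a = fromFin (finite-Cell b) (proj₂ (remQuot {suc (γ M)} (4 + b) a))

  tag : Fin (suc (γ M)) → Cell b → Sym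
  tag a c = combine a (toFin (finite-Cell b) c)

  symbol-tag : ∀ a c → symbol (tag a c) ≡ a
  symbol-tag a c = cong proj₁ (Fin.remQuot-combine a (toFin (finite-Cell b) c))

  cell-tag : ∀ a c → cell (tag a c) ≡ c
  cell-tag a c = trans (cong (fromFin (finite-Cell b) ∘ proj₂) (Fin.remQuot-combine a (toFin (finite-Cell b) c))) (from∘to (finite-Cell b) c)

  Action : Set
  Action = State (Q M) × Move × Vec (Sym × Move) (suc (k M))

  keep : ∀ {n} → Vec Sym n → Vec (Sym × Move) n
  keep = Vec.map (λ a → a , stay)

  go : ∀ {n} → Control → Move → Vec Sym n → State (Q M) × Move × Vec (Sym × Move) n
  go s m w = prepare s , m , keep w

  tick : Control → Move → Cell b → Move → Vec Sym (suc (k M)) → Maybe Action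
  tick s m c m′ w = just (prepare s , m , (tag zero c , m′) ∷ keep (Vec.tail w))

  end-clause : Control → Vec Sym (suc (k M)) → Maybe Action
  end-clause scan-clause w = just (go scan-next right w)
  end-clause _           w = just (go reject stay w)

  scan-letter : Control → Fin 5 → Vec Sym (suc (k M)) → Maybe Action
  scan-letter q 4F w = end-clause q w
  scan-letter q _  w = just (go scan-clause right w)

  prepare-move : Control → InSym 5 → Cell b → Vec Sym (suc (k M)) → Maybe Action
  prepare-move scan-start  ⊢       c         w = just (go scan-start right w)
  prepare-move scan-start  ⊣       c         w = just (go accept stay w)
  prepare-move scan-start  (sym a) c         w = scan-letter scan-start a w
  prepare-move scan-clause (sym a) c         w = scan-letter scan-clause a w
  prepare-move scan-next   (sym a) c         w = scan-letter scan-next a w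
  prepare-move scan-next   ⊣       c         w = tick build stay mark stay w
  prepare-move build       ⊢       c         w = just (race false (q₀ M) , stay , keep w)
  prepare-move build       _       c         w = tick incr left mark right w
  prepare-move incr        a       blank     w = tick rewind stay (digit (suc zero)) left w
  prepare-move incr        a       (digit zero)    w = tick rewind stay (digit (suc zero)) left w
  prepare-move incr        a       (digit (suc _)) w = tick incr stay (digit zero) right w
  prepare-move rewind      a       mark      w = just (go build stay w)
  prepare-move rewind      a       (digit d) w = tick rewind stay (digit d) left w
  prepare-move _           a       c         w = nothing

  both : Maybe (Bool × Cell b × Move) → List (Fin (Q M) × Move × Vec (Fin (suc (γ M)) × Move) (k M)) →
         Vec Sym (suc (k M)) → Action
  both (just (u , c , m)) ((q , m′ , ws) ∷ _) w = race u q , m′ , (tag zero c , m) ∷ Vec.map (λ (a , m) → tag a blank , m) ws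
  both _                  _                   w = go accept stay w

  move : State (Q M) → InSym 5 → Vec Sym (suc (k M)) → Maybe Action
  move (prepare s) a w = prepare-move s a (cell (lookup w zero)) w
  move (race u q)  a w with q Fin.≟ qacc M
  -- Acceptance by `M` becomes rejection: the machine stops in a state other than `accept`.
  ... | yes _ = nothing
  ... | no  _ = just (both (clock u (cell (lookup w zero))) (δ M q a (Vec.map symbol (Vec.tail w))) w)

  states : Finite (State (Q M))
  states = finite-State (Q M)

  machine : NTM 5
  machine = record
    { Q    = size states
    ; k    = suc (k M)
    ; γ    = 3 + b + γ M * (4 + b)
    ; q₀   = toFin states (prepare scan-start)
    ; qacc = toFin states (prepare accept)
    ; δ    = λ q a w → List.map (λ (s , o) → toFin states s , o) (optional (move (fromFin states q) a w))
    }

  deterministic : Deterministic machine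
  deterministic q a w with move (fromFin states q) a w
  ... | just _  = s≤s z≤n
  ... | nothing = z≤n

  module Execution (x : List (Fin 5)) (s : ℕ) where

    private
      n : ℕ
      n = length x

    _⟶_ : Config machine → Config machine → Set
    _⟶_ = Step machine x

    open Halting machine x s public

    _⇒_ : Config machine → Config machine → Set
    _⇒_ = Forced _⟶_ Inner

    reads : Config machine → Vec Sym (suc (k M))
    reads c = Vec.map readTape (tapes c)

    perform : Config machine → Action → Config machine
    perform c (q , o) = apply machine x (toFin states q , o) c

    move-at : ∀ c {q} → state c ≡ toFin states q → move (fromFin states (state c)) (readIn x (ipos c)) (reads c) ≡ move q (readIn x (ipos c)) (reads c)
    move-at c {q} st = cong (λ q → move q (readIn x (ipos c)) (reads c)) (trans (cong (fromFin states) st) (from∘to states q))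

    one-step : ∀ c {q o} → state c ≡ toFin states q → q ≢ prepare accept → Within c →
               move q (readIn x (ipos c)) (reads c) ≡ just o → c ⇒ perform c o
    one-step c {q} {o} st q≢ within eq = ((within , λ eq → q≢ (toFin-injective states {q} {prepare accept} (trans (≡.sym st) eq))) ,
      only-step machine x {c} (cong (List.map _ ∘ optional) (trans (move-at c {q} st) eq))) ∷ []

    stuck : ∀ c {q} → state c ≡ toFin states q → move q (readIn x (ipos c)) (reads c) ≡ nothing → Stuck _⟶_ c
    stuck c {q} st eq = no-step machine x {c} (cong (List.map _ ∘ optional) (trans (move-at c {q} st) eq))

    keep-tape : ∀ c i → lookup (Vec.zipWith updTape (tapes c) (keep (reads c))) i ≡ updTape (lookup (tapes c) i) (readTape (lookup (tapes c) i) , stay)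
    keep-tape c i = begin
      lookup (Vec.zipWith updTape (tapes c) (keep (reads c))) i             ≡⟨ Vec.lookup-zipWith updTape i (tapes c) _ ⟩
      updTape (lookup (tapes c) i) (lookup (keep (reads c)) i)              ≡⟨ cong (updTape (lookup (tapes c) i)) (Vec.lookup-map i _ (reads c)) ⟩
      updTape (lookup (tapes c) i) (lookup (reads c) i , stay)              ≡⟨ cong (λ a → updTape (lookup (tapes c) i) (a , stay)) (Vec.lookup-map i readTape (tapes c)) ⟩
      updTape (lookup (tapes c) i) (readTape (lookup (tapes c) i) , stay)   ∎

    unchanged-cells : ∀ t j → symbol (writeCell (cells t) (head t) (readTape t) j) ≡ symbol (cells t j)
    unchanged-cells t j with j ℕ.≟ head t
    ... | yes refl = refl
    ... | no  _    = refl

    lookup-tail : ∀ {A : Set} {n} (xs : Vec A (suc n)) i → lookup (Vec.tail xs) i ≡ lookup xs (suc i)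
    lookup-tail (_ ∷ _) i = refl

    -- Up to the tags, the work tapes ts of the given machine follow the clock tape.
    record Shadows (c : Config machine) (ts : Vec (Tape (γ M)) (k M)) : Set where
      constructor shadow
      field
        heads-≡   : ∀ i → head (lookup (tapes c) (suc i)) ≡ head (lookup ts i)
        symbols-≡ : ∀ i j → symbol (cells (lookup (tapes c) (suc i)) j) ≡ cells (lookup ts i) j

    record Tapes (c : Config machine) (h : ℕ) (ds : Digits b) (ts : Vec (Tape (γ M)) (k M)) : Set where
      constructor mk
      field
        clock-holds : Holds cell (lookup (tapes c) zero) h ds
        shadows     : Shadows c ts
      open Shadows shadows public
    open Tapes

    first-tape : ∀ (c : Config machine) o ws → lookup (Vec.zipWith updTape (tapes c) (o ∷ ws)) zero ≡ updTape (lookup (tapes c) zero) o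
    first-tape c o ws = Vec.lookup-zipWith updTape zero (tapes c) (o ∷ ws)

    other-tape : ∀ (c : Config machine) o ws i → lookup (Vec.zipWith updTape (tapes c) (o ∷ ws)) (suc i) ≡ updTape (lookup (tapes c) (suc i)) (lookup ws i)
    other-tape c o ws i = Vec.lookup-zipWith updTape (suc i) (tapes c) (o ∷ ws)

    ticked : ∀ c {ts} → Shadows c ts → ∀ q m {o h′ ds′} → Holds cell (updTape (lookup (tapes c) zero) o) h′ ds′ →
             Tapes (perform c (q , m , o ∷ keep (Vec.tail (reads c)))) h′ ds′ ts
    ticked c (shadow heads symbols) q m {o} held = mk (subst (λ t → Holds cell t _ _) (≡.sym (first-tape c o (keep (Vec.tail (reads c))))) held) (shadow
      (λ i → trans (cong head (same i)) (heads i))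
      (λ i j → trans (cong (λ t → symbol (cells t j)) (same i)) (trans (unchanged-cells (lookup (tapes c) (suc i)) j) (symbols i j))))
      where
      same : ∀ i → lookup (Vec.zipWith updTape (tapes c) (o ∷ keep (Vec.tail (reads c)))) (suc i)
                   ≡ updTape (lookup (tapes c) (suc i)) (readTape (lookup (tapes c) (suc i)) , stay)
      same i = trans (other-tape c o (keep (Vec.tail (reads c))) i) (cong (updTape (lookup (tapes c) (suc i)))
        (trans (Vec.lookup-map i _ (Vec.tail (reads c)))
          (cong (_, stay) (trans (lookup-tail (reads c) i) (Vec.lookup-map (suc i) readTape (tapes c))))))

    module _ (c : Config machine) {h ds ts} (t : Tapes c h ds ts) where

      kept : ∀ q m → Tapes (perform c (q , m , keep (reads c))) h ds ts
      kept q m = mk (subst (λ t → Holds cell t h ds) (≡.sym (keep-tape c zero)) (holds-keep stay (clock-holds t))) (shadow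
        (λ i → trans (cong head (keep-tape c (suc i))) (heads-≡ t i))
        (λ i j → trans (cong (λ t → symbol (cells t j)) (keep-tape c (suc i))) (trans (unchanged-cells (lookup (tapes c) (suc i)) j) (symbols-≡ t i j))))

      raced : ∀ q m {o h′ ds′} (ws : Vec (Fin (suc (γ M)) × Move) (k M)) → Holds cell (updTape (lookup (tapes c) zero) o) h′ ds′ →
              Tapes (perform c (q , m , o ∷ Vec.map (λ (a , m) → tag a blank , m) ws)) h′ ds′ (Vec.zipWith updTape ts ws)
      raced q m {o} ws held = mk (subst (λ t → Holds cell t _ _) (≡.sym (first-tape c o tagged)) held) (shadow
        (λ i → begin
          head (lookup (Vec.zipWith updTape (tapes c) (o ∷ tagged)) (suc i))         ≡⟨ cong head (written i) ⟩
          moveHead (proj₂ (lookup ws i)) (head (lookup (tapes c) (suc i)))           ≡⟨ cong (moveHead (proj₂ (lookup ws i))) (heads-≡ t i) ⟩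
          moveHead (proj₂ (lookup ws i)) (head (lookup ts i))                        ≡⟨ cong head (Vec.lookup-zipWith updTape i ts ws) ⟨
          head (lookup (Vec.zipWith updTape ts ws) i)                                ∎)
        (λ i j → begin
          symbol (cells (lookup (Vec.zipWith updTape (tapes c) (o ∷ tagged)) (suc i)) j)                  ≡⟨ cong (λ t → symbol (cells t j)) (written i) ⟩
          symbol (writeCell (cells (lookup (tapes c) (suc i))) (head (lookup (tapes c) (suc i))) (tag (proj₁ (lookup ws i)) blank) j)
                                                                                                          ≡⟨ cell-written i j ⟩
          writeCell (cells (lookup ts i)) (head (lookup ts i)) (proj₁ (lookup ws i)) j                    ≡⟨ cong (λ t → cells t j) (Vec.lookup-zipWith updTape i ts ws) ⟨
          cells (lookup (Vec.zipWith updTape ts ws) i) j                                                  ∎))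
        where
        tagged : Vec (Sym × Move) (k M)
        tagged = Vec.map (λ (a , m) → tag a blank , m) ws
        written : ∀ i → lookup (Vec.zipWith updTape (tapes c) (o ∷ tagged)) (suc i)
                        ≡ updTape (lookup (tapes c) (suc i)) (tag (proj₁ (lookup ws i)) blank , proj₂ (lookup ws i))
        written i = trans (other-tape c o tagged i) (cong (updTape (lookup (tapes c) (suc i))) (Vec.lookup-map i _ ws))
        cell-written : ∀ i j → symbol (writeCell (cells (lookup (tapes c) (suc i))) (head (lookup (tapes c) (suc i))) (tag (proj₁ (lookup ws i)) blank) j)
                               ≡ writeCell (cells (lookup ts i)) (head (lookup ts i)) (proj₁ (lookup ws i)) j
        cell-written i j rewrite heads-≡ t i with j ℕ.≟ head (lookup ts i)
        ... | yes _ = symbol-tag (proj₁ (lookup ws i)) blank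
        ... | no  _ = symbols-≡ t i j

      reads-M : Vec.map symbol (Vec.tail (reads c)) ≡ Vec.map readTape ts
      reads-M = vec-ext λ i → begin
        lookup (Vec.map symbol (Vec.tail (reads c))) i   ≡⟨ Vec.lookup-map i symbol (Vec.tail (reads c)) ⟩
        symbol (lookup (Vec.tail (reads c)) i)           ≡⟨ cong symbol (trans (lookup-tail (reads c) i) (Vec.lookup-map (suc i) readTape (tapes c))) ⟩
        symbol (readTape (lookup (tapes c) (suc i)))     ≡⟨ symbols-≡ t i _ ⟩
        cells (lookup ts i) (head (lookup (tapes c) (suc i))) ≡⟨ cong (cells (lookup ts i)) (heads-≡ t i) ⟩
        readTape (lookup ts i)                           ≡⟨ Vec.lookup-map i readTape ts ⟨
        lookup (Vec.map readTape ts) i                   ∎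

      clock-read : ∀ {e} → cell (readTape (lookup (tapes c) zero)) ≡ e → cell (lookup (reads c) zero) ≡ e
      clock-read = trans (cong cell (Vec.lookup-map zero readTape (tapes c)))

      within : h ≤ s → (∀ i → head (lookup ts i) ≤ s) → Within c
      within h≤ ts≤ zero    = subst (_≤ s) (≡.sym (head-≡ (clock-holds t))) h≤
      within h≤ ts≤ (suc i) = subst (_≤ s) (≡.sym (heads-≡ t i)) (ts≤ i)

    private
      moved : Move → ℕ → ℕ
      moved m p = moveHead m p ⊓ suc n

    _▷_ : ∀ {c} {B C : Config machine → Set} → (∃ λ c′ → c ⇒ c′ × B c′) →
          (∀ {c′} → B c′ → ∃ λ c″ → c′ ⇒ c″ × C c″) → ∃ λ c″ → c ⇒ c″ × C c″
    (_ , p , x) ▷ f with f x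
    ... | _ , q , y = _ , p ++ᶠ q , y

    blanks : Vec (Tape (γ M)) (k M)
    blanks = Vec.replicate (k M) blankTape

    blank-heads : ∀ i → head (lookup blanks i) ≤ s
    blank-heads i = subst (λ t → head t ≤ s) (≡.sym (Vec.lookup-replicate i blankTape)) z≤n

    record Preparing (c : Config machine) (q : Control) (p h : ℕ) (ds : Digits b) : Set where
      constructor preparing
      field
        state-≡   : state c ≡ toFin states (prepare q)
        ipos-≡    : ipos c ≡ p
        the-tapes : Tapes c h ds blanks
    open Preparing

    held : ∀ {c q p h ds} → Preparing c q p h ds → Holds cell (lookup (tapes c) zero) h ds
    held a = clock-holds (the-tapes a)

    clock-tape : Config machine → Tape (3 + b + γ M * (4 + b))
    clock-tape c = lookup (tapes c) zero

    prepare≢ : ∀ {q : Control} → q ≢ accept → prepare {Q M} q ≢ prepare accept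
    prepare≢ q≢ refl = q≢ refl

    tick-step : ∀ {c q q′ p p′ h h′ ds ds′ m m′ e e′} → Preparing c q p h ds → q ≢ accept → h ≤ s →
                cell (readTape (clock-tape c)) ≡ e →
                prepare-move q (readIn x p) e (reads c) ≡ tick q′ m e′ m′ (reads c) →
                Holds cell (updTape (clock-tape c) (tag zero e′ , m′)) h′ ds′ → moved m p ≡ p′ →
                ∃ λ c′ → c ⇒ c′ × Preparing c′ q′ p′ h′ ds′
    tick-step {c} {q} {q′} {m = m} (preparing st refl t) q≢ h≤ reading eq written pos =
      _ , one-step c st (prepare≢ q≢) (within c t h≤ blank-heads)
            (trans (cong (λ e → prepare-move q (readIn x (ipos c)) e (reads c)) (clock-read c t reading)) eq) ,
      preparing refl pos (ticked c (shadows t) (prepare q′) m written)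

    keep-step : ∀ {c q q′ p p′ h ds m e} → Preparing c q p h ds → q ≢ accept → h ≤ s →
                cell (readTape (clock-tape c)) ≡ e → prepare-move q (readIn x p) e (reads c) ≡ just (go q′ m (reads c)) → moved m p ≡ p′ →
                ∃ λ c′ → c ⇒ c′ × Preparing c′ q′ p′ h ds
    keep-step {c} {q} {q′} {m = m} (preparing st refl t) q≢ h≤ reading eq pos =
      _ , one-step c st (prepare≢ q≢) (within c t h≤ blank-heads)
            (trans (cong (λ e → prepare-move q (readIn x (ipos c)) e (reads c)) (clock-read c t reading)) eq) ,
      preparing refl pos (kept c t (prepare q′) m)

    ⊓-bounded : ∀ {p} → p ≤ suc n → p ⊓ suc n ≡ p
    ⊓-bounded = ℕ.m≤n⇒m⊓n≡m

    increment : ∀ rs ls {c p} → Preparing c incr p (suc (length ls)) (ls ʳ++ rs) → p ≤ suc n → length ls + length rs < s →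
                ∃ λ c′ → c ⇒ c′ × Preparing c′ rewind p (length ls) (ls ʳ++ inc rs)
    increment [] ls a p≤ len = tick-step {e′ = digit (suc zero)} a (λ ()) (ℕ.≤-trans (s≤s (ℕ.m≤m+n _ _)) len)
      (read-blank ls (held a)) refl
      (holds-write ls left (held a) (cell-tag zero (digit (suc zero)))) (⊓-bounded p≤)
    increment (zero ∷ rs) ls a p≤ len = tick-step {e′ = digit (suc zero)} a (λ ()) (ℕ.≤-trans (s≤s (ℕ.m≤m+n _ _)) len)
      (read-digit ls (held a)) refl
      (holds-write ls left (held a) (cell-tag zero (digit (suc zero)))) (⊓-bounded p≤)
    increment (suc d ∷ rs) ls a p≤ len =
      tick-step {e′ = digit zero} a (λ ()) (ℕ.≤-trans (s≤s (ℕ.m≤m+n _ _)) len) (read-digit ls (held a)) refl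
        (holds-write ls right (held a) (cell-tag zero (digit zero))) (⊓-bounded p≤) ▷ λ a′ →
      increment rs (zero ∷ ls) a′ p≤ (subst (_< s) (ℕ.+-suc (length ls) (length rs)) len) ▷ λ a″ →
      tick-step {e′ = digit zero} a″ (λ ()) (ℕ.≤-trans (s≤s (ℕ.m≤m+n _ _)) len)
        (read-digit ls {rs = inc rs} (held a″)) refl
        (holds-write ls {zero ∷ inc rs} left (held a″) (cell-tag zero (digit zero))) (⊓-bounded p≤)

    build-left : ∀ p e w → prepare-move build (readIn x (suc p)) e w ≡ tick incr left mark right w
    build-left p e w with readIn x (suc p) in eq
    ... | ⊢     = contradiction eq (readIn-suc x p)
    ... | ⊣     = refl
    ... | sym _ = refl

    Small : Digits b → Set
    Small = All (λ d → toℕ d ≤ 1)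

    -- As in saving a position, the sum of counter and head position is invariant. Starting on the
    -- right endmarker with an empty counter, the head arrives on the left with the value n + 1.
    build-clock : ∀ Λ → suc n < 2 ^ Λ → Λ < s → ∀ p {c ds} → Preparing c build p 0 ds → bin ds + p ≤ suc n → length ds ≤ Λ → Small ds →
                  ∃ λ c′ → c ⇒ c′ × (∃ λ ds′ → Preparing c′ build 0 0 ds′ × bin ds′ ≡ bin ds + p × length ds′ ≤ Λ × Small ds′)
    build-clock Λ fits Λ<s zero {ds = ds} a v≤ len small = _ , [] , ds , a , ≡.sym (ℕ.+-identityʳ (bin ds)) , len , small
    build-clock Λ fits Λ<s (suc p) {c} {ds} a v≤ len small =
      tick-step {e′ = mark} a (λ ()) z≤n (read-mark (held a)) (build-left p mark (reads c))
        (holds-same right (held a) (trans (cell-tag zero mark) (≡.sym (read-mark (held a)))))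
        (⊓-bounded p≤) ▷ λ a′ →
      increment ds [] a′ p≤ (ℕ.≤-<-trans len Λ<s) ▷ λ a″ →
      keep-step a″ (λ ()) z≤n (read-mark (held a″)) refl (⊓-bounded p≤) ▷ λ a‴ →
      build-clock Λ fits Λ<s p a‴ (subst (_≤ suc n) (≡.sym value) v≤)
        (length-inc ds len (ℕ.≤-<-trans (ℕ.≤-trans (s≤s (ℕ.m≤m+n (bin ds) p)) suc-v≤) fits)) (inc-small small) ▷ λ (ds′ , a⁗ , v , rest) →
      _ , [] , ds′ , a⁗ , trans v value , rest
      where
      value : bin (inc ds) + p ≡ bin ds + suc p
      value = trans (cong (_+ p) (bin-inc ds)) (≡.sym (ℕ.+-suc (bin ds) p))
      suc-v≤ : suc (bin ds + p) ≤ suc n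
      suc-v≤ = subst (_≤ suc n) (ℕ.+-suc (bin ds) p) v≤
      p≤ : p ≤ suc n
      p≤ = ℕ.≤-trans (ℕ.n≤1+n p) (ℕ.m+n≤o⇒n≤o (bin ds) v≤)

    accepting : ∀ {c A} → state c ≡ toFin states (prepare accept) → Within c → A → Verdict c A
    accepting {c} st within a = verdict [] (stuck c {prepare accept} st refl) within (inj₁ (st , a))

    rejecting : ∀ {c A} q → state c ≡ toFin states q → q ≢ prepare accept → move q (readIn x (ipos c)) (reads c) ≡ nothing →
                Within c → ¬ A → Verdict c A
    rejecting {c} q st q≢ eq within ¬a =
      verdict [] (stuck c {q} st eq) within (inj₂ ((λ eq → q≢ (toFin-injective states {q} {prepare accept} (trans (≡.sym st) eq))) , ¬a))

    AvoidsAccept : ℕ → Config M → Set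
    AvoidsAccept T c = ∀ t d → t ≤ T → Run (Step M x) t c d → state d ≢ qacc M

    record Racing (c : Config machine) (d : Config M) (up : Bool) (h : ℕ) (ds : Digits b) : Set where
      constructor racing
      field
        state-≡   : state c ≡ toFin states (race up (state d))
        ipos-≡    : ipos c ≡ ipos d
        the-tapes : Tapes c h ds (tapes d)

    race-move : ∀ {u q a w} → q ≢ qacc M →
                move (race u q) a w ≡ just (both (clock u (cell (lookup w zero))) (δ M q a (Vec.map symbol (Vec.tail w))) w)
    race-move {q = q} q≢ with q Fin.≟ qacc M
    ... | yes q≡ = contradiction q≡ q≢
    ... | no  _  = refl

    race-over : ∀ {u a w} → move (race u (qacc M)) a w ≡ nothing
    race-over with qacc M Fin.≟ qacc M
    ... | yes _ = refl
    ... | no  ≢ = contradiction refl ≢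

    race≢ : ∀ {u q} → race {Q M} u q ≢ prepare accept
    race≢ ()

    options : Config M → List (Fin (Q M) × Move × Vec (Fin (suc (γ M)) × Move) (k M))
    options d = δ M (state d) (readIn x (ipos d)) (Vec.map readTape (tapes d))

    module _ (space : SpaceWithin M x (_≤ s)) where

      reach-heads : ∀ {t d} → Reach M x t d → ∀ i → head (lookup (tapes d) i) ≤ s
      reach-heads r = VecAll.lookup⁺ (space _ _ r)

      race-action : ∀ {c d u h ds e} → Racing c d u h ds → state d ≢ qacc M → cell (readTape (clock-tape c)) ≡ e →
                    move (race u (state d)) (readIn x (ipos c)) (reads c) ≡ just (both (clock u e) (options d) (reads c))
      race-action {c} {d} {u} (racing _ refl t) d≢ reading = trans (race-move d≢)
        (cong₂ (λ e ws → just (both (clock u e) (δ M (state d) (readIn x (ipos d)) ws) (reads c))) (clock-read c t reading) (reads-M c t))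

      race-accept : ∀ {c d u h ds A t} → Racing c d u h ds → h ≤ s → Reach M x t d → state d ≢ qacc M →
                    move (race u (state d)) (readIn x (ipos c)) (reads c) ≡ just (go accept stay (reads c)) → A → Verdict c A
      race-accept {c} {d} {u} (racing st ip t) h≤ r d≢ eq a =
        verdict-after (one-step c {race u (state d)} st race≢ (within c t h≤ (reach-heads r)) eq)
          (accepting refl (within _ (kept c t (prepare accept) stay) h≤ (reach-heads r)) a)

      -- Since `M` is deterministic, avoiding acceptance for `suc T` steps from a nonaccepting `d`
      -- with a successor amounts to avoiding it for `T` steps from this only successor. If `d` is
      -- stuck, only `d` itself matters. So a statement about all runs is settled by following one.
      race-step : ∀ {c d u u′ h h′ ds ds′ T t e e′ m′} → Racing c d u h ds → h ≤ s → Reach M x t d → cell (readTape (clock-tape c)) ≡ e →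
                  clock u e ≡ just (u′ , e′ , m′) → Holds cell (updTape (clock-tape c) (tag zero e′ , m′)) h′ ds′ →
                  (∀ {c′ d′} → Step M x d d′ → Racing c′ d′ u′ h′ ds′ → Verdict c′ (AvoidsAccept T d′)) →
                  Verdict c (AvoidsAccept (suc T) d)
      race-step {c} {d} {u} {u′} {h′ = h′} {ds′ = ds′} {T} {e′ = e′} {m′} a@(racing st ip t) h≤ r reading ticking held next-verdict
        with state d Fin.≟ qacc M
      ... | yes d≡ = rejecting (race u (state d)) st race≢ (trans (cong (λ q → move (race u q) _ _) d≡) race-over)
              (within c t h≤ (reach-heads r)) (λ avoids → avoids 0 d z≤n [] d≡)
      ... | no  d≢ = split (options d) refl
        where
        action : ∀ {os} → options d ≡ os → move (race u (state d)) (readIn x (ipos c)) (reads c) ≡ just (both (just (u′ , e′ , m′)) os (reads c))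
        action eq = trans (race-action a d≢ reading) (cong₂ (λ r os → just (both r os (reads c))) ticking eq)
        split : ∀ os → options d ≡ os → Verdict c (AvoidsAccept (suc T) d)
        split [] eq = race-accept a h≤ r d≢ (action eq) halts
          where
          halts : AvoidsAccept (suc T) d
          halts t d′ _ p with run-from-stuck (no-step M x eq) p
          ... | _ , refl = d≢
        split (o@(q , m , ws) ∷ os) eq =
          verdict-after (one-step c {race u (state d)} st race≢ (within c t h≤ (reach-heads r)) (action eq))
            (verdict-⇔ later earlier
              (next-verdict step-d (racing refl (cong (λ p → moveHead m p ⊓ suc n) ip) (raced c t (race u′ q) m ws held))))
          where
          d′ : Config M
          d′ = apply M x o d
          step-d : Step M x d d′
          step-d = o , subst (o ∈_) (≡.sym eq) (here refl) , refl
          later : AvoidsAccept T d′ → AvoidsAccept (suc T) d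
          later avoids zero    _ _        []      = d≢
          later avoids (suc t) e (s≤s t≤) (p ∷ q) with step-unique M x det p step-d
          ... | refl = avoids t e t≤ q
          earlier : AvoidsAccept (suc T) d → AvoidsAccept T d′
          earlier avoids t e t≤ q = avoids (suc t) e (s≤s t≤) (step-d ∷ q)

      -- Cell 0 holds the mark. On the way up the head is on the first digit of the right part, on
      -- the way down on the digit just left of it, or on the mark.
      height : Bool → Digits b → ℕ
      height true  ls = suc (length ls)
      height false ls = length ls

      -- Every move of the clock is also a step of `M`, so the induction on the ticks lowers the
      -- number of steps still to be inspected. At the overflow it is 0 and only `d` itself counts.
      race-verdict : ∀ {T up ls rs c d t} → Ticks T up ls rs → length ls + length rs < s → Reach M x t d →
                     Racing c d up (height up ls) (ls ʳ++ rs) → Verdict c (AvoidsAccept T d)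
      race-verdict {ls = ls} {c = c} {d} overflow len r a@(racing st ip t) with state d Fin.≟ qacc M
      ... | yes d≡ = rejecting (race true (state d)) st race≢ (trans (cong (λ q → move (race true q) _ _) d≡) race-over)
              (within c t (ℕ.≤-trans (s≤s (ℕ.m≤m+n _ 0)) len) (reach-heads r)) (λ avoids → avoids 0 d z≤n [] d≡)
      ... | no d≢ = race-accept a (ℕ.≤-trans (s≤s (ℕ.m≤m+n _ 0)) len) r d≢
              (race-action a d≢ (read-blank ls (clock-holds t))) (λ { _ _ z≤n [] → d≢ })
      race-verdict {ls = ls} {c = c} (bump {d = e} {d′ = e′} {rs} eq ticks) len r a@(racing st ip t) =
        race-step {e′ = digit e′} a (ℕ.≤-trans (s≤s (ℕ.m≤m+n _ _)) len) r (read-digit ls (clock-holds t))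
          (cong (just ∘ maybe′ (λ d′ → false , digit d′ , left) (true , digit zero , right)) eq)
          (holds-write ls left (clock-holds t) (cell-tag zero (digit e′)))
          (λ s a′ → race-verdict ticks len (step r s) a′)
      race-verdict {ls = ls} (carry {d = e} {rs} eq ticks) len r a@(racing st ip t) =
        race-step {e′ = digit zero} a (ℕ.≤-trans (s≤s (ℕ.m≤m+n _ _)) len) r (read-digit ls (clock-holds t))
          (cong (just ∘ maybe′ (λ d′ → false , digit d′ , left) (true , digit zero , right)) eq)
          (holds-write ls right (clock-holds t) (cell-tag zero (digit zero)))
          (λ s′ a′ → race-verdict ticks (subst (_< s) (ℕ.+-suc (length ls) (length rs)) len) (step r s′) a′)
      race-verdict (descend {d = e} {ls} {rs} ticks) len r a@(racing st ip t) =
        race-step {e′ = digit e} a (ℕ.≤-trans (s≤s (ℕ.m≤m+n (length ls) (length rs))) (ℕ.<⇒≤ len)) r (read-digit ls (clock-holds t)) refl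
          (holds-write ls {e ∷ rs} left (clock-holds t) (cell-tag zero (digit e)))
          (λ s′ a′ → race-verdict ticks (subst (_< s) (≡.sym (ℕ.+-suc (length ls) (length rs))) len) (step r s′) a′)
      race-verdict (turn-up ticks) len r a@(racing st ip t) =
        race-step {e′ = mark} a z≤n r (read-mark (clock-holds t)) refl
          (holds-same right (clock-holds t) (trans (cell-tag zero mark) (≡.sym (read-mark (clock-holds t)))))
          (λ s′ a′ → race-verdict ticks len (step r s′) a′)

    -- All heads are still at 0, so these configurations respect every space bound `s`, including 0.
    record Fresh (c : Config machine) (q : Control) (p : ℕ) : Set where
      constructor fresh
      field
        state-≡ : state c ≡ toFin states (prepare q)
        ipos-≡  : ipos c ≡ p
        at-0    : ∀ i → head (lookup (tapes c) i) ≡ 0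
        empty   : ∀ i j → cells (lookup (tapes c) i) j ≡ zero

    fresh-initial : Fresh (initial machine) scan-start 0
    fresh-initial = fresh refl refl (λ i → cong head (Vec.lookup-replicate {n = suc (k M)} i blankTape))
                      (λ i j → cong (λ t → cells t j) (Vec.lookup-replicate {n = suc (k M)} i blankTape))

    fresh-within : ∀ {c q p} → Fresh c q p → Within c
    fresh-within f i = subst (_≤ s) (≡.sym (Fresh.at-0 f i)) z≤n

    fresh-step : ∀ {c q q′ p p′ m} → Fresh c q p → q ≢ accept → (∀ e w → prepare-move q (readIn x p) e w ≡ just (go q′ m w)) →
                 moved m p ≡ p′ → ∃ λ c′ → c ⇒ c′ × Fresh c′ q′ p′
    fresh-step {c} {q} f@(fresh st refl at-0 empty) q≢ eq pos = _ , one-step c st (prepare≢ q≢) (fresh-within f) (eq _ (reads c)) ,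
      fresh refl pos (λ i → trans (cong head (keep-tape c i)) (at-0 i)) still-empty
      where
      still-empty : ∀ i j → cells (lookup (Vec.zipWith updTape (tapes c) (keep (reads c))) i) j ≡ zero
      still-empty i j rewrite keep-tape c i with j ℕ.≟ head (lookup (tapes c) i)
      ... | yes refl = empty i _
      ... | no  _    = empty i j

    start-clock : ∀ {c} → Fresh c scan-next (suc n) → ∃ λ c′ → c ⇒ c′ × Preparing c′ build (suc n) 0 []
    start-clock {c} f@(fresh st refl at-0 empty) =
      _ , one-step c {prepare scan-next} st (λ ()) (fresh-within f)
            (cong (λ a → prepare-move scan-next a (cell (lookup (reads c) zero)) (reads c)) (readIn-end x)) ,
      preparing refl (⊓-bounded ℕ.≤-refl)
        (ticked c (shadow (λ i → trans (at-0 (suc i)) (≡.sym (cong head (Vec.lookup-replicate i blankTape))))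
                          (λ i j → trans (cong symbol (empty (suc i) j)) (≡.sym (cong (λ t → cells t j) (Vec.lookup-replicate i blankTape)))))
           (prepare build) stay
           (holds-new (at-0 zero) (λ j → cong cell (empty zero j)) (cell-tag zero mark)))

    start-race : ∀ {c ds} → Preparing c build 0 0 ds → ∃ λ c′ → c ⇒ c′ × Racing c′ (initial M) false 0 ds
    start-race {c} (preparing st refl t) = _ , one-step c {prepare build} {race false (q₀ M) , stay , keep (reads c)} st (λ ()) (within c t z≤n blank-heads) refl ,
      racing refl refl (kept c t (race false (q₀ M)) stay)

    -- The clock starts from the binary digits of n + 1, of which there are more than log n. As they
    -- are small, the time until overflow has the stated lower bound.
    race-result : ∀ {c} → SpaceWithin M x (_≤ s) → suc (suc ⌊log₂ suc n ⌋) ≤ s → Fresh c scan-next (suc n) →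
                  ∃ λ T → suc b ^ suc ⌊log₂ n ⌋ ≤ suc T × Verdict c (AvoidsAccept T (initial M))
    race-result space room f =
      let _ , p , a                          = start-clock f
          _ , q , ds , a′ , value , len , small = build-clock (suc ⌊log₂ suc n ⌋) (<2^suc-log₂ (suc n)) room (suc n) a ℕ.≤-refl z≤n []
          _ , r , a″                         = start-race a′
          T , T≥ , t                         = ticks (remaining ds) ds refl
      in T , ℕ.≤-trans (ℕ.^-monoʳ-≤ (suc b) (log₂<length ds n value)) (ℕ.≤-trans (remaining-small small) (s≤s T≥)) ,
         verdict-after (p ++ᶠ q ++ᶠ r) (race-verdict space t (ℕ.≤-<-trans len room) start a″)

    open Reading x

    letter : ∀ q {a} w → a ≢ 4F → scan-letter q a w ≡ just (go scan-clause right w)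
    letter q           {0F} w _ = refl
    letter q           {1F} w _ = refl
    letter q           {2F} w _ = refl
    letter q           {3F} w _ = refl
    letter q           {4F} w ≢ = contradiction refl ≢

    scan-letters : ∀ v {c p u y} → All (_≢ 4F) v → Fresh c scan-clause p → At p u (v ++ 4F ∷ y) →
                   ∃ λ c′ → c ⇒ c′ × (∃₂ λ p′ u′ → Fresh c′ scan-next p′ × At p′ u′ y)
    scan-letters [] _ f a =
      fresh-step f (λ ()) (λ e w → cong (λ r → prepare-move scan-clause r e w) (at-read a)) refl ▷ λ f′ →
      _ , [] , _ , _ , f′ , at-right a
    scan-letters (_ ∷ v) (≢4 ∷ ≢4s) f a =
      fresh-step f (λ ()) (λ e w → trans (cong (λ r → prepare-move scan-clause r e w) (at-read a)) (letter scan-clause w ≢4)) refl ▷ λ f′ →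
      scan-letters v ≢4s f′ (at-right a)

    letters : Clause → List (Fin 5)
    letters = List.concatMap encLit

    encClause≡letters : ∀ c → encClause c ≡ letters c ++ 4F ∷ []
    encClause≡letters []      = refl
    encClause≡letters (l ∷ c) = trans (cong (encLit l ++_) (encClause≡letters c)) (≡.sym (List.++-assoc (encLit l) (letters c) _))

    encBin≢4 : ∀ v → All (_≢ 4F) (encBin v)
    encBin≢4 ℕᵇ.zero  = []
    encBin≢4 2[1+ v ] = (λ ()) ∷ encBin≢4 v
    encBin≢4 1+[2 v ] = (λ ()) ∷ encBin≢4 v

    encLit≢4 : ∀ l → All (_≢ 4F) (encLit l)
    encLit≢4 (lit true  v) = (λ ()) ∷ encBin≢4 (fromℕ v)
    encLit≢4 (lit false v) = (λ ()) ∷ encBin≢4 (fromℕ v)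

    letters≢4 : ∀ c → All (_≢ 4F) (letters c)
    letters≢4 []      = []
    letters≢4 (l ∷ c) = All.++⁺ (encLit≢4 l) (letters≢4 c)

    scan-nonempty : ∀ q l cl {c p u y} → q ≢ accept → (∀ {a} e w → prepare-move q (sym a) e w ≡ scan-letter q a w) →
                    Fresh c q p → At p u (encClause (l ∷ cl) ++ y) →
                    ∃ λ c′ → c ⇒ c′ × (∃₂ λ p′ u′ → Fresh c′ scan-next p′ × At p′ u′ y)
    scan-nonempty q l cl {c} {p} {u} {y} q≢ scans f a = start-letter (letters (l ∷ cl)) (nonempty l) (letters≢4 (l ∷ cl))
      (subst (At p u) (trans (cong (_++ y) (encClause≡letters (l ∷ cl))) (List.++-assoc (letters (l ∷ cl)) _ y)) a)
      where
      nonempty : ∀ l → letters (l ∷ cl) ≢ []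
      nonempty (lit true  _) ()
      nonempty (lit false _) ()
      start-letter : ∀ v → v ≢ [] → All (_≢ 4F) v → At p u (v ++ 4F ∷ y) →
                     ∃ λ c′ → c ⇒ c′ × (∃₂ λ p′ u′ → Fresh c′ scan-next p′ × At p′ u′ y)
      start-letter []      v≢ _ _ = contradiction refl v≢
      start-letter (_ ∷ v) _  (≢4 ∷ ≢4s) a′ =
        fresh-step f q≢ (λ e w → trans (cong (λ r → prepare-move q r e w) (at-read a′)) (trans (scans e w) (letter q w ≢4))) refl ▷ λ f′ →
        scan-letters v ≢4s f′ (at-right a′)

    Scanned : Config machine → Formula → Set
    Scanned c φ = (∃ λ c′ → c ⇒ c′ × Fresh c′ scan-next (suc n) × [] ∉ φ) ⊎ ((∃ λ c′ → c ⇒ c′ × (∃ λ p → Fresh c′ reject p)) × [] ∈ φ)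

    scanned-after : ∀ {c d cl φ} → cl ≢ [] → c ⇒ d → Scanned d φ → Scanned c (cl ∷ φ)
    scanned-after cl≢ p (inj₁ (c′ , q , f , ∉)) = inj₁ (c′ , p ++ᶠ q , f , λ { (here eq) → cl≢ (≡.sym eq) ; (there ∈) → ∉ ∈ })
    scanned-after cl≢ p (inj₂ ((c′ , q , f) , ∈)) = inj₂ ((c′ , p ++ᶠ q , f) , there ∈)

    scan-formula : ∀ φ {c p u} → Fresh c scan-next p → At p u (encode φ) → Scanned c φ
    scan-formula [] {c} f a@(at text refl) = inj₁ (c , [] ,
      subst (λ m → Fresh c scan-next (suc m)) (trans (≡.sym (ℕ.+-identityʳ _)) (at-length a)) f , λ ())
    scan-formula ([] ∷ φ) f a = inj₂
      ((fresh-step f (λ ()) (λ e w → cong (λ r → prepare-move scan-next r e w) (at-read a)) refl ▷ λ f′ → _ , [] , _ , f′) , here refl)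
    scan-formula ((l ∷ cl) ∷ φ) f a with scan-nonempty scan-next l cl (λ ()) (λ _ _ → refl) f a
    ... | _ , p , _ , _ , f′ , a′ = scanned-after (λ ()) p (scan-formula φ f′ a′)

    reject-verdict : ∀ {c A} → (∃ λ c′ → c ⇒ c′ × (∃ λ p → Fresh c′ reject p)) → ¬ A → Verdict c A
    reject-verdict (c′ , p , _ , f) ¬a =
      verdict-after p (rejecting (prepare reject) (Fresh.state-≡ f) (λ ()) refl (fresh-within f) ¬a)

    first-step : ∃ λ c → initial machine ⇒ c × Fresh c scan-start 1
    first-step = fresh-step fresh-initial (λ ()) (λ _ _ → refl) refl

    -- `scan-start` and `scan-next` treat letters alike. They differ at the right endmarker: for the
    -- first it means the empty formula, for the second that all clauses have been checked.
    scan-all : ∀ cl φ → encode (cl ∷ φ) ≡ x → Scanned (initial machine) (cl ∷ φ)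
    scan-all cl φ x≡ with first-step
    scan-all [] φ x≡ | _ , p , f = inj₂ (((_ , p , f) ▷ λ f → fresh-step f (λ ()) (λ e w → cong (λ r → prepare-move scan-start r e w) (at-read start-text)) refl ▷ λ f′ →
                                    _ , [] , _ , f′) , here refl)
      where
      start-text : At 1 [] (4F ∷ encode φ)
      start-text = at x≡ refl
    scan-all (l ∷ cl) φ x≡ | _ , p , f with scan-nonempty scan-start l cl (λ ()) (λ _ _ → refl) f (at {u = []} x≡ refl)
    ... | _ , q , _ , _ , f′ , a′ = scanned-after (λ ()) (p ++ᶠ q) (scan-formula φ f′ a′)

    accept-empty : ∀ {A : Set} → [] ≡ x → A → Verdict (initial machine) A
    accept-empty x≡ a with first-step
    ... | _ , p , f with fresh-step {q′ = accept} {m = stay} f (λ ())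
                           (λ e w → cong (λ y → prepare-move scan-start (readIn y 1) e w) (≡.sym x≡)) refl
    ...   | _ , q , f′ = verdict-after (p ++ᶠ q) (accepting (Fresh.state-≡ f′) (fresh-within f′) a)

-- From a deterministic logspace machine for the complement to a solver

module Solver (M : NTM 5) (det : Deterministic M) (c : ℕ) (space : ∀ x → SpaceWithin M x (λ h → h ≤ c * ⌊log₂ length x ⌋ + c))
              (decides : ∀ x → Accepts M x ⇔ Accepts (Compiled.machine prover) x) (S : ℕ) (3+c≤S : 3 + c ≤ S) where

  b : ℕ
  b = proj₁ (accepting-time M c)

  open Complement M det b

  -- `M` needs `c` in both coefficients, and the clock needs ⌊log₂ n⌋ + 3; `3 + c ≤ S` covers both.
  -- Up to the form of the polynomial this is the polylogarithmic factor itself.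
  budget : ℕ → ℕ
  budget n = S * ⌊log₂ n ⌋ + S

  open Halting machine

  degree : ℕ
  degree = proj₁ (halting-time machine S)

  polynomial-time : ∀ {x s A} → s ≤ budget (length x) → Verdict x s (initial machine) A → TimeWithin machine x (degree * length x ^ degree + degree)
  polynomial-time {x} s≤ v = proj₂ (halting-time machine S) x _
    (λ t d r → VecAll.map (λ h≤ → ℕ.≤-trans h≤ s≤) (verdict-space _ _ v t d r)) (verdict-time _ _ v)

  avoids⇔rejects : ∀ x {T s} → suc b ^ suc ⌊log₂ length x ⌋ ≤ suc T → Execution.AvoidsAccept x s T (initial M) ⇔ (¬ Accepts M x)
  avoids⇔rejects x {T} T≥ = mk⇔ to from
    where
    to : (∀ t d → t ≤ T → Run (Step M x) t (initial M) d → state d ≢ qacc M) → ¬ Accepts M x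
    to avoids accepted with proj₂ (accepting-time M c) x (space x) accepted
    ... | u , e , u<K , r , final = avoids u e (ℕ.≤-pred (ℕ.≤-trans u<K T≥)) (reach⇒run M x r) final
    from : ¬ Accepts M x → ∀ t d → t ≤ T → Run (Step M x) t (initial M) d → state d ≢ qacc M
    from rejects t d _ p final = rejects (t , d , run⇒reach M x p , final)

  satisfiable⇔rejects : ∀ {φ} → TwoSat φ → Satisfiable φ ⇔ (¬ Accepts M (encode φ))
  satisfiable⇔rejects {φ} clauses = mk⇔ sound complete
    where
    open ProverRuns φ clauses
    open Equivalence
    sound : Satisfiable φ → ¬ Accepts M (encode φ)
    sound sat accepted with Compiled.accepts⇔run prover (encode φ) .to (decides (encode φ) .to accepted)
    ... | _ , _ , p = satisfiable⇒consistent sat (wins⇒contradictory p)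
    complete : ¬ Accepts M (encode φ) → Satisfiable φ
    complete rejected = consistent⇒satisfiable clauses λ contra →
      rejected (decides (encode φ) .from (Compiled.accepts⇔run prover (encode φ) .from (contradictory⇒wins contra)))

  empty-clause : ∀ {φ} → [] ∈ φ → ¬ Satisfiable φ
  empty-clause []∈ (_ , sat) with All.lookup sat []∈
  ... | ()

  two-sat : ∀ {φ} → All (λ cl → length cl ≤ 2) φ → [] ∉ φ → TwoSat φ
  two-sat []                       _  = []
  two-sat {[] ∷ φ}       (_  ∷ _)  ∉ = contradiction (here refl) ∉
  two-sat {(_ ∷ _) ∷ φ} (≤2 ∷ ≤2s) ∉ = (s≤s z≤n , ≤2) ∷ two-sat ≤2s (∉ ∘ there)

  M-space≤ : ∀ n → c * ⌊log₂ n ⌋ + c ≤ budget n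
  M-space≤ n = ℕ.+-mono-≤ (ℕ.*-monoˡ-≤ ⌊log₂ n ⌋ c≤S) c≤S
    where
    c≤S : c ≤ S
    c≤S = ℕ.≤-trans (ℕ.m≤n+m c 3) 3+c≤S

  clock-space≤ : ∀ n → suc (suc ⌊log₂ suc n ⌋) ≤ budget n
  clock-space≤ n = begin
    suc (suc ⌊log₂ suc n ⌋)     ≤⟨ s≤s (s≤s (log₂-suc≤ n)) ⟩
    3 + ⌊log₂ n ⌋               ≡⟨ ℕ.+-comm 3 ⌊log₂ n ⌋ ⟩
    ⌊log₂ n ⌋ + 3               ≡⟨ cong (_+ 3) (ℕ.*-identityˡ ⌊log₂ n ⌋) ⟨
    1 * ⌊log₂ n ⌋ + 3           ≤⟨ ℕ.+-mono-≤ (ℕ.*-monoˡ-≤ ⌊log₂ n ⌋ (ℕ.≤-trans (s≤s z≤n) 3≤S)) 3≤S ⟩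
    S * ⌊log₂ n ⌋ + S           ∎
    where
    open ℕ.≤-Reasoning
    3≤S : 3 ≤ S
    3≤S = ℕ.≤-trans (ℕ.m≤m+n 3 c) 3+c≤S

  race-halts : ∀ x {d} → Execution.Fresh x (budget (length x)) d scan-next (suc (length x)) →
               Verdict x (budget (length x)) d (¬ Accepts M x)
  race-halts x f =
    let T , T≥ , v = Execution.race-result x (budget (length x))
                       (λ t d r → VecAll.map (λ h≤ → ℕ.≤-trans h≤ (M-space≤ (length x))) (space x t d r)) (clock-space≤ (length x)) f
        -- The module parameter `s` is set to an arbitrary value: `AvoidsAccept` unfolds to the same
        -- predicate for each.
        equivalence = avoids⇔rejects x {s = 0} T≥
    in verdict-⇔ x _ (equivalence .Equivalence.to) (equivalence .Equivalence.from) v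

  -- If the first clause has a literal, there is a variable and the whole budget is available.
  -- Otherwise the formula is empty or its first letter already shows an empty clause, and the
  -- verdict is reached during the scan in space 0.
  result : ∀ φ → All (λ cl → length cl ≤ 2) φ →
           Verdict (encode φ) 0 (initial machine) (Satisfiable φ) ⊎ (1 ≤ mvbl φ × Verdict (encode φ) (budget (length (encode φ))) (initial machine) (Satisfiable φ))
  result [] _ = inj₁ (Execution.accept-empty [] 0 refl ((λ _ → false) , []))
  result ([] ∷ φ) _ with Execution.scan-all (encode ([] ∷ φ)) 0 [] φ refl
  ... | inj₁ (_ , _ , _ , ∉)    = contradiction (here refl) ∉
  ... | inj₂ (rejected , []∈) = inj₁ (Execution.reject-verdict (encode ([] ∷ φ)) 0 rejected (empty-clause []∈))
  result φ′@((l ∷ cl) ∷ φ) ≤2 with Execution.scan-all (encode φ′) (budget (length (encode φ′))) (l ∷ cl) φ refl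
  ... | inj₂ (rejected , []∈) = inj₂ (s≤s z≤n , Execution.reject-verdict (encode φ′) _ rejected (empty-clause []∈))
  ... | inj₁ (_ , p , f , ∉)  = inj₂ (s≤s z≤n , verdict-after (encode φ′) _ p
          (verdict-⇔ (encode φ′) _ (sat .Equivalence.from) (sat .Equivalence.to) (race-halts (encode φ′) f)))
    where
    sat : Satisfiable φ′ ⇔ (¬ Accepts M (encode φ′))
    sat = satisfiable⇔rejects (two-sat ≤2 ∉)

  solves : Solves2SAT₃ machine degree degree 1 2 (S ∷ S ∷ [])
  solves φ (≤2 , _) with result φ ≤2
  -- All heads are at 0 here, and `0 ^ 2` satisfies every bound, also the bound 0 of a formula
  -- without variables.
  ... | inj₁ v = polynomial-time z≤n v , (λ t d r → VecAll.map (λ { z≤n → z≤n }) (verdict-space _ _ v t d r)) , verdict-accepts _ _ v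
  ... | inj₂ (m≥1 , v) = polynomial-time ℕ.≤-refl v , (λ t d r → VecAll.map fits (verdict-space _ _ v t d r)) , verdict-accepts _ _ v
    where
    n : ℕ
    n = length (encode φ)
    fits : ∀ {h} → h ≤ budget n → h ^ 2 ≤ mvbl φ ^ 1 * polylog (S ∷ S ∷ []) n ^ 2
    fits {h} h≤ = begin
      h ^ 2                                          ≤⟨ ℕ.^-monoˡ-≤ 2 h≤ ⟩
      budget n ^ 2                                   ≡⟨ cong (_^ 2) (solve 2 (λ S l → S :* l :+ S := S :+ l :* (S :+ l :* con 0)) refl S ⌊log₂ n ⌋) ⟩
      polylog (S ∷ S ∷ []) n ^ 2                     ≡⟨ ℕ.*-identityˡ _ ⟨
      1 * polylog (S ∷ S ∷ []) n ^ 2                 ≤⟨ ℕ.*-monoˡ-≤ (polylog (S ∷ S ∷ []) n ^ 2) (subst (1 ≤_) (≡.sym (ℕ.^-identityʳ (mvbl φ))) m≥1) ⟩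
      mvbl φ ^ 1 * polylog (S ∷ S ∷ []) n ^ 2        ∎
      where
      open ℕ.≤-Reasoning
      open +-*-Solver

theorem2 : LSH → L≢NL
theorem2 lsh L≡NL =
  let N = Compiled.machine prover
      -- The language is the set of words accepted by `N`, so `N` decides it by definition. What `N`
      -- does on words that encode no formula then never has to be analysed.
      M , det , (c , space) , decides =
        Equivalence.from (L≡NL 5 (Accepts N)) (N , Compiled.logSpace prover , λ _ → mk⇔ id id)
      open Solver M det c space (λ x → mk⇔ (Equivalence.from (decides x)) (Equivalence.to (decides x))) (3 + c) ℕ.≤-refl
  -- The exponent 1/2 is an arbitrary choice in (0,1); the space beyond it is absorbed by the linear
  -- polynomial in log n with both coefficients `3 + c`.
  in lsh 1 2 (s≤s z≤n) (s≤s (s≤s z≤n)) ((3 + c) ∷ (3 + c) ∷ [])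
       (Complement.machine M det b , Complement.deterministic M det b , degree , degree , solves)
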